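{- Let $n=\prod_i p_i^{r_i}$ be a composite positive integer, with distinct primes $p_i$ and $r_i\ge1$. For each $i$ set $$C_i=\tfrac12\left(\gcd(n^2-1,p_i-1)-\gcd(n-1,p_i-1)\right),$$ $$D_i=\tfrac12\left(\gcd(p_i^2-1,n^2-1,n-p_i)-\gcd(n-1,p_i-1)\right).$$ Then $$L_2^-(n)=\frac12\prod_i (C_i+D_i)-\frac12\prod_{i:\,2\mid r_i}(C_i+D_i)\prod_{i:\,2\nmid r_i}(C_i-D_i).$$
   Context: For a positive integer $m$ and monic $g_1,g_2,h\in(\mathbb{Z}/m\mathbb{Z})[x]$, $\mathrm{gcmd}(g_1,g_2)=h$ means that the ideal generated by $g_1,g_2$ in $(\mathbb{Z}/m\mathbb{Z})[x]$ equals the ideal generated by $h$. A composite $n$ is a degree-2 Frobenius pseudoprime with respect to a monic quadratic $f$ with discriminant $\Delta$ (equivalently, $f$ is a liar for $n$) if all of the following hold: (1) $\gcd(n,f(0)\Delta)=1$; (2) modulo $n$, the polynomials $F_1=\mathrm{gcmd}(x^n-x,f)$, $f_1=f/F_1$, $F_2=\mathrm{gcmd}(x^{n^2}-x,f_1)$ and $f_2=f_1/F_2$ all exist, and $f_2=1$; (3) $F_2(x)\mid F_2(x^n)$; (4) $(-1)^{\deg(F_2)/2}=\left(\frac{\Delta}{n}\right)$ (Jacobi symbol). These conditions depend only on $f$ modulo $n$. $L_2^-(n)$ is the number of monic quadratic polynomials $f\in(\mathbb{Z}/n\mathbb{Z})[x]$ that are liars for $n$ and satisfy $\left(\frac{\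Delta}{n}\right)=-1$.
   Formalization: The composite integer n is additionally assumed odd, because the Jacobi symbol (Δ/n) in the definitions of liar and of L_2^-(n) is undefined for even n. -}

module Defs where

open import Data.Nat as ℕ using (ℕ; zero; suc; _<_)
open import Data.Nat.Divisibility as ℕD using (_∣?_)
open import Data.Nat.GCD using (gcd)
open import Data.Nat.Primality using (Prime)
open import Data.Integer as ℤ using (ℤ; +_; 0ℤ; 1ℤ; -1ℤ; _%ℕ_)
open import Data.Integer.Divisibility as ℤD using ()
open import Data.Rational as ℚ using (ℚ; ½)
open import Data.List using (List; []; _∷_; map; foldr; replicate; _++_; length; upTo)
open import Data.Bool.ListAction using (any)
open import Data.List.Relation.Unary.All using (All)
open import Data.List.Relation.Unary.Unique.Propositional using (Unique)
open import Data.List.Membership.Propositional using (_∈_)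
open import Data.Product using (Σ; ∃; ∃-syntax; _×_; _,_; proj₁)
open import Data.Bool using (if_then_else_)
open import Relation.Nullary using (does)
open import Relation.Binary.PropositionalEquality using (_≡_)

-- Polynomials with integer coefficients (lowest degree first), viewed
-- as representatives of elements of (ℤ/nℤ)[x].

Poly : Set
Poly = List ℤ

coeff : Poly → ℕ → ℤ
coeff []       _       = 0ℤ
coeff (a ∷ p)  zero    = a
coeff (a ∷ p)  (suc k) = coeff p k

infixl 6 _+ₚ_ _-ₚ_
infixl 7 _*ₚ_

_+ₚ_ : Poly → Poly → Poly
[]      +ₚ q       = q
(a ∷ p) +ₚ []      = a ∷ p
(a ∷ p) +ₚ (b ∷ q) = (a ℤ.+ b) ∷ (p +ₚ q)

negₚ : Poly → Poly
negₚ = map (λ a → ℤ.- a)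

_-ₚ_ : Poly → Poly → Poly
p -ₚ q = p +ₚ negₚ q

_*ₚ_ : Poly → Poly → Poly
[]      *ₚ q = []
(a ∷ p) *ₚ q = map (a ℤ.*_) q +ₚ (0ℤ ∷ (p *ₚ q))

oneₚ : Poly
oneₚ = 1ℤ ∷ []

Xpow : ℕ → Poly
Xpow m = replicate m 0ℤ ++ (1ℤ ∷ [])

compose : Poly → Poly → Poly
compose []      g = []
compose (a ∷ p) g = (a ∷ []) +ₚ (g *ₚ compose p g)

PolyEq : ℕ → Poly → Poly → Set
PolyEq n p q = ∀ k → (+ n) ℤD.∣ (coeff p k ℤ.- coeff q k)

MonicDeg : ℕ → Poly → ℕ → Set
MonicDeg n h d = ((+ n) ℤD.∣ (coeff h d ℤ.- 1ℤ)) × (∀ k → d < k → (+ n) ℤD.∣ coeff h k)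

Monic : ℕ → Poly → Set
Monic n h = ∃[ d ] MonicDeg n h d

InIdeal₂ : ℕ → Poly → Poly → Poly → Set
InIdeal₂ n g₁ g₂ q = ∃[ a ] ∃[ b ] PolyEq n (a *ₚ g₁ +ₚ b *ₚ g₂) q

InIdeal₁ : ℕ → Poly → Poly → Set
InIdeal₁ n h q = ∃[ a ] PolyEq n (a *ₚ h) q

IsGcmd : ℕ → Poly → Poly → Poly → Set
IsGcmd n g₁ g₂ h =
  Monic n h × (∀ q → (InIdeal₂ n g₁ g₂ q → InIdeal₁ n h q) × (InIdeal₁ n h q → InIdeal₂ n g₁ g₂ q))

-- Legendre symbol (a/p); p is assumed prime (value at p = 0 is junk)
legendre : ℤ → ℕ → ℤ
legendre a zero    = 0ℤ
legendre a (suc q) =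
  let r = a %ℕ suc q in
  if does (r ℕ.≟ 0) then 0ℤ
  else if any (λ x → does (((x ℕ.* x) ℕ.% suc q) ℕ.≟ r)) (upTo (suc q)) then 1ℤ
  else -1ℤ

-- A prime factorisation: list of (pᵢ , rᵢ)
Factorisation : Set
Factorisation = List (ℕ × ℕ)

IsPrimeFactorisation : ℕ → Factorisation → Set
IsPrimeFactorisation n fs =
  All (λ pr → Prime (proj₁ pr)) fs ×
  All (λ pr → 1 ℕ.≤ Data.Product.proj₂ pr) fs ×
  Unique (map proj₁ fs) ×
  n ≡ foldr (λ pr acc → (proj₁ pr ℕ.^ Data.Product.proj₂ pr) ℕ.* acc) 1 fs

jacobi : Factorisation → ℤ → ℤ
jacobi fs a = foldr (λ pr acc → (legendre a (proj₁ pr) ℤ.^ Data.Product.proj₂ pr) ℤ.* acc) 1ℤ fs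

-- Monic quadratic f = x² + b x + c and degree-2 Frobenius liars

quad : ℕ → ℕ → Poly
quad b c = (+ c) ∷ (+ b) ∷ 1ℤ ∷ []

disc : ℕ → ℕ → ℤ
disc b c = (+ b) ℤ.* (+ b) ℤ.- (+ 4) ℤ.* (+ c)

Liar : ℕ → Factorisation → ℕ → ℕ → Set
Liar n fs b c =
  gcd n ℤ.∣ (+ c) ℤ.* disc b c ∣ ≡ 1 ×
  (∃[ F₁ ] ∃[ f₁ ] ∃[ F₂ ] ∃[ f₂ ]
     IsGcmd n (Xpow n -ₚ Xpow 1) (quad b c) F₁ ×
     PolyEq n (F₁ *ₚ f₁) (quad b c) ×
     IsGcmd n (Xpow (n ℕ.* n) -ₚ Xpow 1) f₁ F₂ ×
     PolyEq n (F₂ *ₚ f₂) f₁ ×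
     PolyEq n f₂ oneₚ ×
     (∃[ q ] PolyEq n (q *ₚ F₂) (compose F₂ (Xpow n))) ×
     (∃[ d ] MonicDeg n F₂ d × -1ℤ ℤ.^ (d ℕ./ 2) ≡ jacobi fs (disc b c)))

LiarMinus : ℕ → Factorisation → ℕ → ℕ → Set
LiarMinus n fs b c = Liar n fs b c × jacobi fs (disc b c) ≡ -1ℤ

IsCount : ℕ → (ℕ → ℕ → Set) → ℕ → Set
IsCount n P k =
  Σ (List (ℕ × ℕ)) λ xs →
    Unique xs ×
    (∀ b c → ((b , c) ∈ xs → (b < n × c < n × P b c)) × ((b < n × c < n × P b c) → (b , c) ∈ xs)) ×
    length xs ≡ k

toℚ : ℕ → ℚ
toℚ m = (+ m) ℚ./ 1

Cᵢ : ℕ → ℕ → ℚ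
Cᵢ n p = ½ ℚ.* (toℚ (gcd (n ℕ.* n ℕ.∸ 1) (p ℕ.∸ 1)) ℚ.- toℚ (gcd (n ℕ.∸ 1) (p ℕ.∸ 1)))

Dᵢ : ℕ → ℕ → ℚ
Dᵢ n p = ½ ℚ.* (toℚ (gcd (p ℕ.* p ℕ.∸ 1) (gcd (n ℕ.* n ℕ.∸ 1) (n ℕ.∸ p)))
                 ℚ.- toℚ (gcd (n ℕ.∸ 1) (p ℕ.∸ 1)))

prodCD : ℕ → Factorisation → ℚ
prodCD n fs = foldr (λ pr acc → (Cᵢ n (proj₁ pr) ℚ.+ Dᵢ n (proj₁ pr)) ℚ.* acc) ℚ.1ℚ fs

prodSigned : ℕ → Factorisation → ℚ
prodSigned n fs =
  foldr (λ pr acc →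
           (if does (2 ∣? Data.Product.proj₂ pr)
              then Cᵢ n (proj₁ pr) ℚ.+ Dᵢ n (proj₁ pr)
              else Cᵢ n (proj₁ pr) ℚ.- Dᵢ n (proj₁ pr)) ℚ.* acc)
        ℚ.1ℚ fs

formula : ℕ → Factorisation → ℚ
formula n fs = ½ ℚ.* prodCD n fs ℚ.- ½ ℚ.* prodSigned n fs

{-# OPTIONS --safe #-}
module Submission where

-- If (Δ/n) = -1, condition (4) forces deg F₂ = 2, hence F₁ = 1 and F₂ = f, and then (2) and (3) say that X and Xⁿ are
-- roots of f = X² + bX + c differing by a unit, i.e. Xⁿ = X̄ := - b - X modulo f and n (conversely Xⁿ = X̄ gives
-- X^(n²) = X by conjugation). So with A the number of f with Xⁿ = X̄ and n prime to cΔ, and B the same count weighted by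
-- (Δ/n), the number of liars is (A - B)/2, and A and B are multiplicative by the Chinese remainder theorem.
--
-- From p to pʳ nothing changes: a solution is a fixed point of the map sending f to the quadratic with roots Xⁿ, X̄ⁿ,
-- which contracts p-adically because p ∣ n, so every solution modulo pᵏ lifts uniquely.
--
-- Modulo p, f is counted by its roots α: if (Δ/p) = 1 these are the α in 𝔽ₚ with αⁿ ≠ α and α^(n²) = α; if (Δ/p) = -1,
-- the α in 𝔽ₚ[√g] off 𝔽ₚ with αⁿ = ᾱ = αᵖ. Both numbers are read off from the number of solutions of xᵐ = 1 in a
-- finite field.

open import Defs
open import Algebra.Bundles using (CommutativeSemiring; CommutativeRing)
import Algebra.Properties.CommutativeSemiring.Binomial as Binomial
import Algebra.Properties.CommutativeSemiring.Exp
import Algebra.Properties.Group as GroupProperties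
import Algebra.Properties.Ring as RingProperties
import Algebra.Properties.Semiring.Exp
import Algebra.Properties.Semiring.Mult
import Algebra.Properties.Semiring.Sum
import Algebra.Solver.Ring.NaturalCoefficients.Default as CSSolver
open import Data.Bool using (Bool; true; false; T; if_then_else_)
open import Data.Bool.ListAction using (any)
open import Data.Fin as Fin using (Fin; toℕ; fromℕ)
import Data.Fin.Properties as Finₚ
open import Data.Integer as ℤ using (ℤ; +_; 0ℤ; 1ℤ; _≤_)
import Data.Integer.DivMod as ℤ/
open import Data.Integer.Divisibility.Signed as ℤ∣ using (divides; ∣ᵤ⇒∣; ∣⇒∣ᵤ) renaming (_∣_ to _∣ᶻ_)
import Data.Integer.Properties as ℤₚ
open import Data.Integer.Tactic.RingSolver using (solve-∀)
open import Data.List using (List; []; _∷_; map; _++_; length; cartesianProduct; filter; foldr; upTo; applyUpTo)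
open import Data.List.Membership.Propositional using (_∈_; find; lose)
open import Data.List.Membership.Propositional.Properties using (∈-upTo⁺; ∈-upTo⁻; ∈-filter⁺; ∈-filter⁻; ∈-cartesianProduct⁺; ∈-cartesianProduct⁻)
open import Data.List.Properties using (length-map; length-upTo)
open import Data.List.Relation.Unary.All as All using (All; []; _∷_)
open import Data.List.Relation.Unary.AllPairs using ([]; _∷_)
open import Data.List.Relation.Unary.Any.Properties using (any⁺; any⁻)
open import Data.List.Relation.Unary.Unique.Propositional using (Unique)
open import Data.List.Relation.Unary.Unique.Propositional.Properties using () renaming (cartesianProduct⁺ to Unique-cartesianProduct; filter⁺ to Unique-filter; upTo⁺ to Unique-upTo)
open import Data.Nat as ℕ using (ℕ; zero; suc)
open import Data.Nat.Base using (_!)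
open import Data.Nat.Combinatorics using (_C_; nCn≡1; nCk≡nC[n∸k]; nCk≡n!/k![n-k]!; k![n∸k]!∣n!)
open import Data.Nat.Coprimality using (coprime-Bézout; gcd≡1⇒coprime)
import Data.Nat.DivMod as ℕ/
open import Data.Nat.Divisibility as ℕ∣ using (_∣_)
open import Data.Nat.GCD using (gcd; gcd[m,n]∣m; gcd[m,n]∣n; gcd-greatest; gcd-GCD; module Bézout)
open import Data.Nat.Primality using (Composite; composite⇒nonTrivial; Prime; prime⇒nonZero; prime⇒nonTrivial; prime⇒irreducible; euclidsLemma)
import Data.Nat.Properties as ℕₚ
open import Data.Nat.Tactic.RingSolver using () renaming (solve-∀ to ℕ-solve-∀)
open import Data.Product using (Σ; ∃; _×_; _,_; proj₁; proj₂; uncurry)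
open import Data.Rational as ℚ using (ℚ; ½)
import Data.Rational.Properties as ℚₚ
import Data.Rational.Unnormalised as ℚᵘ
import Data.Rational.Unnormalised.Properties as ℚᵘₚ
open import Data.Sum as Sum using (_⊎_; inj₁; inj₂)
open import Data.Vec using (Vec; []; _∷_; replicate) renaming (_++_ to _++ᵛ_)
open import Function using (_∘_)
open import Level using (0ℓ)
open import Relation.Binary.PropositionalEquality as ≡ using (_≡_; module ≡-Reasoning)
open import Relation.Binary.Structures using (IsEquivalence)
open import Relation.Nullary using (¬_; Dec; yes; no; ¬?; contradiction; does)
open import Relation.Nullary.Decidable as Dec using (_×-dec_; _⊎-dec_)

-- Sums over representatives of finite setoids

-- The ½ in Cᵢ and Dᵢ comes from counting a quadratic by its two roots. If αⁿ = ᾱ and ᾱⁿ = α with α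
-- ≠ ᾱ in 𝔽ₚ, then α^(n²-1) = 1 but α^(n-1) ≠ 1, whence gcd(n²-1, p-1) - gcd(n-1, p-1). Off 𝔽ₚ the
-- condition is α^(n-p) = 1 in a group of order p²-1, and the solutions inside 𝔽ₚ, gcd(n-p, p-1) =
-- gcd(n-1, p-1) in number, are removed. Weighing by (Δ/p)ʳ replaces Dᵢ by (-1)ʳDᵢ, which is why the
-- parity of rᵢ enters.
--
-- Solutions of xᵈ = 1 are counted without generators of the multiplicative group, from the bound on
-- the number of roots of a polynomial and the identity x^q = x.
--
-- The obstacle in lifting is that Xⁿ = X̄ is not itself a fixed-point equation. Its trace and norm
-- are: they say that (b, c) equals (- Tr Xⁿ, N Xⁿ), which varies with (b, c) through differentials
-- divisible by n. But they hold for Xⁿ = X as well; since Δ is a unit, the solution modulo p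
-- excludes this alternative.

module Sums where
  open import Data.Integer using (_+_; _*_; _-_; -_)
  open import Relation.Binary.PropositionalEquality using (refl; sym; trans; cong; cong₂; subst)

  private variable
    A B : Set
    P Q : Set

  ∑ : (A → ℤ) → List A → ℤ
  ∑ f []       = 0ℤ
  ∑ f (x ∷ xs) = f x + ∑ f xs

  ∑-cong : {f g : A → ℤ} → (∀ x → f x ≡ g x) → ∀ xs → ∑ f xs ≡ ∑ g xs
  ∑-cong f≡g []       = refl
  ∑-cong f≡g (x ∷ xs) = cong₂ _+_ (f≡g x) (∑-cong f≡g xs)

  ∑-mono : {f g : A → ℤ} → (∀ x → f x ≤ g x) → ∀ xs → ∑ f xs ≤ ∑ g xs
  ∑-mono f≤g []       = ℤₚ.≤-refl
  ∑-mono f≤g (x ∷ xs) = ℤₚ.+-mono-≤ (f≤g x) (∑-mono f≤g xs)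

  ∑-0 : (xs : List A) → ∑ (λ _ → 0ℤ) xs ≡ 0ℤ
  ∑-0 []       = refl
  ∑-0 (x ∷ xs) = trans (ℤₚ.+-identityˡ _) (∑-0 xs)

  ∑-+ : (f g : A → ℤ) (xs : List A) → ∑ (λ x → f x + g x) xs ≡ ∑ f xs + ∑ g xs
  ∑-+ f g []       = refl
  ∑-+ f g (x ∷ xs) = trans (cong (_+_ (f x + g x)) (∑-+ f g xs)) (interchange (f x) (g x) (∑ f xs) (∑ g xs))
    where
    interchange : ∀ a b c d → (a + b) + (c + d) ≡ (a + c) + (b + d)
    interchange = solve-∀

  ∑-*ˡ : (k : ℤ) (f : A → ℤ) (xs : List A) → ∑ (λ x → k * f x) xs ≡ k * ∑ f xs
  ∑-*ˡ k f []       = sym (ℤₚ.*-zeroʳ k)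
  ∑-*ˡ k f (x ∷ xs) = trans (cong (_+_ (k * f x)) (∑-*ˡ k f xs)) (sym (ℤₚ.*-distribˡ-+ k (f x) (∑ f xs)))

  ∑-*ʳ : (k : ℤ) (f : A → ℤ) (xs : List A) → ∑ (λ x → f x * k) xs ≡ ∑ f xs * k
  ∑-*ʳ k f xs = trans (∑-cong (λ x → ℤₚ.*-comm (f x) k) xs) (trans (∑-*ˡ k f xs) (ℤₚ.*-comm k _))

  ∑-neg : (f : A → ℤ) (xs : List A) → ∑ (λ x → - f x) xs ≡ - ∑ f xs
  ∑-neg f []       = refl
  ∑-neg f (x ∷ xs) = trans (cong (_+_ (- f x)) (∑-neg f xs)) (sym (ℤₚ.neg-distrib-+ (f x) (∑ f xs)))

  ∑-- : (f g : A → ℤ) (xs : List A) → ∑ (λ x → f x - g x) xs ≡ ∑ f xs - ∑ g xs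
  ∑-- f g xs = trans (∑-+ f (λ x → - g x) xs) (cong (_+_ (∑ f xs)) (∑-neg g xs))

  ∑-comm : (f : A → B → ℤ) (xs : List A) (ys : List B) →
           ∑ (λ x → ∑ (f x) ys) xs ≡ ∑ (λ y → ∑ (λ x → f x y) xs) ys
  ∑-comm f []       ys = sym (∑-0 ys)
  ∑-comm f (x ∷ xs) ys = trans (cong (_+_ (∑ (f x) ys)) (∑-comm f xs ys))
    (sym (∑-+ (f x) (λ y → ∑ (λ x → f x y) xs) ys))

  ∑-map : (f : B → ℤ) (h : A → B) (xs : List A) → ∑ f (map h xs) ≡ ∑ (λ x → f (h x)) xs
  ∑-map f h []       = refl
  ∑-map f h (x ∷ xs) = cong (_+_ (f (h x))) (∑-map f h xs)

  ∑-++ : (f : A → ℤ) (xs ys : List A) → ∑ f (xs ++ ys) ≡ ∑ f xs + ∑ f ys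
  ∑-++ f []       ys = sym (ℤₚ.+-identityˡ _)
  ∑-++ f (x ∷ xs) ys = trans (cong (_+_ (f x)) (∑-++ f xs ys)) (sym (ℤₚ.+-assoc (f x) _ _))

  ∑-cartesianProduct : (f : A × B → ℤ) (xs : List A) (ys : List B) →
                       ∑ f (cartesianProduct xs ys) ≡ ∑ (λ x → ∑ (λ y → f (x , y)) ys) xs
  ∑-cartesianProduct f []       ys = refl
  ∑-cartesianProduct f (x ∷ xs) ys =
    trans (∑-++ f (map (x ,_) ys) (cartesianProduct xs ys))
          (cong₂ _+_ (∑-map f (x ,_) ys) (∑-cartesianProduct f xs ys))

  ∑-∑-* : (f : A → ℤ) (g : B → ℤ) (xs : List A) (ys : List B) →
          ∑ (λ x → ∑ (λ y → f x * g y) ys) xs ≡ ∑ f xs * ∑ g ys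
  ∑-∑-* f g xs ys = trans (∑-cong (λ x → ∑-*ˡ (f x) g ys) xs) (∑-*ʳ (∑ g ys) f xs)

  ∑-1 : (xs : List A) → ∑ (λ _ → 1ℤ) xs ≡ + length xs
  ∑-1 []       = refl
  ∑-1 (x ∷ xs) = cong (_+_ 1ℤ) (∑-1 xs)

  -- Iverson bracket, with values in ℤ so that counts can be weighed by the signs of Legendre and
  -- Jacobi symbols.
  ⟦_⟧ : Dec P → ℤ
  ⟦ yes _ ⟧ = 1ℤ
  ⟦ no  _ ⟧ = 0ℤ

  ⟦⟧-cong : (p? : Dec P) (q? : Dec Q) → (P → Q) → (Q → P) → ⟦ p? ⟧ ≡ ⟦ q? ⟧
  ⟦⟧-cong (yes p) (yes q) to from = refl
  ⟦⟧-cong (yes p) (no ¬q) to from = contradiction (to p) ¬q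
  ⟦⟧-cong (no ¬p) (yes q) to from = contradiction (from q) ¬p
  ⟦⟧-cong (no ¬p) (no ¬q) to from = refl

  ⟦⟧-mono : (p? : Dec P) (q? : Dec Q) → (P → Q) → ⟦ p? ⟧ ≤ ⟦ q? ⟧
  ⟦⟧-mono (yes p) (yes q) to = ℤₚ.≤-refl
  ⟦⟧-mono (yes p) (no ¬q) to = contradiction (to p) ¬q
  ⟦⟧-mono (no ¬p) (yes q) to = ℤ.+≤+ ℕ.z≤n
  ⟦⟧-mono (no ¬p) (no ¬q) to = ℤₚ.≤-refl

  ⟦⟧-yes : (p? : Dec P) → P → ⟦ p? ⟧ ≡ 1ℤ
  ⟦⟧-yes (yes _) p = refl
  ⟦⟧-yes (no ¬p) p = contradiction p ¬p

  ⟦⟧-no : (p? : Dec P) → ¬ P → ⟦ p? ⟧ ≡ 0ℤ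
  ⟦⟧-no (yes p) ¬p = contradiction p ¬p
  ⟦⟧-no (no _)  ¬p = refl

  ⟦⟧-× : (p? : Dec P) (q? : Dec Q) → ⟦ p? ×-dec q? ⟧ ≡ ⟦ p? ⟧ * ⟦ q? ⟧
  ⟦⟧-× (yes p) (yes q) = refl
  ⟦⟧-× (yes p) (no ¬q) = refl
  ⟦⟧-× (no ¬p) _       = refl

  ⟦⟧-⊎-≤ : (p? : Dec P) (q? : Dec Q) → ⟦ p? ⊎-dec q? ⟧ ≤ ⟦ p? ⟧ + ⟦ q? ⟧
  ⟦⟧-⊎-≤ (yes p) (yes q) = ℤ.+≤+ (ℕ.s≤s ℕ.z≤n)
  ⟦⟧-⊎-≤ (yes p) (no ¬q) = ℤₚ.≤-refl
  ⟦⟧-⊎-≤ (no ¬p) (yes q) = ℤₚ.≤-refl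
  ⟦⟧-⊎-≤ (no ¬p) (no ¬q) = ℤₚ.≤-refl

  ⟦⟧-⊎ : (p? : Dec P) (q? : Dec Q) → ¬ (P × Q) → ⟦ p? ⊎-dec q? ⟧ ≡ ⟦ p? ⟧ + ⟦ q? ⟧
  ⟦⟧-⊎ (yes p) (yes q) ¬pq = contradiction (p , q) ¬pq
  ⟦⟧-⊎ (yes p) (no ¬q) ¬pq = refl
  ⟦⟧-⊎ (no ¬p) (yes q) ¬pq = refl
  ⟦⟧-⊎ (no ¬p) (no ¬q) ¬pq = refl

  -- Constructive use of a count: searching the list either delivers a witness or certifies that the
  -- count is zero, so a nonzero count proves existence.
  ∃⊎∑≡0 : {P : A → Set} (P? : ∀ x → Dec (P x)) (xs : List A) → ∃ P ⊎ ∑ (λ x → ⟦ P? x ⟧) xs ≡ 0ℤ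
  ∃⊎∑≡0 P? []       = inj₂ refl
  ∃⊎∑≡0 P? (x ∷ xs) with P? x | ∃⊎∑≡0 P? xs
  ... | yes p | _       = inj₁ (x , p)
  ... | no ¬p | inj₁ e  = inj₁ e
  ... | no ¬p | inj₂ eq = inj₂ (trans (ℤₚ.+-identityˡ _) eq)

  ∑-filter : {P : A → Set} (P? : ∀ x → Dec (P x)) (xs : List A) →
             ∑ (λ x → ⟦ P? x ⟧) xs ≡ + length (filter P? xs)
  ∑-filter P? []       = refl
  ∑-filter P? (x ∷ xs) with P? x
  ... | yes p = cong (_+_ 1ℤ) (∑-filter P? xs)
  ... | no ¬p = trans (ℤₚ.+-identityˡ _) (∑-filter P? xs)

  -- `enum` makes every class occur exactly once in `elems`. It is phrased as a sum of brackets
  -- because it serves to insert a factor 1 into other sums.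
  record FiniteSetoid : Set₁ where
    infix 4 _≈_ _≈?_
    field
      {Carrier} : Set
      _≈_       : Carrier → Carrier → Set
      _≈?_      : ∀ x y → Dec (x ≈ y)
      ≈-sym     : ∀ {x y} → x ≈ y → y ≈ x
      elems     : List Carrier
      enum      : ∀ z → ∑ (λ x → ⟦ x ≈? z ⟧) elems ≡ 1ℤ

  open FiniteSetoid

  infixr 2 _×ᶠ_
  _×ᶠ_ : FiniteSetoid → FiniteSetoid → FiniteSetoid
  S ×ᶠ T = record
    { _≈_   = λ (x , y) (x′ , y′) → S ._≈_ x x′ × T ._≈_ y y′
    ; _≈?_  = λ (x , y) (x′ , y′) → S ._≈?_ x x′ ×-dec T ._≈?_ y y′
    ; ≈-sym = λ (p , q) → S .≈-sym p , T .≈-sym q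
    ; elems = cartesianProduct (S .elems) (T .elems)
    ; enum  = λ (x′ , y′) → begin
        ∑ (λ (x , y) → ⟦ S ._≈?_ x x′ ×-dec T ._≈?_ y y′ ⟧) (cartesianProduct (S .elems) (T .elems))
          ≡⟨ ∑-cartesianProduct _ (S .elems) (T .elems) ⟩
        ∑ (λ x → ∑ (λ y → ⟦ S ._≈?_ x x′ ×-dec T ._≈?_ y y′ ⟧) (T .elems)) (S .elems)
          ≡⟨ ∑-cong (λ x → ∑-cong (λ y → ⟦⟧-× (S ._≈?_ x x′) (T ._≈?_ y y′)) (T .elems)) (S .elems) ⟩
        ∑ (λ x → ∑ (λ y → ⟦ S ._≈?_ x x′ ⟧ * ⟦ T ._≈?_ y y′ ⟧) (T .elems)) (S .elems)
          ≡⟨ ∑-∑-* _ _ (S .elems) (T .elems) ⟩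
        ∑ (λ x → ⟦ S ._≈?_ x x′ ⟧) (S .elems) * ∑ (λ y → ⟦ T ._≈?_ y y′ ⟧) (T .elems)
          ≡⟨ cong₂ _*_ (S .enum x′) (T .enum y′) ⟩
        1ℤ ∎
    }
    where open ≡-Reasoning

  -- Multiply each term by 1 = ∑ [y ≈ φ x], summed over y, and exchange the two sums.
  ∑-fibres : (T : FiniteSetoid) (φ : A → T .Carrier) (v : A → ℤ) (w : T .Carrier → ℤ) (xs : List A) →
             (∀ y → ∑ (λ x → v x * ⟦ T ._≈?_ y (φ x) ⟧) xs ≡ w y) → ∑ v xs ≡ ∑ w (T .elems)
  ∑-fibres T φ v w xs fibre = begin
    ∑ v xs                                                  ≡⟨ ∑-cong (λ x → sym (step x)) xs ⟩
    ∑ (λ x → ∑ (λ y → v x * ⟦ T ._≈?_ y (φ x) ⟧) (T .elems)) xs ≡⟨ ∑-comm _ xs (T .elems) ⟩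
    ∑ (λ y → ∑ (λ x → v x * ⟦ T ._≈?_ y (φ x) ⟧) xs) (T .elems) ≡⟨ ∑-cong fibre (T .elems) ⟩
    ∑ w (T .elems) ∎
    where
    open ≡-Reasoning
    step : ∀ x → ∑ (λ y → v x * ⟦ T ._≈?_ y (φ x) ⟧) (T .elems) ≡ v x
    step x = trans (∑-*ˡ (v x) _ (T .elems)) (trans (cong (v x *_) (T .enum (φ x))) (ℤₚ.*-identityʳ (v x)))

  module _ (S T : FiniteSetoid) {V : S .Carrier → Set} {W : T .Carrier → Set}
           (V? : ∀ x → Dec (V x)) (W? : ∀ y → Dec (W y)) (φ : S .Carrier → T .Carrier)
           (V⇒W : ∀ {x y} → V x → T ._≈_ y (φ x) → W y) where

    -- Over a point of `W` the fibre is the class of a single z, so its sum is an instance of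
    -- `enum`; over any other point it is empty by `V⇒W`.
    count-1-to-1 : (∀ {y} → W y → ∃ λ z → ∀ x → (S ._≈_ x z → V x × T ._≈_ y (φ x)) ×
                                               (V x × T ._≈_ y (φ x) → S ._≈_ x z)) →
                   ∑ (λ x → ⟦ V? x ⟧) (S .elems) ≡ ∑ (λ y → ⟦ W? y ⟧) (T .elems)
    count-1-to-1 preimage = ∑-fibres T φ _ _ (S .elems) fibre
      where
      fibre : ∀ y → ∑ (λ x → ⟦ V? x ⟧ * ⟦ T ._≈?_ y (φ x) ⟧) (S .elems) ≡ ⟦ W? y ⟧
      fibre y with W? y
      ... | yes Wy = let (z , iff) = preimage Wy in
        trans (∑-cong (λ x → trans (sym (⟦⟧-× (V? x) (T ._≈?_ y (φ x))))
          (⟦⟧-cong (V? x ×-dec T ._≈?_ y (φ x)) (S ._≈?_ x z) (proj₂ (iff x)) (proj₁ (iff x)))) (S .elems))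
          (S .enum z)
      ... | no ¬Wy = trans (∑-cong (λ x → trans (sym (⟦⟧-× (V? x) (T ._≈?_ y (φ x))))
          (⟦⟧-no (V? x ×-dec T ._≈?_ y (φ x)) λ (Vx , e) → ¬Wy (V⇒W Vx e))) (S .elems)) (∑-0 (S .elems))

    -- Applied to the map from roots to quadratics, where z and z′ are two conjugate roots.
    count-2-to-1 : (∀ {y} → W y → ∃ λ z → ∃ λ z′ → (∀ {x} → ¬ (S ._≈_ x z × S ._≈_ x z′)) ×
                     (∀ x → (S ._≈_ x z ⊎ S ._≈_ x z′ → V x × T ._≈_ y (φ x)) ×
                            (V x × T ._≈_ y (φ x) → S ._≈_ x z ⊎ S ._≈_ x z′))) →
                   ∑ (λ x → ⟦ V? x ⟧) (S .elems) ≡ + 2 * ∑ (λ y → ⟦ W? y ⟧) (T .elems)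
    count-2-to-1 preimages = trans (∑-fibres T φ _ _ (S .elems) fibre) (∑-*ˡ (+ 2) _ (T .elems))
      where
      fibre : ∀ y → ∑ (λ x → ⟦ V? x ⟧ * ⟦ T ._≈?_ y (φ x) ⟧) (S .elems) ≡ + 2 * ⟦ W? y ⟧
      fibre y with W? y
      ... | yes Wy = let (z , z′ , z≉z′ , iff) = preimages Wy in
        trans (∑-cong (λ x → trans (sym (⟦⟧-× (V? x) (T ._≈?_ y (φ x))))
          (trans (⟦⟧-cong (V? x ×-dec T ._≈?_ y (φ x)) (S ._≈?_ x z ⊎-dec S ._≈?_ x z′) (proj₂ (iff x)) (proj₁ (iff x)))
                 (⟦⟧-⊎ (S ._≈?_ x z) (S ._≈?_ x z′) z≉z′))) (S .elems))
          (trans (∑-+ _ _ (S .elems)) (cong₂ _+_ (S .enum z) (S .enum z′)))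
      ... | no ¬Wy = trans (∑-cong (λ x → trans (sym (⟦⟧-× (V? x) (T ._≈?_ y (φ x))))
          (⟦⟧-no (V? x ×-dec T ._≈?_ y (φ x)) λ (Vx , e) → ¬Wy (V⇒W Vx e))) (S .elems)) (∑-0 (S .elems))

open Sums

-- Roots of unity and squares in finite domains

module Powers (R : CommutativeSemiring 0ℓ 0ℓ) where
  open CommutativeSemiring R hiding (_≉_)
  open Algebra.Properties.Semiring.Exp semiring
  open import Relation.Binary.Reasoning.Setoid setoid

  1^n≈1 : ∀ n → 1# ^ n ≈ 1#
  1^n≈1 zero    = refl
  1^n≈1 (suc n) = trans (*-identityˡ _) (1^n≈1 n)

  ^∣-≈1 : ∀ x m {n} → x ^ m ≈ 1# → m ℕ∣.∣ n → x ^ n ≈ 1#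
  ^∣-≈1 x m {n} xᵐ≈1 (ℕ∣.divides k ≡.refl) = begin
    x ^ (k ℕ.* m) ≡⟨ ≡.cong (x ^_) (ℕₚ.*-comm k m) ⟩
    x ^ (m ℕ.* k) ≈⟨ ^-assocʳ x m k ⟨
    (x ^ m) ^ k   ≈⟨ ^-congˡ k xᵐ≈1 ⟩
    1# ^ k        ≈⟨ 1^n≈1 k ⟩
    1#            ∎

  -- Bézout over ℕ reads gcd + b n = a m or gcd + a m = b n. Multiplying x ^ gcd by a power of x
  -- that equals 1 thus avoids negative exponents.
  ^-gcd-≈1 : ∀ {x} m n → x ^ m ≈ 1# → x ^ n ≈ 1# → x ^ gcd m n ≈ 1#
  ^-gcd-≈1 {x} m n xᵐ≈1 xⁿ≈1 = go (Bézout.identity (gcd-GCD m n))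
    where
    cancel : ∀ a b d → x ^ a ≈ 1# → x ^ b ≈ 1# → d ℕ.+ b ≡ a → x ^ d ≈ 1#
    cancel a b d xᵃ≈1 xᵇ≈1 d+b≡a = begin
      x ^ d         ≈⟨ *-identityʳ _ ⟨
      x ^ d * 1#    ≈⟨ *-congˡ xᵇ≈1 ⟨
      x ^ d * x ^ b ≈⟨ ^-homo-* x d b ⟨
      x ^ (d ℕ.+ b) ≡⟨ ≡.cong (x ^_) d+b≡a ⟩
      x ^ a         ≈⟨ xᵃ≈1 ⟩
      1#            ∎
    go : Bézout.Identity (gcd m n) m n → x ^ gcd m n ≈ 1#
    go (Bézout.+- a b eq) = cancel (a ℕ.* m) (b ℕ.* n) (gcd m n) (^∣-≈1 x m xᵐ≈1 (ℕ∣.divides a ≡.refl)) (^∣-≈1 x n xⁿ≈1 (ℕ∣.divides b ≡.refl)) eq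
    go (Bézout.-+ a b eq) = cancel (b ℕ.* n) (a ℕ.* m) (gcd m n) (^∣-≈1 x n xⁿ≈1 (ℕ∣.divides b ≡.refl)) (^∣-≈1 x m xᵐ≈1 (ℕ∣.divides a ≡.refl)) eq

module _ (R : CommutativeRing 0ℓ 0ℓ) where
  open CommutativeRing R hiding (_≉_; _-_)
  open Algebra.Properties.Semiring.Exp semiring

  -- Instantiated with r = p - 1 for the integers modulo p and with r = p² - 1 for the field with p²
  -- elements. `fermat` is a parameter because both instances derive it from the Frobenius map.
  module FiniteDomain
    (_≈?_ : ∀ x y → Dec (x ≈ y)) (elems : List Carrier)
    (enum : ∀ z → ∑ (λ x → ⟦ x ≈? z ⟧) elems ≡ 1ℤ)
    (cancel : ∀ x y z → x * z ≈ y * z → x ≈ y ⊎ z ≈ 0#)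
    (1≉0 : ¬ 1# ≈ 0#)
    (r : ℕ) (card : + length elems ≡ + suc r) (fermat : ∀ x → x ^ suc r ≈ x)
    where
    open Powers commutativeSemiring
    open GroupProperties +-group using () renaming (∙-cancelʳ to +-cancelʳ)
    open import Relation.Binary.Reasoning.Setoid setoid

    # : {P : Carrier → Set} → (∀ x → Dec (P x)) → ℤ
    # P? = ∑ (λ x → ⟦ P? x ⟧) elems

    -- The monic polynomial of degree d whose lower coefficients are the entries of the vector.
    eval : ∀ {d} → Vec Carrier d → Carrier → Carrier
    eval []      x = 1#
    eval (c ∷ p) x = c + x * eval p x

    -- Synthetic division: the quotient (p - p(a)) / (X - a), whose coefficients are the values at a
    -- of the successive tails of p.
    deflate : ∀ {d} → Vec Carrier (suc d) → Carrier → Vec Carrier d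
    deflate (c ∷ [])        a = []
    deflate (c ∷ p@(_ ∷ _)) a = eval p a ∷ deflate p a

    -- Arranged without subtraction to suit a solver for commutative semirings; the content is (x -
    -- a) q(x) = p(x) - p(a).
    deflate-correct : ∀ {d} (p : Vec Carrier (suc d)) a x →
                      x * eval (deflate p a) x + eval p a ≈ eval p x + a * eval (deflate p a) x
    deflate-correct (c ∷ []) a x = solve 3 (λ c a x → x :* con 1 :+ (c :+ a :* con 1) := (c :+ x :* con 1) :+ a :* con 1) refl c a x
      where open CSSolver commutativeSemiring
    deflate-correct (c ∷ p@(_ ∷ _)) a x = let q = eval (deflate p a) x; P = eval p a in begin
      x * (P + x * q) + (c + a * P)
        ≈⟨ solve 5 (λ c a x q P → x :* (P :+ x :* q) :+ (c :+ a :* P) := x :* (x :* q :+ P) :+ (c :+ a :* P)) refl c a x q P ⟩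
      x * (x * q + P) + (c + a * P)
        ≈⟨ +-congʳ (*-congˡ (deflate-correct p a x)) ⟩
      x * (eval p x + a * q) + (c + a * P)
        ≈⟨ solve 6 (λ c a x q P E → x :* (E :+ a :* q) :+ (c :+ a :* P) := (c :+ x :* E) :+ a :* (P :+ x :* q)) refl c a x q P (eval p x) ⟩
      (c + x * eval p x) + a * (P + x * q) ∎
      where open CSSolver commutativeSemiring

    root-count : ∀ {d} (p : Vec Carrier d) → # (λ x → eval p x ≈? 0#) ≤ + d
    root-count [] = ℤₚ.≤-reflexive (≡.trans (∑-cong (λ x → ⟦⟧-no (1# ≈? 0#) 1≉0) elems) (∑-0 elems))
    root-count {suc d} p with ∃⊎∑≡0 (λ x → eval p x ≈? 0#) elems
    ... | inj₂ none = ℤₚ.≤-trans (ℤₚ.≤-reflexive none) (ℤ.+≤+ ℕ.z≤n)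
    ... | inj₁ (a , pa≈0) = ℤₚ.≤-trans
            (∑-mono (λ x → ℤₚ.≤-trans (⟦⟧-mono (eval p x ≈? 0#) (x ≈? a ⊎-dec eval q x ≈? 0#) factor)
                                      (⟦⟧-⊎-≤ (x ≈? a) (eval q x ≈? 0#))) elems)
            (ℤₚ.≤-trans (ℤₚ.≤-reflexive (∑-+ _ _ elems))
                        (ℤₚ.+-mono-≤ (ℤₚ.≤-reflexive (enum a)) (root-count q)))
      where
      q = deflate p a
      factor : ∀ {x} → eval p x ≈ 0# → x ≈ a ⊎ eval q x ≈ 0#
      factor {x} px≈0 = cancel x a _ (begin
        x * eval q x            ≈⟨ +-identityʳ _ ⟨
        x * eval q x + 0#       ≈⟨ +-congˡ pa≈0 ⟨
        x * eval q x + eval p a ≈⟨ deflate-correct p a x ⟩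
        eval p x + a * eval q x ≈⟨ +-congʳ px≈0 ⟩
        0# + a * eval q x       ≈⟨ +-identityˡ _ ⟩
        a * eval q x            ∎)

    shift : ∀ d′ {d} → Carrier → Vec Carrier d → Vec Carrier (suc d′ ℕ.+ d)
    shift d′ c p = c ∷ (replicate d′ 0# ++ᵛ p)

    eval-shift : ∀ d′ {d} c (p : Vec Carrier d) x → eval (shift d′ c p) x ≈ c + x ^ suc d′ * eval p x
    eval-shift d′ c p x = +-congˡ (trans (*-congˡ (zeros d′)) (sym (*-assoc x _ _)))
      where
      zeros : ∀ d′ → eval (replicate d′ 0# ++ᵛ p) x ≈ x ^ d′ * eval p x
      zeros zero     = sym (*-identityˡ _)
      zeros (suc d′) = trans (+-identityˡ _) (trans (*-congˡ (zeros d′)) (sym (*-assoc x _ _)))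

    -- Every x is a root of X or of Xʳ - wᵐ = (Xᵈ - w) h with deg h = r - d. As there are 1 + r elements and no factor has
    -- more roots than its degree, Xᵈ - w has exactly d roots.
    module _ (m′ d′ : ℕ) (r≡md : r ≡ suc m′ ℕ.* suc d′) (w : Carrier) (wᵐ≈1 : w ^ suc m′ ≈ 1#) where
      private
        d = suc d′
        m = suc m′

        -- The quotient (Zᵏ⁺¹ - wᵏ⁺¹) / (Z - w) at Z = Xᵈ, that is, the sum of the products Zⁱ wᵏ⁻ⁱ.
        cofactor : ∀ k → Vec Carrier (k ℕ.* d)
        cofactor zero    = []
        cofactor (suc k) = shift d′ (w ^ suc k) (cofactor k)

        cofactor-correct : ∀ k x → x ^ d * eval (cofactor k) x + w ^ suc k ≈ (x ^ d) ^ suc k + w * eval (cofactor k) x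
        cofactor-correct zero    x = solve 2 (λ z w → z :* con 1 :+ w :* con 1 := z :* con 1 :+ w :* con 1) refl (x ^ d) w
          where open CSSolver commutativeSemiring
        cofactor-correct (suc k) x = let z = x ^ d; h = eval (cofactor k) x; W = w ^ suc k in begin
          z * eval (cofactor (suc k)) x + w * W
            ≈⟨ +-congʳ (*-congˡ (eval-shift d′ W (cofactor k) x)) ⟩
          z * (W + z * h) + w * W
            ≈⟨ solve 4 (λ z h w W → z :* (W :+ z :* h) :+ w :* W := z :* (z :* h :+ W) :+ w :* W) refl z h w W ⟩
          z * (z * h + W) + w * W
            ≈⟨ +-congʳ (*-congˡ (cofactor-correct k x)) ⟩
          z * (z ^ suc k + w * h) + w * W
            ≈⟨ solve 5 (λ z h w W Z → z :* (Z :+ w :* h) :+ w :* W := z :* Z :+ w :* (W :+ z :* h)) refl z h w W (z ^ suc k) ⟩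
          z * z ^ suc k + w * (W + z * h)
            ≈⟨ +-congˡ (*-congˡ (eval-shift d′ W (cofactor k) x)) ⟨
          z * z ^ suc k + w * eval (cofactor (suc k)) x ∎
          where open CSSolver commutativeSemiring

        trichotomy : ∀ x → x ≈ 0# ⊎ x ^ d ≈ w ⊎ eval (cofactor m′) x ≈ 0#
        trichotomy x with cancel (x ^ r) 1# x (trans (*-comm _ x) (trans (fermat x) (sym (*-identityˡ x))))
        ... | inj₂ x≈0  = inj₁ x≈0
        ... | inj₁ xʳ≈1 = inj₂ (cancel (x ^ d) w h (+-cancelʳ 1# _ _ (begin
                x ^ d * h + 1#        ≈⟨ +-congˡ wᵐ≈1 ⟨
                x ^ d * h + w ^ m     ≈⟨ cofactor-correct m′ x ⟩
                (x ^ d) ^ m + w * h   ≈⟨ +-congʳ (^-assocʳ x d m) ⟩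
                x ^ (d ℕ.* m) + w * h ≡⟨ ≡.cong (λ k → x ^ k + w * h) (≡.trans (ℕₚ.*-comm d m) (≡.sym r≡md)) ⟩
                x ^ r + w * h         ≈⟨ +-congʳ xʳ≈1 ⟩
                1# + w * h            ≈⟨ +-comm 1# _ ⟩
                w * h + 1#            ∎)))
          where
          h = eval (cofactor m′) x

      power-count : # (λ x → (x ^ d) ≈? w) ≡ + d
      power-count = ℤₚ.≤-antisym upper lower
        where
        upper : # (λ x → (x ^ d) ≈? w) ≤ + d
        upper = ℤₚ.≤-trans
          (∑-mono (λ x → ⟦⟧-mono ((x ^ d) ≈? w) (eval (shift d′ (- w) []) x ≈? 0#) λ xᵈ≈w →
            trans (eval-shift d′ (- w) [] x) (trans (+-congˡ (trans (*-identityʳ _) xᵈ≈w)) (-‿inverseˡ w))) elems)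
          (ℤₚ.≤-trans (root-count (shift d′ (- w) [])) (ℤₚ.≤-reflexive (≡.cong +_ (ℕₚ.+-identityʳ d))))
        total : + suc r ≤ 1ℤ ℤ.+ (# (λ x → (x ^ d) ≈? w) ℤ.+ + (m′ ℕ.* d))
        total = begin′
          + suc r                ≤⟨ ℤₚ.≤-reflexive (≡.trans (≡.sym card) (≡.sym (∑-1 elems))) ⟩
          ∑ (λ _ → 1ℤ) elems     ≤⟨ ∑-mono (λ x → ℤₚ.≤-trans
                                       (ℤₚ.≤-reflexive (≡.sym (⟦⟧-yes (x ≈? 0# ⊎-dec ((x ^ d) ≈? w ⊎-dec eval (cofactor m′) x ≈? 0#)) (trichotomy x))))
                                       (ℤₚ.≤-trans (⟦⟧-⊎-≤ (x ≈? 0#) _) (ℤₚ.+-monoʳ-≤ ⟦ x ≈? 0# ⟧ (⟦⟧-⊎-≤ ((x ^ d) ≈? w) (eval (cofactor m′) x ≈? 0#))))) elems ⟩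
          ∑ (λ x → ⟦ x ≈? 0# ⟧ ℤ.+ (⟦ (x ^ d) ≈? w ⟧ ℤ.+ ⟦ eval (cofactor m′) x ≈? 0# ⟧)) elems
                                 ≤⟨ ℤₚ.≤-reflexive (≡.trans (∑-+ _ _ elems) (≡.cong₂ ℤ._+_ (enum 0#) (∑-+ _ _ elems))) ⟩
          1ℤ ℤ.+ (# (λ x → (x ^ d) ≈? w) ℤ.+ # (λ x → eval (cofactor m′) x ≈? 0#))
                                 ≤⟨ ℤₚ.+-monoʳ-≤ 1ℤ (ℤₚ.+-monoʳ-≤ (# (λ x → (x ^ d) ≈? w)) (root-count (cofactor m′))) ⟩
          1ℤ ℤ.+ (# (λ x → (x ^ d) ≈? w) ℤ.+ + (m′ ℕ.* d)) ∎′
          where open ℤₚ.≤-Reasoning renaming (begin_ to begin′_; _∎ to _∎′)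
        lower : + d ≤ # (λ x → (x ^ d) ≈? w)
        lower = +-cancelʳ-≤ (+ (m′ ℕ.* d)) (+-cancelˡ-≤ 1ℤ (≡.subst (_≤ 1ℤ ℤ.+ (# (λ x → (x ^ d) ≈? w) ℤ.+ + (m′ ℕ.* d))) (≡.cong (λ k → + suc k) r≡md) total))
          where
          +-cancelˡ-≤ : ∀ i {j k} → i ℤ.+ j ≤ i ℤ.+ k → j ≤ k
          +-cancelˡ-≤ i {j} {k} le = ≡.subst₂ _≤_ (eq i j) (eq i k) (ℤₚ.+-monoʳ-≤ (ℤ.- i) le)
            where
            eq : ∀ i j → ℤ.- i ℤ.+ (i ℤ.+ j) ≡ j
            eq = solve-∀
          +-cancelʳ-≤ : ∀ i {j k} → j ℤ.+ i ≤ k ℤ.+ i → j ≤ k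
          +-cancelʳ-≤ i {j} {k} le = +-cancelˡ-≤ i (≡.subst₂ _≤_ (ℤₚ.+-comm j i) (ℤₚ.+-comm k i) le)

    x≉0⇒xʳ≈1 : ∀ {x} → ¬ x ≈ 0# → x ^ r ≈ 1#
    x≉0⇒xʳ≈1 {x} x≉0 with cancel (x ^ r) 1# x (trans (*-comm _ x) (trans (fermat x) (sym (*-identityˡ x))))
    ... | inj₁ xʳ≈1 = xʳ≈1
    ... | inj₂ x≈0  = contradiction x≈0 x≉0

    -- A nonzero x satisfies xʳ = 1, so xᴹ = 1 amounts to x ^ gcd M r = 1, and this exponent divides
    -- r as `power-count` requires. Excluding 0 matters for M = 0, where 0⁰ = 1.
    roots-of-unity-count : .{{_ : ℕ.NonZero r}} → ∀ M → # (λ x → ¬? (x ≈? 0#) ×-dec (x ^ M) ≈? 1#) ≡ + gcd M r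
    roots-of-unity-count M = go (gcd M r) ≡.refl (gcd[m,n]∣n M r)
      where
      go : ∀ g → g ≡ gcd M r → g ℕ∣.∣ r → # (λ x → ¬? (x ≈? 0#) ×-dec (x ^ M) ≈? 1#) ≡ + g
      go g g≡ (ℕ∣.divides zero r≡0) = contradiction r≡0 (ℕ.≢-nonZero⁻¹ r)
      go zero g≡ (ℕ∣.divides m@(suc _) r≡) = contradiction (≡.trans r≡ (ℕₚ.*-zeroʳ m)) (ℕ.≢-nonZero⁻¹ r)
      go (suc d′) g≡ (ℕ∣.divides (suc m′) r≡) = ≡.trans
        (∑-cong (λ x → ⟦⟧-cong (¬? (x ≈? 0#) ×-dec (x ^ M) ≈? 1#) ((x ^ suc d′) ≈? 1#) (to x) (from x)) elems)
        (power-count m′ d′ r≡ 1# (1^n≈1 (suc m′)))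
        where
        to : ∀ x → ¬ x ≈ 0# × x ^ M ≈ 1# → x ^ suc d′ ≈ 1#
        to x (x≉0 , xᴹ≈1) = ≡.subst (λ k → x ^ k ≈ 1#) (≡.sym g≡) (^-gcd-≈1 M r xᴹ≈1 (x≉0⇒xʳ≈1 x≉0))
        from : ∀ x → x ^ suc d′ ≈ 1# → ¬ x ≈ 0# × x ^ M ≈ 1#
        from x xᵈ≈1 = (λ x≈0 → 1≉0 (trans (sym xᵈ≈1) (trans (*-congʳ x≈0) (zeroˡ _)))) ,
                      ^∣-≈1 x (suc d′) xᵈ≈1 (≡.subst (ℕ∣._∣ M) (≡.sym g≡) (gcd[m,n]∣m M r))

    module Squares (h′ : ℕ) (r≡2h : r ≡ suc h′ ℕ.* 2) where
      open Algebra.Properties.CommutativeSemiring.Exp commutativeSemiring using (^-distrib-*)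
      private
        h = suc h′

        x²≈1⇒x≈±1 : ∀ {x} → x * x ≈ 1# → x ≈ 1# ⊎ x ≈ - 1#
        x²≈1⇒x≈±1 {x} x²≈1 = Sum.map₂ (λ x+1≈0 → +-cancelʳ 1# x (- 1#) (trans x+1≈0 (sym (-‿inverseˡ 1#))))
          (cancel x 1# (x + 1#) (begin
            x * (x + 1#)      ≈⟨ distribˡ x x 1# ⟩
            x * x + x * 1#    ≈⟨ +-cong x²≈1 (*-identityʳ x) ⟩
            1# + x            ≈⟨ +-comm 1# x ⟩
            x + 1#            ≈⟨ *-identityˡ _ ⟨
            1# * (x + 1#) ∎))

        2h≡r : 2 ℕ.* h ≡ r
        2h≡r = ≡.trans (ℕₚ.*-comm 2 h) (≡.sym r≡2h)

      inverse : ∀ {x} → ¬ x ≈ 0# → ∃ λ u → u * x ≈ 1#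
      inverse {x} x≉0 = x ^ ℕ.pred r , trans (*-comm _ x)
        (≡.subst (λ e → x ^ e ≈ 1#) (≡.trans r≡2h (≡.cong (suc ∘ ℕ.pred) (≡.sym r≡2h))) (x≉0⇒xʳ≈1 x≉0))

      square⇒^h≈1 : ∀ {a y} → ¬ a ≈ 0# → y * y ≈ a → a ^ h ≈ 1#
      square⇒^h≈1 {a} {y} a≉0 y²≈a = begin
        a ^ h             ≈⟨ ^-congˡ h (trans (*-congˡ (*-identityʳ y)) y²≈a) ⟨
        (y ^ 2) ^ h       ≈⟨ ^-assocʳ y 2 h ⟩
        y ^ (2 ℕ.* h)     ≡⟨ ≡.cong (y ^_) 2h≡r ⟩
        y ^ r             ≈⟨ x≉0⇒xʳ≈1 (λ y≈0 → a≉0 (trans (sym y²≈a) (trans (*-congʳ y≈0) (zeroˡ y)))) ⟩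
        1# ∎

      -- If aʰ = 1, then X² = a has exactly two solutions by `power-count`, so the search for one
      -- cannot fail.
      ^h≈1⇒square : ∀ {a} → a ^ h ≈ 1# → ∃ λ y → y * y ≈ a
      ^h≈1⇒square {a} aʰ≈1 with ∃⊎∑≡0 (λ x → (x ^ 2) ≈? a) elems
      ... | inj₁ (y , y²≈a) = y , trans (*-congˡ (sym (*-identityʳ y))) y²≈a
      ... | inj₂ none       = contradiction (≡.trans (≡.sym none) (power-count h′ 1 r≡2h a aʰ≈1)) λ ()

      nonsquare⇒^h≈-1 : ∀ {a} → ¬ a ≈ 0# → ¬ (∃ λ y → y * y ≈ a) → a ^ h ≈ - 1#
      nonsquare⇒^h≈-1 {a} a≉0 ¬sq = Sum.[ (λ aʰ≈1 → contradiction (^h≈1⇒square aʰ≈1) ¬sq) , (λ aʰ≈-1 → aʰ≈-1) ]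
        (x²≈1⇒x≈±1 (begin
          a ^ h * a ^ h ≈⟨ *-congˡ (*-identityʳ _) ⟨
          (a ^ h) ^ 2   ≈⟨ ^-assocʳ a h 2 ⟩
          a ^ (h ℕ.* 2) ≡⟨ ≡.cong (a ^_) r≡2h ⟨
          a ^ r         ≈⟨ x≉0⇒xʳ≈1 a≉0 ⟩
          1# ∎))

      -- By Euler's criterion (ag)ʰ = (-1)(-1) = 1, so ag = z² for some z, and y = z/g works. This
      -- is why one extension by √g contains the roots of all irreducible quadratics.
      nonsquares-ratio : ∀ {a g} → ¬ a ≈ 0# → ¬ (∃ λ y → y * y ≈ a) → ¬ g ≈ 0# → ¬ (∃ λ y → y * y ≈ g) →
                         ∃ λ y → g * (y * y) ≈ a
      nonsquares-ratio {a} {g} a≉0 a-ns g≉0 g-ns = u * z , (begin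
          g * ((u * z) * (u * z)) ≈⟨ solve 3 (λ g u z → g :* ((u :* z) :* (u :* z)) := (u :* g) :* (u :* (z :* z))) refl g u z ⟩
          (u * g) * (u * (z * z)) ≈⟨ *-cong ug≈1 (*-congˡ z²≈ag) ⟩
          1# * (u * (a * g))      ≈⟨ solve 3 (λ g u a → con 1 :* (u :* (a :* g)) := (u :* g) :* a) refl g u a ⟩
          (u * g) * a             ≈⟨ *-congʳ ug≈1 ⟩
          1# * a                  ≈⟨ *-identityˡ a ⟩
          a ∎)
        where
        open CSSolver commutativeSemiring
        open RingProperties ring using (-1*x≈-x; -‿involutive)
        ag-root : ∃ λ z → z * z ≈ a * g
        ag-root = ^h≈1⇒square (begin
          (a * g) ^ h   ≈⟨ ^-distrib-* a g h ⟩
          a ^ h * g ^ h ≈⟨ *-cong (nonsquare⇒^h≈-1 a≉0 a-ns) (nonsquare⇒^h≈-1 g≉0 g-ns) ⟩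
          - 1# * - 1#   ≈⟨ -1*x≈-x (- 1#) ⟩
          - - 1#        ≈⟨ -‿involutive 1# ⟩
          1# ∎)
        z = proj₁ ag-root
        z²≈ag = proj₂ ag-root
        u = proj₁ (inverse g≉0)
        ug≈1 = proj₂ (inverse g≉0)

      -- If xʰ = 1 held for every nonzero x, there would be 1 + h elements instead of 1 + 2h.
      ∃nonsquare : ∃ λ g → ¬ g ≈ 0# × ¬ (∃ λ y → y * y ≈ g)
      ∃nonsquare with ∃⊎∑≡0 (λ x → ¬? (x ≈? 0#) ×-dec ¬? ((x ^ h) ≈? 1#)) elems
      ... | inj₁ (g , g≉0 , gʰ≉1) = g , g≉0 , λ (y , y²≈g) → gʰ≉1 (square⇒^h≈1 g≉0 y²≈g)
      ... | inj₂ none = contradiction (≡.trans 2h≡r (ℕₚ.suc-injective (ℤₚ.+-injective 1+r≡1+h))) (ℕₚ.m≢1+m+n h ∘ λ eq →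
          ≡.trans (≡.sym eq) (≡.trans (≡.cong (h ℕ.+_) (ℕₚ.+-identityʳ h)) (ℕₚ.+-suc h h′)))
        where
        split : ∀ x → 1ℤ ≡ ⟦ x ≈? 0# ⟧ ℤ.+ (⟦ (x ^ h) ≈? 1# ⟧ ℤ.+ ⟦ ¬? (x ≈? 0#) ×-dec ¬? ((x ^ h) ≈? 1#) ⟧)
        split x with x ≈? 0# | (x ^ h) ≈? 1#
        ... | yes x≈0 | yes xʰ≈1 = contradiction (trans (sym xʰ≈1) (trans (*-congʳ x≈0) (zeroˡ _))) 1≉0
        ... | yes _   | no _     = ≡.refl
        ... | no _    | yes _    = ≡.refl
        ... | no _    | no _     = ≡.refl
        1+r≡1+h : + suc r ≡ + suc h
        1+r≡1+h = ≡.trans (≡.sym card) (≡.trans (≡.sym (∑-1 elems)) (≡.trans (∑-cong split elems)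
          (≡.trans (∑-+ _ _ elems) (≡.trans (≡.cong₂ ℤ._+_ (enum 0#) (∑-+ _ _ elems))
          (≡.trans (≡.cong (ℤ._+_ 1ℤ) (≡.cong₂ ℤ._+_ (power-count 1 h′ (≡.sym 2h≡r) 1# (1^n≈1 2)) none))
                   (≡.cong (ℤ._+_ 1ℤ) (ℤₚ.+-identityʳ (+ h))))))))

    x^1+m≈x⇒xᵐ≈1 : ∀ {x} m → ¬ x ≈ 0# → x ^ suc m ≈ x → x ^ m ≈ 1#
    x^1+m≈x⇒xᵐ≈1 {x} m x≉0 xᵐ⁺¹≈x = Sum.[ (λ xᵐ≈1 → xᵐ≈1) , (λ x≈0 → contradiction x≈0 x≉0) ]
      (cancel (x ^ m) 1# x (trans (*-comm _ x) (trans xᵐ⁺¹≈x (sym (*-identityˡ x)))))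

    xᵐ≈1⇒x^1+m≈x : ∀ {x} m → x ^ m ≈ 1# → x ^ suc m ≈ x
    xᵐ≈1⇒x^1+m≈x m xᵐ≈1 = trans (*-congˡ xᵐ≈1) (*-identityʳ _)

    -- For nonzero x the equations x^(n²) = x and xⁿ = x read x^(n²-1) = 1 and x^(n-1) = 1, and the
    -- second implies the first. The condition xⁿ ≉ x already excludes zero.
    period-2-count : .{{_ : ℕ.NonZero r}} → ∀ n .{{_ : ℕ.NonZero n}} →
                     # (λ x → ¬? ((x ^ n) ≈? x) ×-dec (x ^ (n ℕ.* n)) ≈? x) ≡
                     + gcd (n ℕ.* n ℕ.∸ 1) r ℤ.- + gcd (n ℕ.∸ 1) r
    period-2-count n@(suc m) = ≡.trans (move _ _ _ (≡.trans (≡.sym (∑-+ _ _ elems)) (∑-cong split elems)))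
      (≡.cong₂ ℤ._-_ (roots-of-unity-count k) (roots-of-unity-count m))
      where
      k = n ℕ.* n ℕ.∸ 1
      move : ∀ a b c → a ℤ.+ b ≡ c → a ≡ c ℤ.- b
      move a b c ≡.refl = eq a b
        where
        eq : ∀ a b → a ≡ a ℤ.+ b ℤ.- b
        eq = solve-∀
      A? = λ x → ¬? ((x ^ n) ≈? x) ×-dec (x ^ (n ℕ.* n)) ≈? x
      B? = λ x → ¬? (x ≈? 0#) ×-dec (x ^ m) ≈? 1#
      C? = λ x → ¬? (x ≈? 0#) ×-dec (x ^ k) ≈? 1#
      split : ∀ x → ⟦ A? x ⟧ ℤ.+ ⟦ B? x ⟧ ≡ ⟦ C? x ⟧
      split x = ≡.trans (≡.sym (⟦⟧-⊎ (A? x) (B? x) λ ((xⁿ≉x , _) , (_ , xᵐ≈1)) → xⁿ≉x (xᵐ≈1⇒x^1+m≈x m xᵐ≈1)))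
        (⟦⟧-cong (A? x ⊎-dec B? x) (C? x) to from)
        where
        to : _ ⊎ _ → _
        to (inj₁ (xⁿ≉x , xⁿⁿ≈x)) = x≉0 , x^1+m≈x⇒xᵐ≈1 k x≉0 xⁿⁿ≈x
          where
          x≉0 : ¬ x ≈ 0#
          x≉0 x≈0 = xⁿ≉x (trans (*-congʳ x≈0) (trans (zeroˡ _) (sym x≈0)))
        -- With n = 1 + m, the number n² - 1 computes to m + m n, a multiple of m.
        to (inj₂ (x≉0 , xᵐ≈1)) = x≉0 , ^∣-≈1 x m xᵐ≈1 (ℕ∣.∣m∣n⇒∣m+n ℕ∣.∣-refl (ℕ∣.m∣m*n n))
        from : _ → _ ⊎ _
        from (x≉0 , xᵏ≈1) with (x ^ n) ≈? x
        ... | yes xⁿ≈x = inj₂ (x≉0 , x^1+m≈x⇒xᵐ≈1 m x≉0 xⁿ≈x)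
        ... | no xⁿ≉x  = inj₁ (xⁿ≉x , xᵐ≈1⇒x^1+m≈x k xᵏ≈1)

    module _ {x y : Carrier} {k : ℕ} (m : ℕ) (xᵏ≈y : x ^ k ≈ y) where
      xᵐ≈1⇒x^m+k≈y : x ^ m ≈ 1# → x ^ (m ℕ.+ k) ≈ y
      xᵐ≈1⇒x^m+k≈y xᵐ≈1 = trans (^-homo-* x m k) (trans (*-cong xᵐ≈1 xᵏ≈y) (*-identityˡ y))

      x^m+k≈y⇒xᵐ≈1 : ¬ y ≈ 0# → x ^ (m ℕ.+ k) ≈ y → x ^ m ≈ 1#
      x^m+k≈y⇒xᵐ≈1 y≉0 e = Sum.[ (λ xᵐ≈1 → xᵐ≈1) , (λ y≈0 → contradiction y≈0 y≉0) ]
        (cancel (x ^ m) 1# y (trans (sym (trans (^-homo-* x m k) (*-congˡ xᵏ≈y))) (trans e (sym (*-identityˡ y)))))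

-- Binomial coefficients and the Frobenius map

prime∤! : ∀ {p} → Prime p → ∀ k → k ℕ.< p → ¬ p ℕ∣.∣ k !
prime∤! {p} pr zero    0<p p∣1 = contradiction (ℕ∣.∣1⇒≡1 p∣1) (ℕ.nonTrivial⇒≢1 {{prime⇒nonTrivial pr}})
prime∤! {p} pr (suc k) k<p p∣  with euclidsLemma (suc k) (k !) pr p∣
... | inj₁ p∣k  = ℕ∣.>⇒∤ k<p p∣k
... | inj₂ p∣k! = prime∤! pr k (ℕₚ.<-trans (ℕₚ.n<1+n k) k<p) p∣k!

-- p divides p! = (p C k) · k! (p - k)! but neither k! nor (p - k)!.
prime∣C : ∀ {p} → Prime p → ∀ k → 0 ℕ.< k → k ℕ.< p → p ℕ∣.∣ p C k
prime∣C {p} pr k 0<k k<p with euclidsLemma (p C k) (k ! ℕ.* (p ℕ.∸ k) !) pr p∣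
  where
  instance _ = k ℕₚ.!* (p ℕ.∸ k) !≢0
  p≡1+ : ∀ {p} → 0 ℕ.< p → p ℕ∣.∣ p !
  p≡1+ {suc p} _ = ℕ∣.m∣m*n (p !)
  p∣ : p ℕ∣.∣ (p C k) ℕ.* (k ! ℕ.* (p ℕ.∸ k) !)
  p∣ = ≡.subst (p ℕ∣.∣_) (≡.sym (≡.trans (≡.cong (ℕ._* (k ! ℕ.* (p ℕ.∸ k) !)) (nCk≡n!/k![n-k]! (ℕₚ.<⇒≤ k<p)))
         (ℕ/.m/n*n≡m (k![n∸k]!∣n! (ℕₚ.<⇒≤ k<p))))) (p≡1+ (ℕₚ.<-trans 0<k k<p))
... | inj₁ p∣C = p∣C
... | inj₂ p∣d with euclidsLemma (k !) ((p ℕ.∸ k) !) pr p∣d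
...   | inj₁ p∣k! = contradiction p∣k! (prime∤! pr k k<p)
...   | inj₂ p∣j! = contradiction p∣j! (prime∤! pr (p ℕ.∸ k) (ℕₚ.∸-monoʳ-< 0<k (ℕₚ.<⇒≤ k<p)))

module _ (R : CommutativeSemiring 0ℓ 0ℓ) where
  open CommutativeSemiring R hiding (_≉_)
  open Algebra.Properties.Semiring.Exp semiring
  open Algebra.Properties.Semiring.Mult semiring using () renaming (_×_ to _·_)

  module Frobenius {p : ℕ} (pr : Prime p) (char : ∀ x → p · x ≈ 0#) where

    open Algebra.Properties.Semiring.Mult semiring using (×-assocˡ; ×-congʳ; ×-congˡ; ×-homo-1)
    open Algebra.Properties.Semiring.Sum semiring using (sum)
    open import Relation.Binary.Reasoning.Setoid setoid

    private
      sum-last : ∀ m (f : Fin (suc m) → Carrier) → (∀ k → toℕ k ℕ.< m → f k ≈ 0#) → sum f ≈ f (fromℕ m)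
      sum-last zero    f small≈0 = +-identityʳ _
      sum-last (suc m) f small≈0 = trans (+-congʳ (small≈0 Fin.zero (ℕ.s≤s ℕ.z≤n)))
        (trans (+-identityˡ _) (sum-last m (f ∘ Fin.suc) (λ k k<m → small≈0 (Fin.suc k) (ℕ.s≤s k<m))))

      multiple≈0 : ∀ {m} x → p ℕ∣.∣ m → m · x ≈ 0#
      multiple≈0 x (ℕ∣.divides q ≡.refl) = trans (×-congˡ (ℕₚ.*-comm q p)) (trans (sym (×-assocˡ x p q)) (char _))

    ^p-+ : ∀ x y → (x + y) ^ p ≈ x ^ p + y ^ p
    ^p-+ x y = go p ≡.refl
      where
      go : ∀ m → m ≡ p → (x + y) ^ m ≈ x ^ m + y ^ m
      go zero    m≡p = contradiction (≡.sym m≡p) (ℕ.≢-nonZero⁻¹ p {{prime⇒nonZero pr}})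
      go (suc m) m≡p = begin
        (x + y) ^ suc m                ≈⟨ Binomial.theorem R (suc m) x y ⟩
        term Fin.zero + sum (term ∘ Fin.suc) ≈⟨ +-cong first (trans (sum-last m (term ∘ Fin.suc) middle) final) ⟩
        y ^ suc m + x ^ suc m          ≈⟨ +-comm _ _ ⟩
        x ^ suc m + y ^ suc m ∎
        where
        term : Fin (suc (suc m)) → Carrier
        term = Binomial.binomialTerm R x y (suc m)
        first : term Fin.zero ≈ y ^ suc m
        first = trans (×-congˡ (≡.trans (nCk≡nC[n∸k] {n = suc m} ℕ.z≤n) (nCn≡1 (suc m)))) (trans (×-homo-1 _) (*-identityˡ _))
        final : term (Fin.suc (fromℕ m)) ≈ x ^ suc m
        final = begin
          term (Fin.suc (fromℕ m)) ≡⟨ ≡.cong (λ k → (suc m C suc k) · (x ^ suc k * y ^ (m ℕ.∸ k))) (Finₚ.toℕ-fromℕ m) ⟩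
          (suc m C suc m) · (x ^ suc m * y ^ (m ℕ.∸ m)) ≡⟨ ≡.cong₂ (λ k l → k · (x ^ suc m * y ^ l)) (nCn≡1 (suc m)) (ℕₚ.n∸n≡0 m) ⟩
          1 · (x ^ suc m * 1#)     ≈⟨ trans (×-homo-1 _) (*-identityʳ _) ⟩
          x ^ suc m ∎
        middle : ∀ k → toℕ k ℕ.< m → term (Fin.suc k) ≈ 0#
        middle k k<m = multiple≈0 _ (≡.subst (λ q → p ℕ∣.∣ q C suc (toℕ k)) (≡.sym m≡p)
          (prime∣C pr (suc (toℕ k)) (ℕ.s≤s ℕ.z≤n) (≡.subst (suc (toℕ k) ℕ.<_) m≡p (ℕ.s≤s k<m))))

    -- Frobenius is additive, and ωᵖ = ω (ω²)ʰ = ω γʰ. When γ is a nonsquare modulo p, ε is -1 and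
    -- Frobenius becomes conjugation.
    ^p-quadratic : ∀ {s t ω γ ε} h → p ≡ suc (2 ℕ.* h) → ω * ω ≈ γ → γ ^ h ≈ ε → s ^ p ≈ s → t ^ p ≈ t →
                   (s + t * ω) ^ p ≈ s + t * (ω * ε)
    ^p-quadratic {s} {t} {ω} {γ} {ε} h p≡1+2h ω²≈γ γʰ≈ε sᵖ≈s tᵖ≈t = begin
      (s + t * ω) ^ p     ≈⟨ ^p-+ s (t * ω) ⟩
      s ^ p + (t * ω) ^ p ≈⟨ +-cong sᵖ≈s (trans (^-distrib-* t ω p) (*-cong tᵖ≈t ωᵖ≈ωε)) ⟩
      s + t * (ω * ε) ∎
      where
      open Algebra.Properties.CommutativeSemiring.Exp R using (^-distrib-*)
      ωᵖ≈ωε : ω ^ p ≈ ω * ε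
      ωᵖ≈ωε = begin
        ω ^ p             ≡⟨ ≡.cong (ω ^_) p≡1+2h ⟩
        ω * ω ^ (2 ℕ.* h) ≈⟨ *-congˡ (^-assocʳ ω 2 h) ⟨
        ω * (ω ^ 2) ^ h   ≈⟨ *-congˡ (^-congˡ h (trans (*-congˡ (*-identityʳ ω)) ω²≈γ)) ⟩
        ω * γ ^ h         ≈⟨ *-congˡ γʰ≈ε ⟩
        ω * ε ∎

-- Evaluation of polynomials

module _ (_∼_ : ℤ → ℤ → Set) (∼-sym : ∀ {a b} → a ∼ b → b ∼ a) (∼-reflexive : ∀ {a b} → a ≡ b → a ∼ b)
         (R : CommutativeRing 0ℓ 0ℓ) where
  open CommutativeRing R hiding (_≉_; _-_)

  -- Below, R is (ℤ/n)[X]/(X² + bX + c). Vanishing at X then means divisibility by the quadratic, so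
  -- conditions on ideals turn into equations in R.
  module Evaluation
    (ι : ℤ → Carrier)
    (ι-cong : ∀ {a b} → a ∼ b → ι a ≈ ι b)
    (ι-0 : ι 0ℤ ≈ 0#) (ι-1 : ι 1ℤ ≈ 1#)
    (ι-+ : ∀ a b → ι (a ℤ.+ b) ≈ ι a + ι b) (ι-* : ∀ a b → ι (a ℤ.* b) ≈ ι a * ι b) where
    open Algebra.Properties.Semiring.Exp semiring using (_^_)
    open import Relation.Binary.Reasoning.Setoid setoid
    open CSSolver commutativeSemiring

    eval : Carrier → Poly → Carrier
    eval θ []      = 0#
    eval θ (a ∷ p) = ι a + θ * eval θ p

    module _ (θ : Carrier) where

      eval-0 : ∀ p → (∀ k → coeff p k ∼ 0ℤ) → eval θ p ≈ 0#
      eval-0 []      p≈0 = refl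
      eval-0 (a ∷ p) p≈0 = trans (+-cong (trans (ι-cong (p≈0 0)) ι-0) (trans (*-congˡ (eval-0 p (p≈0 ∘ suc))) (zeroʳ θ))) (+-identityˡ 0#)

      eval-cong : ∀ p q → (∀ k → coeff p k ∼ coeff q k) → eval θ p ≈ eval θ q
      eval-cong []      q       p≈q = sym (eval-0 q (λ k → ∼-sym (p≈q k)))
      eval-cong (a ∷ p) []      p≈q = eval-0 (a ∷ p) p≈q
      eval-cong (a ∷ p) (b ∷ q) p≈q = +-cong (ι-cong (p≈q 0)) (*-congˡ (eval-cong p q (p≈q ∘ suc)))

      eval-+ : ∀ p q → eval θ (p +ₚ q) ≈ eval θ p + eval θ q
      eval-+ []      q       = sym (+-identityˡ _)
      eval-+ (a ∷ p) []      = sym (+-identityʳ _)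
      eval-+ (a ∷ p) (b ∷ q) = trans (+-cong (ι-+ a b) (*-congˡ (eval-+ p q)))
        (solve 5 (λ a b t p q → (a :+ b) :+ t :* (p :+ q) := (a :+ t :* p) :+ (b :+ t :* q)) refl (ι a) (ι b) θ (eval θ p) (eval θ q))

      eval-scale : ∀ a q → eval θ (map (a ℤ.*_) q) ≈ ι a * eval θ q
      eval-scale a []      = sym (zeroʳ _)
      eval-scale a (b ∷ q) = trans (+-cong (ι-* a b) (*-congˡ (eval-scale a q)))
        (solve 4 (λ a b t q → a :* b :+ t :* (a :* q) := a :* (b :+ t :* q)) refl (ι a) (ι b) θ (eval θ q))

      eval-* : ∀ p q → eval θ (p *ₚ q) ≈ eval θ p * eval θ q
      eval-* []      q = sym (zeroˡ _)
      eval-* (a ∷ p) q = begin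
        eval θ (map (a ℤ.*_) q +ₚ (0ℤ ∷ (p *ₚ q)))          ≈⟨ eval-+ (map (a ℤ.*_) q) _ ⟩
        eval θ (map (a ℤ.*_) q) + (ι 0ℤ + θ * eval θ (p *ₚ q)) ≈⟨ +-cong (eval-scale a q) (+-cong ι-0 (*-congˡ (eval-* p q))) ⟩
        ι a * eval θ q + (0# + θ * (eval θ p * eval θ q))
          ≈⟨ solve 4 (λ a t p q → a :* q :+ (con 0 :+ t :* (p :* q)) := (a :+ t :* p) :* q) refl (ι a) θ (eval θ p) (eval θ q) ⟩
        (ι a + θ * eval θ p) * eval θ q ∎

      eval-+-neg : ∀ p → eval θ p + eval θ (negₚ p) ≈ 0#
      eval-+-neg []      = +-identityˡ 0#
      eval-+-neg (a ∷ p) = begin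
        (ι a + θ * eval θ p) + (ι (ℤ.- a) + θ * eval θ (negₚ p))
          ≈⟨ solve 5 (λ a b t p q → (a :+ t :* p) :+ (b :+ t :* q) := (a :+ b) :+ t :* (p :+ q)) refl (ι a) (ι (ℤ.- a)) θ (eval θ p) (eval θ (negₚ p)) ⟩
        (ι a + ι (ℤ.- a)) + θ * (eval θ p + eval θ (negₚ p))
          ≈⟨ +-cong (trans (sym (ι-+ a (ℤ.- a))) (ι-cong (∼-reflexive (ℤₚ.+-inverseʳ a)))) (*-congˡ (eval-+-neg p)) ⟩
        ι 0ℤ + θ * 0# ≈⟨ +-cong ι-0 (zeroʳ θ) ⟩
        0# + 0#       ≈⟨ +-identityˡ 0# ⟩
        0# ∎

      eval-- : ∀ p q → eval θ (p -ₚ q) ≈ eval θ p + - eval θ q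
      eval-- p q = trans (eval-+ p (negₚ q)) (+-congˡ (GroupProperties.inverseʳ-unique +-group (eval θ q) (eval θ (negₚ q)) (eval-+-neg q)))

      eval-1 : eval θ oneₚ ≈ 1#
      eval-1 = trans (+-cong ι-1 (zeroʳ θ)) (+-identityʳ 1#)

      eval-Xpow : ∀ m → eval θ (Xpow m) ≈ θ ^ m
      eval-Xpow zero    = eval-1
      eval-Xpow (suc m) = trans (+-cong ι-0 (*-congˡ (eval-Xpow m))) (+-identityˡ _)

    eval-θ-cong : ∀ {θ θ′} p → θ ≈ θ′ → eval θ p ≈ eval θ′ p
    eval-θ-cong []      θ≈θ′ = refl
    eval-θ-cong (a ∷ p) θ≈θ′ = +-congˡ (*-cong θ≈θ′ (eval-θ-cong p θ≈θ′))

    eval-compose : ∀ θ p g → eval θ (compose p g) ≈ eval (eval θ g) p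
    eval-compose θ []      g = refl
    eval-compose θ (a ∷ p) g = begin
      eval θ ((a ∷ []) +ₚ (g *ₚ compose p g))       ≈⟨ eval-+ θ (a ∷ []) (g *ₚ compose p g) ⟩
      (ι a + θ * 0#) + eval θ (g *ₚ compose p g)    ≈⟨ +-cong (trans (+-congˡ (zeroʳ θ)) (+-identityʳ (ι a))) (trans (eval-* θ g (compose p g)) (*-congˡ (eval-compose θ p g))) ⟩
      ι a + eval θ g * eval (eval θ g) p ∎

    -- (y - x)(y + x + b) = (y² + by + c) - (x² + bx + c).
    other-root : ∀ {x y b c a} → x * x + b * x + c ≈ 0# → y * y + b * y + c ≈ 0# → a * (y + - x) ≈ 1# → y + x + b ≈ 0#
    other-root {x} {y} {b} {c} {a} fx≈0 fy≈0 unit = begin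
      y + x + b                       ≈⟨ *-identityˡ _ ⟨
      1# * (y + x + b)                ≈⟨ *-congʳ unit ⟨
      a * (y + - x) * (y + x + b)     ≈⟨ *-assoc a (y + - x) (y + x + b) ⟩
      a * ((y + - x) * (y + x + b))   ≈⟨ *-congˡ (+-cancelʳ (x * x + b * x + c) _ _ (begin
        (y + - x) * (y + x + b) + (x * x + b * x + c)
          ≈⟨ solve 5 (λ x x⁻ y b c → (y :+ x⁻) :* (y :+ x :+ b) :+ (x :* x :+ b :* x :+ c) :=
                                     (y :* y :+ b :* y :+ c) :+ (x :+ x⁻) :* (y :+ x :+ b)) refl x (- x) y b c ⟩
        (y * y + b * y + c) + (x + - x) * (y + x + b) ≈⟨ +-cong fy≈0 (trans (*-congʳ (-‿inverseʳ x)) (zeroˡ _)) ⟩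
        0# + 0#                       ≈⟨ +-congˡ (sym fx≈0) ⟩
        0# + (x * x + b * x + c) ∎)) ⟩
      a * 0#                          ≈⟨ zeroʳ a ⟩
      0# ∎
      where open GroupProperties +-group using () renaming (∙-cancelʳ to +-cancelʳ)

    eval-quadratic : ∀ θ b c → eval θ (c ∷ b ∷ 1ℤ ∷ []) ≈ θ * θ + ι b * θ + ι c
    eval-quadratic θ b c = trans (+-congˡ (*-congˡ (+-congˡ (*-congˡ (+-congʳ ι-1)))))
      (solve 3 (λ t b c → c :+ t :* (b :+ t :* (con 1 :+ t :* con 0)) := t :* t :+ b :* t :+ c) refl θ (ι b) (ι c))

    eval-linear : ∀ θ s t → eval θ (s ∷ t ∷ []) ≈ ι s + θ * ι t
    eval-linear θ s t = +-congˡ (*-congˡ (trans (+-congˡ (zeroʳ θ)) (+-identityʳ (ι t))))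

    combination : ∀ θ a g a′ g′ → eval θ g ≈ 0# → eval θ g′ ≈ 0# → eval θ (a *ₚ g +ₚ a′ *ₚ g′) ≈ 0#
    combination θ a g a′ g′ g≈0 g′≈0 = trans (eval-+ θ (a *ₚ g) (a′ *ₚ g′)) (trans (+-cong
      (trans (eval-* θ a g) (trans (*-congˡ g≈0) (zeroʳ _))) (trans (eval-* θ a′ g′) (trans (*-congˡ g′≈0) (zeroʳ _)))) (+-identityˡ 0#))

    cofactor : ∀ {w d} e → w * d ≈ 1# → e + - ((e * w) * d) ≈ 0#
    cofactor {w} {d} e wd≈1 = trans (+-congˡ (-‿cong (trans (*-assoc e w d) (trans (*-congˡ wd≈1) (*-identityʳ e))))) (-‿inverseʳ e)

    module _ {n : ℕ} {x : Carrier} {f F₁ f₁ F₂ f₂ q A B : Poly}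
      (fx≈0 : eval x f ≈ 0#)
      (F₁∼1 : ∀ k → coeff F₁ k ∼ coeff oneₚ k) (F₁f₁∼f : ∀ k → coeff (F₁ *ₚ f₁) k ∼ coeff f k)
      (F₂f₂∼f₁ : ∀ k → coeff (F₂ *ₚ f₂) k ∼ coeff f₁ k) (f₂∼1 : ∀ k → coeff f₂ k ∼ coeff oneₚ k) where
      private
        F₂≈f : ∀ θ → eval θ F₂ ≈ eval θ f
        F₂≈f θ = begin
          eval θ F₂                    ≈⟨ *-identityʳ _ ⟨
          eval θ F₂ * 1#               ≈⟨ *-congˡ (trans (eval-cong θ f₂ oneₚ f₂∼1) (eval-1 θ)) ⟨
          eval θ F₂ * eval θ f₂        ≈⟨ eval-* θ F₂ f₂ ⟨
          eval θ (F₂ *ₚ f₂)            ≈⟨ eval-cong θ (F₂ *ₚ f₂) f₁ F₂f₂∼f₁ ⟩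
          eval θ f₁                    ≈⟨ *-identityˡ _ ⟨
          1# * eval θ f₁               ≈⟨ *-congʳ (trans (eval-cong θ F₁ oneₚ F₁∼1) (eval-1 θ)) ⟨
          eval θ F₁ * eval θ f₁        ≈⟨ eval-* θ F₁ f₁ ⟨
          eval θ (F₁ *ₚ f₁)            ≈⟨ eval-cong θ (F₁ *ₚ f₁) f F₁f₁∼f ⟩
          eval θ f ∎

      -- F₁ = f₂ = 1 leaves F₂ = f, so evaluating F₂(Xⁿ) = q F₂ at the root x of f gives f(xⁿ) = 0.
      power-root : (∀ k → coeff (q *ₚ F₂) k ∼ coeff (compose F₂ (Xpow n)) k) → eval (x ^ n) f ≈ 0#
      power-root qF₂∼ = begin
        eval (x ^ n) f               ≈⟨ F₂≈f (x ^ n) ⟨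
        eval (x ^ n) F₂              ≈⟨ eval-θ-cong F₂ (eval-Xpow x n) ⟨
        eval (eval x (Xpow n)) F₂    ≈⟨ eval-compose x F₂ (Xpow n) ⟨
        eval x (compose F₂ (Xpow n)) ≈⟨ eval-cong x (q *ₚ F₂) (compose F₂ (Xpow n)) qF₂∼ ⟨
        eval x (q *ₚ F₂)             ≈⟨ eval-* x q F₂ ⟩
        eval x q * eval x F₂         ≈⟨ *-congˡ (trans (F₂≈f x) fx≈0) ⟩
        eval x q * 0#                ≈⟨ zeroʳ _ ⟩
        0# ∎

      -- At the root x the term with f drops out of the Bézout relation between Xⁿ - X and f. This
      -- is the use of F₁ = 1.
      power-unit : (∀ k → coeff (A *ₚ (Xpow n -ₚ Xpow 1) +ₚ B *ₚ f) k ∼ coeff oneₚ k) → eval x A * (x ^ n + - x) ≈ 1#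
      power-unit bezout = begin
        eval x A * (x ^ n + - x)     ≈⟨ *-congˡ (trans (eval-- x (Xpow n) (Xpow 1)) (+-cong (eval-Xpow x n) (-‿cong (trans (eval-Xpow x 1) (*-identityʳ x))))) ⟨
        eval x A * eval x (Xpow n -ₚ Xpow 1) ≈⟨ +-identityʳ _ ⟨
        eval x A * eval x (Xpow n -ₚ Xpow 1) + 0# ≈⟨ +-cong (eval-* x A (Xpow n -ₚ Xpow 1)) (trans (eval-* x B f) (trans (*-congˡ fx≈0) (zeroʳ _))) ⟨
        eval x (A *ₚ (Xpow n -ₚ Xpow 1)) + eval x (B *ₚ f) ≈⟨ eval-+ x (A *ₚ (Xpow n -ₚ Xpow 1)) (B *ₚ f) ⟨
        eval x (A *ₚ (Xpow n -ₚ Xpow 1) +ₚ B *ₚ f) ≈⟨ trans (eval-cong x (A *ₚ (Xpow n -ₚ Xpow 1) +ₚ B *ₚ f) oneₚ bezout) (eval-1 x) ⟩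
        1# ∎

open import Data.Integer using (_+_; _*_; _-_; -_)
open import Relation.Binary.PropositionalEquality using (refl; sym; trans; cong; cong₂; subst)

-- Congruences and quadratic extensions

infix 4 _≈_[mod_]
record _≈_[mod_] (a b : ℤ) (N : ℕ) : Set where
  constructor modulo
  field N∣a-b : + N ∣ᶻ a - b
open _≈_[mod_]

module _ {N : ℕ} where

  -- Congruences are proved by certificates from here on: a - b is written as an explicit
  -- combination of differences known to vanish modulo N, and the ring solver checks that identity,
  -- usually named `eq`.
  ≈-lin : ∀ {a b} k {c d} → a - b ≡ k * (c - d) → c ≈ d [mod N ] → a ≈ b [mod N ]
  ≈-lin k eq c≈d = modulo (subst (+ N ∣ᶻ_) (sym eq) (ℤ∣.∣n⇒∣m*n k (N∣a-b c≈d)))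

  ≈-lin₂ : ∀ {a b} k l {c d e f} → a - b ≡ k * (c - d) + l * (e - f) →
           c ≈ d [mod N ] → e ≈ f [mod N ] → a ≈ b [mod N ]
  ≈-lin₂ k l eq c≈d e≈f = modulo (subst (+ N ∣ᶻ_) (sym eq)
    (ℤ∣.∣m∣n⇒∣m+n (ℤ∣.∣n⇒∣m*n k (N∣a-b c≈d)) (ℤ∣.∣n⇒∣m*n l (N∣a-b e≈f))))

  ≈-lin₃ : ∀ {a b} k l m {c d e f g h} → a - b ≡ k * (c - d) + l * (e - f) + m * (g - h) →
           c ≈ d [mod N ] → e ≈ f [mod N ] → g ≈ h [mod N ] → a ≈ b [mod N ]
  ≈-lin₃ k l m eq c≈d e≈f g≈h = modulo (subst (+ N ∣ᶻ_) (sym eq)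
    (ℤ∣.∣m∣n⇒∣m+n (ℤ∣.∣m∣n⇒∣m+n (ℤ∣.∣n⇒∣m*n k (N∣a-b c≈d)) (ℤ∣.∣n⇒∣m*n l (N∣a-b e≈f))) (ℤ∣.∣n⇒∣m*n m (N∣a-b g≈h))))

  ≈-reflexive : ∀ {a b} → a ≡ b → a ≈ b [mod N ]
  ≈-reflexive {a} refl = modulo (divides 0ℤ (ℤₚ.+-inverseʳ a))

  ≈-refl : ∀ {a} → a ≈ a [mod N ]
  ≈-refl = ≈-reflexive refl

  ≈-sym : ∀ {a b} → a ≈ b [mod N ] → b ≈ a [mod N ]
  ≈-sym {a} {b} = ≈-lin (- 1ℤ) (eq a b)
    where
    eq : ∀ a b → b - a ≡ - 1ℤ * (a - b)
    eq = solve-∀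

  ≈-trans : ∀ {a b c} → a ≈ b [mod N ] → b ≈ c [mod N ] → a ≈ c [mod N ]
  ≈-trans {a} {b} {c} = ≈-lin₂ 1ℤ 1ℤ (eq a b c)
    where
    eq : ∀ a b c → a - c ≡ 1ℤ * (a - b) + 1ℤ * (b - c)
    eq = solve-∀

  ≈-+ : ∀ {a b c d} → a ≈ b [mod N ] → c ≈ d [mod N ] → a + c ≈ b + d [mod N ]
  ≈-+ {a} {b} {c} {d} = ≈-lin₂ 1ℤ 1ℤ (eq a b c d)
    where
    eq : ∀ a b c d → a + c - (b + d) ≡ 1ℤ * (a - b) + 1ℤ * (c - d)
    eq = solve-∀

  ≈-* : ∀ {a b c d} → a ≈ b [mod N ] → c ≈ d [mod N ] → a * c ≈ b * d [mod N ]
  ≈-* {a} {b} {c} {d} = ≈-lin₂ c b (eq a b c d)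
    where
    eq : ∀ a b c d → a * c - b * d ≡ c * (a - b) + b * (c - d)
    eq = solve-∀

  ≈-neg : ∀ {a b} → a ≈ b [mod N ] → - a ≈ - b [mod N ]
  ≈-neg {a} {b} = ≈-lin (- 1ℤ) (eq a b)
    where
    eq : ∀ a b → - a - - b ≡ - 1ℤ * (a - b)
    eq = solve-∀

  ≈-- : ∀ {a b c d} → a ≈ b [mod N ] → c ≈ d [mod N ] → a - c ≈ b - d [mod N ]
  ≈-- a≈b c≈d = ≈-+ a≈b (≈-neg c≈d)

  ≈-isEquivalence : IsEquivalence (λ a b → a ≈ b [mod N ])
  ≈-isEquivalence = record { refl = ≈-refl ; sym = ≈-sym ; trans = ≈-trans }

  ∣⇒≈0 : ∀ {a} → + N ∣ᶻ a → a ≈ 0ℤ [mod N ]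
  ∣⇒≈0 {a} = modulo ∘ subst (+ N ∣ᶻ_) (sym (ℤₚ.+-identityʳ a))

  ≈0⇒∣ : ∀ {a} → a ≈ 0ℤ [mod N ] → + N ∣ᶻ a
  ≈0⇒∣ {a} a≈0 = subst (+ N ∣ᶻ_) (ℤₚ.+-identityʳ a) (N∣a-b a≈0)

infix 4 _≈?_[mod_]
_≈?_[mod_] : ∀ a b N → Dec (a ≈ b [mod N ])
a ≈? b [mod N ] = Dec.map′ modulo N∣a-b (+ N ℤ∣.∣? (a - b))

≈-coarsen : ∀ {M N a b} → M ℕ∣.∣ N → a ≈ b [mod N ] → a ≈ b [mod M ]
≈-coarsen M∣N a≈b = modulo (ℤ∣.∣-trans (∣ᵤ⇒∣ M∣N) (N∣a-b a≈b))

module _ (R : CommutativeRing 0ℓ 0ℓ) where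
  private module R = CommutativeRing R

  -- A quotient keeps the carrier and only coarsens the equality. The same integers thus represent
  -- classes modulo p, its powers and n, and reduction is the identity map.
  coarsen : (_∼_ : R.Carrier → R.Carrier → Set) → IsEquivalence _∼_ → (∀ {x y} → x R.≈ y → x ∼ y) →
            (∀ {x y u v} → x ∼ y → u ∼ v → (x R.+ u) ∼ (y R.+ v)) →
            (∀ {x y u v} → x ∼ y → u ∼ v → (x R.* u) ∼ (y R.* v)) →
            (∀ {x y} → x ∼ y → (R.- x) ∼ (R.- y)) → CommutativeRing 0ℓ 0ℓ
  coarsen _∼_ isEquivalence incl +-cong *-cong neg-cong = record
    { Carrier = R.Carrier ; _≈_ = _∼_ ; _+_ = R._+_ ; _*_ = R._*_ ; -_ = R.-_ ; 0# = R.0# ; 1# = R.1#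
    ; isCommutativeRing = record
      { isRing = record
        { +-isAbelianGroup = record
          { isGroup = record
            { isMonoid = record
              { isSemigroup = record
                { isMagma = record { isEquivalence = isEquivalence ; ∙-cong = +-cong }
                ; assoc = λ x y z → incl (R.+-assoc x y z) }
              ; identity = (λ x → incl (R.+-identityˡ x)) , (λ x → incl (R.+-identityʳ x)) }
            ; inverse = (λ x → incl (R.-‿inverseˡ x)) , (λ x → incl (R.-‿inverseʳ x))
            ; ⁻¹-cong = neg-cong }
          ; comm = λ x y → incl (R.+-comm x y) }
        ; *-cong = *-cong
        ; *-assoc = λ x y z → incl (R.*-assoc x y z)
        ; *-identity = (λ x → incl (R.*-identityˡ x)) , (λ x → incl (R.*-identityʳ x))
        ; distrib = (λ x y z → incl (R.distribˡ x y z)) , (λ x y z → incl (R.distribʳ x y z)) }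
      ; *-comm = λ x y → incl (R.*-comm x y) } }

ℤ/ : ℕ → CommutativeRing 0ℓ 0ℓ
ℤ/ N = coarsen ℤₚ.+-*-commutativeRing (λ a b → a ≈ b [mod N ]) ≈-isEquivalence ≈-reflexive ≈-+ ≈-* ≈-neg

ℤ² : Set
ℤ² = ℤ × ℤ

infix 4 _≈²_[mod_]
_≈²_[mod_] : ℤ² → ℤ² → ℕ → Set
x ≈² y [mod N ] = (proj₁ x ≈ proj₁ y [mod N ]) × (proj₂ x ≈ proj₂ y [mod N ])

≈²-coarsen : ∀ {M N x y} → M ℕ∣.∣ N → x ≈² y [mod N ] → x ≈² y [mod M ]
≈²-coarsen M∣N (p , q) = ≈-coarsen M∣N p , ≈-coarsen M∣N q

-- The pair (u , v) stands for u + vX in the ring of integral polynomials modulo X² + bX + c.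
module Quadratic (b c : ℤ) where

  infixl 6 _⊕_
  infixl 7 _⊗_
  _⊕_ _⊗_ : ℤ² → ℤ² → ℤ²
  (u , v) ⊕ (u′ , v′) = u + u′ , v + v′
  (u , v) ⊗ (u′ , v′) = u * u′ - c * (v * v′) , u * v′ + v * u′ - b * (v * v′)

  -- `conj` substitutes the other root - b - X for X.
  ⊖_ conj : ℤ² → ℤ²
  ⊖ (u , v) = - u , - v
  conj (u , v) = u - b * v , - v

  private
    ⊗₁-assoc : ∀ b c u v u′ v′ u″ v″ →
      (u * u′ - c * (v * v′)) * u″ - c * ((u * v′ + v * u′ - b * (v * v′)) * v″) ≡
      u * (u′ * u″ - c * (v′ * v″)) - c * (v * (u′ * v″ + v′ * u″ - b * (v′ * v″)))
    ⊗₁-assoc = solve-∀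
    ⊗₂-assoc : ∀ b c u v u′ v′ u″ v″ →
      (u * u′ - c * (v * v′)) * v″ + (u * v′ + v * u′ - b * (v * v′)) * u″ - b * ((u * v′ + v * u′ - b * (v * v′)) * v″) ≡
      u * (u′ * v″ + v′ * u″ - b * (v′ * v″)) + v * (u′ * u″ - c * (v′ * v″)) - b * (v * (u′ * v″ + v′ * u″ - b * (v′ * v″)))
    ⊗₂-assoc = solve-∀
    ⊗₁-identity : ∀ c u v → 1ℤ * u - c * (0ℤ * v) ≡ u
    ⊗₁-identity = solve-∀
    ⊗₂-identity : ∀ b u v → 1ℤ * v + 0ℤ * u - b * (0ℤ * v) ≡ v
    ⊗₂-identity = solve-∀
    ⊗₁-distrib : ∀ c u v u′ v′ u″ v″ →
      (u′ + u″) * u - c * ((v′ + v″) * v) ≡ (u′ * u - c * (v′ * v)) + (u″ * u - c * (v″ * v))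
    ⊗₁-distrib = solve-∀
    ⊗₂-distrib : ∀ b u v u′ v′ u″ v″ →
      (u′ + u″) * v + (v′ + v″) * u - b * ((v′ + v″) * v) ≡ (u′ * v + v′ * u - b * (v′ * v)) + (u″ * v + v″ * u - b * (v″ * v))
    ⊗₂-distrib = solve-∀
    ⊗₁-comm : ∀ c u v u′ v′ → u * u′ - c * (v * v′) ≡ u′ * u - c * (v′ * v)
    ⊗₁-comm = solve-∀
    ⊗₂-comm : ∀ b u v u′ v′ → u * v′ + v * u′ - b * (v * v′) ≡ u′ * v + v′ * u - b * (v′ * v)
    ⊗₂-comm = solve-∀

  ⊗-comm : ∀ x y → x ⊗ y ≡ y ⊗ x
  ⊗-comm (u , v) (u′ , v′) = cong₂ _,_ (⊗₁-comm c u v u′ v′) (⊗₂-comm b u v u′ v′)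

  ⊗-identityˡ : ∀ x → (1ℤ , 0ℤ) ⊗ x ≡ x
  ⊗-identityˡ (u , v) = cong₂ _,_ (⊗₁-identity c u v) (⊗₂-identity b u v)

  ⊗-distribʳ : ∀ x y z → (y ⊕ z) ⊗ x ≡ (y ⊗ x) ⊕ (z ⊗ x)
  ⊗-distribʳ (u , v) (u′ , v′) (u″ , v″) = cong₂ _,_ (⊗₁-distrib c u v u′ v′ u″ v″) (⊗₂-distrib b u v u′ v′ u″ v″)

  commutativeRing : CommutativeRing 0ℓ 0ℓ
  commutativeRing = record
    { Carrier = ℤ² ; _≈_ = _≡_ ; _+_ = _⊕_ ; _*_ = _⊗_ ; -_ = ⊖_ ; 0# = 0ℤ , 0ℤ ; 1# = 1ℤ , 0ℤ
    ; isCommutativeRing = record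
      { isRing = record
        { +-isAbelianGroup = record
          { isGroup = record
            { isMonoid = record
              { isSemigroup = record
                { isMagma = ≡.isMagma _⊕_
                ; assoc = λ x y z → cong₂ _,_ (ℤₚ.+-assoc (proj₁ x) (proj₁ y) (proj₁ z)) (ℤₚ.+-assoc (proj₂ x) (proj₂ y) (proj₂ z)) }
              ; identity = (λ x → cong₂ _,_ (ℤₚ.+-identityˡ (proj₁ x)) (ℤₚ.+-identityˡ (proj₂ x))) ,
                           (λ x → cong₂ _,_ (ℤₚ.+-identityʳ (proj₁ x)) (ℤₚ.+-identityʳ (proj₂ x))) }
            ; inverse = (λ x → cong₂ _,_ (ℤₚ.+-inverseˡ (proj₁ x)) (ℤₚ.+-inverseˡ (proj₂ x))) ,
                        (λ x → cong₂ _,_ (ℤₚ.+-inverseʳ (proj₁ x)) (ℤₚ.+-inverseʳ (proj₂ x)))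
            ; ⁻¹-cong = cong ⊖_ }
          ; comm = λ x y → cong₂ _,_ (ℤₚ.+-comm (proj₁ x) (proj₁ y)) (ℤₚ.+-comm (proj₂ x) (proj₂ y)) }
        ; *-cong = cong₂ _⊗_
        ; *-assoc = λ (u , v) (u′ , v′) (u″ , v″) → cong₂ _,_ (⊗₁-assoc b c u v u′ v′ u″ v″) (⊗₂-assoc b c u v u′ v′ u″ v″)
        ; *-identity = ⊗-identityˡ , (λ x → trans (⊗-comm x (1ℤ , 0ℤ)) (⊗-identityˡ x))
        ; distrib = (λ x y z → trans (⊗-comm x (y ⊕ z)) (trans (⊗-distribʳ x y z) (cong₂ _⊕_ (⊗-comm y x) (⊗-comm z x)))) , ⊗-distribʳ }
      ; *-comm = ⊗-comm } }

  module _ (N : ℕ) where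
    infix 4 _≋_
    _≋_ : ℤ² → ℤ² → Set
    x ≋ y = x ≈² y [mod N ]

    ⊗-cong : ∀ {x x′ y y′} → x ≋ x′ → y ≋ y′ → x ⊗ y ≋ x′ ⊗ y′
    ⊗-cong (p , q) (p′ , q′) =
      ≈-- (≈-* p p′) (≈-* (≈-refl {a = c}) (≈-* q q′)) , ≈-- (≈-+ (≈-* p q′) (≈-* q p′)) (≈-* (≈-refl {a = b}) (≈-* q q′))

    ≋-isEquivalence : IsEquivalence _≋_
    ≋-isEquivalence = record
      { refl = ≈-refl , ≈-refl ; sym = λ (p , q) → ≈-sym p , ≈-sym q
      ; trans = λ (p , q) (p′ , q′) → ≈-trans p p′ , ≈-trans q q′ }

    quotient : CommutativeRing 0ℓ 0ℓ
    quotient = coarsen commutativeRing _≋_ ≋-isEquivalence (λ { refl → ≈-refl , ≈-refl })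
      (λ (p , q) (p′ , q′) → ≈-+ p p′ , ≈-+ q q′) (λ {x} {x′} {y} {y′} → ⊗-cong {x} {x′} {y} {y′})
      (λ (p , q) → ≈-neg p , ≈-neg q)

-- Residue classes

∑-applyUpTo-0 : {A : Set} → ∀ n (g : ℕ → A) (h : A → ℤ) → (∀ i → i ℕ.< n → h (g i) ≡ 0ℤ) → ∑ h (applyUpTo g n) ≡ 0ℤ
∑-applyUpTo-0 zero    g h h≡0 = refl
∑-applyUpTo-0 (suc n) g h h≡0 = cong₂ _+_ (h≡0 0 (ℕ.s≤s ℕ.z≤n))
  (∑-applyUpTo-0 n (g ∘ suc) h (λ i i<n → h≡0 (suc i) (ℕ.s≤s i<n)))

∑-applyUpTo-1 : {A : Set} → ∀ n (g : ℕ → A) (h : A → ℤ) j → j ℕ.< n → h (g j) ≡ 1ℤ →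
                (∀ i → i ℕ.< n → ¬ i ≡ j → h (g i) ≡ 0ℤ) → ∑ h (applyUpTo g n) ≡ 1ℤ
∑-applyUpTo-1 (suc n) g h zero    j<n h≡1 h≡0 = cong₂ _+_ h≡1
  (∑-applyUpTo-0 n (g ∘ suc) h (λ i i<n → h≡0 (suc i) (ℕ.s≤s i<n) λ ()))
∑-applyUpTo-1 (suc n) g h (suc j) (ℕ.s≤s j<n) h≡1 h≡0 = cong₂ _+_ (h≡0 0 (ℕ.s≤s ℕ.z≤n) λ ())
  (∑-applyUpTo-1 n (g ∘ suc) h j j<n h≡1 (λ i i<n i≢j → h≡0 (suc i) (ℕ.s≤s i<n) (i≢j ∘ ℕₚ.suc-injective)))

residue-unique : ∀ {N i j} → i ℕ.< N → j ℕ.< N → + i ≈ + j [mod N ] → i ≡ j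
residue-unique {N} {i} {j} i<N j<N i≈j with i ℕ.≟ j
... | yes i≡j = i≡j
... | no i≢j  = contradiction (subst (λ z → N ℕ∣.∣ ℤ.∣ z ∣) (ℤₚ.m-n≡m⊖n i j) (∣⇒∣ᵤ (N∣a-b i≈j)))
    (ℕ∣.>⇒∤ {{ℕ.≢-nonZero (i≢j ∘ ℤₚ.+-injective ∘ ℤₚ.i-j≡0⇒i≡j (+ i) (+ j) ∘ trans (ℤₚ.m-n≡m⊖n i j) ∘ ℤₚ.∣i∣≡0⇒i≡0)}}
      (ℕₚ.≤-<-trans (ℤₚ.∣m⊝n∣≤m⊔n i j) (ℕₚ.⊔-lub i<N j<N)))

module _ {N : ℕ} .{{_ : ℕ.NonZero N}} where
  ≈-% : ∀ a → a ≈ + (a ℤ/.%ℕ N) [mod N ]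
  ≈-% a = modulo (divides (a ℤ/./ℕ N) (trans (cong (_- + (a ℤ/.%ℕ N)) (ℤ/.a≡a%ℕn+[a/ℕn]*n a N)) (eq (+ (a ℤ/.%ℕ N)) (a ℤ/./ℕ N * + N))))
    where
    eq : ∀ r q → r + q - r ≡ q
    eq = solve-∀

  %-cong : ∀ {a b} → a ≈ b [mod N ] → a ℤ/.%ℕ N ≡ b ℤ/.%ℕ N
  %-cong {a} {b} a≈b = residue-unique (ℤ/.n%ℕd<d a N) (ℤ/.n%ℕd<d b N)
    (≈-trans (≈-sym (≈-% a)) (≈-trans a≈b (≈-% b)))

residues : (N : ℕ) .{{_ : ℕ.NonZero N}} → FiniteSetoid
residues N = record
  { _≈_ = λ a b → a ≈ b [mod N ] ; _≈?_ = λ a b → a ≈? b [mod N ] ; ≈-sym = ≈-sym ; elems = map +_ (upTo N)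
  ; enum = λ z → trans (∑-map _ +_ (upTo N)) (∑-applyUpTo-1 N (λ i → i) _ (z ℤ/.%ℕ N) (ℤ/.n%ℕd<d z N)
      (⟦⟧-yes (+ (z ℤ/.%ℕ N) ≈? z [mod N ]) (≈-sym (≈-% z)))
      (λ i i<N i≢ → ⟦⟧-no (+ i ≈? z [mod N ]) λ i≈z → i≢ (residue-unique i<N (ℤ/.n%ℕd<d z N) (≈-trans i≈z (≈-% z))))) }

module _ (N : ℕ) where
  open Algebra.Properties.Semiring.Mult (CommutativeRing.semiring (ℤ/ N)) using () renaming (_×_ to _·_)

  ·≡* : ∀ n a → n · a ≡ + n * a
  ·≡* zero    a = refl
  ·≡* (suc n) a = trans (cong (_+_ a) (·≡* n a)) (eq (+ n) a)
    where
    eq : ∀ n a → a + n * a ≡ (1ℤ + n) * a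
    eq = solve-∀

  N·a≈0 : ∀ a → N · a ≈ 0ℤ [mod N ]
  N·a≈0 a = ∣⇒≈0 (divides a (trans (·≡* N a) (ℤₚ.*-comm (+ N) a)))

-- The field with p elements

module Fp {p : ℕ} (pr : Prime p) where
  instance p≢0 = prime⇒nonZero pr
  r = ℕ.pred p
  1+r≡p : suc r ≡ p
  1+r≡p = ℕₚ.suc-pred p
  1<p : 1 ℕ.< p
  1<p = ℕ.nonTrivial⇒n>1 p {{prime⇒nonTrivial pr}}

  open Algebra.Properties.Semiring.Exp (CommutativeRing.semiring (ℤ/ p)) public using (_^_; ^-congˡ; ^-assocʳ)

  *≈0 : ∀ a b → a * b ≈ 0ℤ [mod p ] → a ≈ 0ℤ [mod p ] ⊎ b ≈ 0ℤ [mod p ]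
  *≈0 a b ab≈0 with euclidsLemma ℤ.∣ a ∣ ℤ.∣ b ∣ pr (subst (p ℕ∣.∣_) (ℤₚ.abs-* a b) (∣⇒∣ᵤ (≈0⇒∣ ab≈0)))
  ... | inj₁ p∣a = inj₁ (∣⇒≈0 (∣ᵤ⇒∣ p∣a))
  ... | inj₂ p∣b = inj₂ (∣⇒≈0 (∣ᵤ⇒∣ p∣b))

  -≈0⇒≈ : ∀ {a b} → a - b ≈ 0ℤ [mod p ] → a ≈ b [mod p ]
  -≈0⇒≈ {a} {b} = ≈-lin 1ℤ (eq a b)
    where
    eq : ∀ a b → a - b ≡ 1ℤ * (a - b - 0ℤ)
    eq = solve-∀

  cancel : ∀ a b c → a * c ≈ b * c [mod p ] → a ≈ b [mod p ] ⊎ c ≈ 0ℤ [mod p ]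
  cancel a b c ac≈bc with *≈0 (a - b) c (≈-lin 1ℤ (eq a b c) ac≈bc)
    where
    eq : ∀ a b c → (a - b) * c - 0ℤ ≡ 1ℤ * (a * c - b * c)
    eq = solve-∀
  ... | inj₁ a-b≈0 = inj₁ (-≈0⇒≈ a-b≈0)
  ... | inj₂ c≈0   = inj₂ c≈0

  1≉0 : ¬ 1ℤ ≈ 0ℤ [mod p ]
  1≉0 1≈0 = contradiction (residue-unique 1<p (ℕₚ.<-trans (ℕₚ.n<1+n 0) 1<p) 1≈0) λ ()

  -- Induction on a residue k, with (1 + k)ᵖ = 1 + kᵖ from the Frobenius map.
  fermat : ∀ a → a ^ suc r ≈ a [mod p ]
  fermat a = ≈-trans (^-congˡ (suc r) (≈-% a)) (≈-trans (nat (a ℤ/.%ℕ p)) (≈-sym (≈-% a)))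
    where
    open Frobenius (CommutativeRing.commutativeSemiring (ℤ/ p)) pr (N·a≈0 p)
    nat : ∀ k → (+ k) ^ suc r ≈ + k [mod p ]
    nat zero    = ≈-refl
    nat (suc k) = ≈-trans (subst (λ e → (1ℤ + + k) ^ e ≈ 1ℤ ^ e + (+ k) ^ e [mod p ]) (sym 1+r≡p) (^p-+ 1ℤ (+ k)))
      (≈-+ (Powers.1^n≈1 (CommutativeRing.commutativeSemiring (ℤ/ p)) (suc r)) (nat k))

  elems = map +_ (upTo p)

  open FiniteDomain (ℤ/ p) (λ a b → a ≈? b [mod p ]) elems (FiniteSetoid.enum (residues p)) cancel 1≉0
    r (cong +_ (trans (length-map +_ (upTo p)) (trans (length-upTo p) (sym 1+r≡p)))) fermat public
    using (#; roots-of-unity-count; period-2-count; module Squares)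

-- The Legendre symbol

Square : ℕ → ℤ → Set
Square p a = ∃ λ y → y * y ≈ a [mod p ]

LegendreView : ℕ → ℤ → ℤ → Set
LegendreView p a s = (a ≈ 0ℤ [mod p ] × s ≡ 0ℤ) ⊎ (¬ a ≈ 0ℤ [mod p ] × Square p a × s ≡ 1ℤ) ⊎
                     (¬ a ≈ 0ℤ [mod p ] × ¬ Square p a × s ≡ ℤ.-1ℤ)

-- Translates the Boolean search through residues into solvability of y² = a modulo p, so that later
-- arguments can work with square roots instead of the search.
legendre-view : ∀ p .{{_ : ℕ.NonZero p}} a → LegendreView p a (legendre a p)
legendre-view (suc q) a = go (r ℕ.≡ᵇ 0) (any f (upTo p)) refl refl
  where
  p = suc q
  r = a ℤ/.%ℕ p
  f : ℕ → Bool
  f x = does (((x ℕ.* x) ℕ.% p) ℕ.≟ r)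
  a≈0 : r ≡ 0 → a ≈ 0ℤ [mod p ]
  a≈0 r≡0 = ≈-trans (≈-% a) (≈-reflexive (cong +_ r≡0))
  square⇒any : Square p a → T (any f (upTo p))
  square⇒any (y , y²≈a) = any⁺ f (lose (∈-upTo⁺ (ℤ/.n%ℕd<d y p)) (ℕₚ.≡⇒≡ᵇ _ _ (%-cong {a = + (x ℕ.* x)} {b = a}
      (≈-trans (≈-reflexive (ℤₚ.pos-* x x)) (≈-trans (≈-sym (≈-* (≈-% y) (≈-% y))) y²≈a)))))
    where x = y ℤ/.%ℕ p
  any⇒square : T (any f (upTo p)) → Square p a
  any⇒square t with find (any⁻ f (upTo p) t)
  ... | x , _ , fx = + x , ≈-trans (≈-reflexive (sym (ℤₚ.pos-* x x))) (≈-trans (≈-% (+ (x ℕ.* x)))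
                      (≈-trans (≈-reflexive (cong +_ (ℕₚ.≡ᵇ⇒≡ _ _ fx))) (≈-sym (≈-% a))))
  -- The two Boolean tests are generalised together with equations recording their values, so that
  -- the conditional reduces and the outcomes remain known.
  go : ∀ d e → (r ℕ.≡ᵇ 0) ≡ d → any f (upTo p) ≡ e → LegendreView p a (if d then 0ℤ else if e then 1ℤ else ℤ.-1ℤ)
  go true  e     eq₁ eq₂ = inj₁ (a≈0 (ℕₚ.≡ᵇ⇒≡ r 0 (subst T (sym eq₁) _)) , refl)
  go false true  eq₁ eq₂ = inj₂ (inj₁ ((λ a≈0 → subst T eq₁ (ℕₚ.≡⇒≡ᵇ r 0 (%-cong {p} {b = 0ℤ} a≈0))) , any⇒square (subst T (sym eq₂) _) , refl))
  go false false eq₁ eq₂ = inj₂ (inj₂ ((λ a≈0 → subst T eq₁ (ℕₚ.≡⇒≡ᵇ r 0 (%-cong {p} {b = 0ℤ} a≈0))) , (λ sq → subst T eq₂ (square⇒any sq)) , refl))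

module _ {p : ℕ} .{{_ : ℕ.NonZero p}} {a : ℤ} where

  legendre≡1⇒square : legendre a p ≡ 1ℤ → ¬ a ≈ 0ℤ [mod p ] × Square p a
  legendre≡1⇒square l≡1 with legendre-view p a
  ... | inj₁ (_ , l≡0)                = contradiction (trans (sym l≡1) l≡0) λ ()
  ... | inj₂ (inj₁ (a≉0 , sq , _))    = a≉0 , sq
  ... | inj₂ (inj₂ (_ , _ , l≡-1))    = contradiction (trans (sym l≡1) l≡-1) λ ()

  square⇒legendre≡1 : ¬ a ≈ 0ℤ [mod p ] → Square p a → legendre a p ≡ 1ℤ
  square⇒legendre≡1 a≉0 sq with legendre-view p a
  ... | inj₁ (a≈0 , _)               = contradiction a≈0 a≉0
  ... | inj₂ (inj₁ (_ , _ , l≡1))    = l≡1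
  ... | inj₂ (inj₂ (_ , ¬sq , _))    = contradiction sq ¬sq

  legendre≡-1⇒nonsquare : legendre a p ≡ ℤ.-1ℤ → ¬ a ≈ 0ℤ [mod p ] × ¬ Square p a
  legendre≡-1⇒nonsquare l≡-1 with legendre-view p a
  ... | inj₁ (_ , l≡0)               = contradiction (trans (sym l≡-1) l≡0) λ ()
  ... | inj₂ (inj₁ (_ , _ , l≡1))    = contradiction (trans (sym l≡-1) l≡1) λ ()
  ... | inj₂ (inj₂ (a≉0 , ¬sq , _))  = a≉0 , ¬sq

  nonsquare⇒legendre≡-1 : ¬ Square p a → legendre a p ≡ ℤ.-1ℤ
  nonsquare⇒legendre≡-1 ¬sq with legendre-view p a
  ... | inj₁ (a≈0 , _)               = contradiction (0ℤ , ≈-sym a≈0) ¬sq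
  ... | inj₂ (inj₁ (_ , sq , _))     = contradiction sq ¬sq
  ... | inj₂ (inj₂ (_ , _ , l≡-1))   = l≡-1

  legendre≡±1 : ¬ a ≈ 0ℤ [mod p ] → legendre a p ≡ 1ℤ ⊎ legendre a p ≡ ℤ.-1ℤ
  legendre≡±1 a≉0 with legendre-view p a
  ... | inj₁ (a≈0 , _)               = contradiction a≈0 a≉0
  ... | inj₂ (inj₁ (_ , _ , l≡1))    = inj₁ l≡1
  ... | inj₂ (inj₂ (_ , _ , l≡-1))   = inj₂ l≡-1

legendre-cong : ∀ {p} .{{_ : ℕ.NonZero p}} {a b} → a ≈ b [mod p ] → legendre a p ≡ legendre b p
legendre-cong {p} {a} {b} a≈b with legendre-view p a
... | inj₂ (inj₁ (a≉0 , (y , y²≈a) , l≡1)) = trans l≡1 (sym (square⇒legendre≡1 (a≉0 ∘ ≈-trans a≈b) (y , ≈-trans y²≈a a≈b)))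
... | inj₂ (inj₂ (a≉0 , ¬sq , l≡-1)) = trans l≡-1 (sym (nonsquare⇒legendre≡-1 λ (y , y²≈b) → ¬sq (y , ≈-trans y²≈b (≈-sym a≈b))))
... | inj₁ (a≈0 , l≡0) with legendre-view p b
...   | inj₁ (_ , l′≡0)          = trans l≡0 (sym l′≡0)
...   | inj₂ (inj₁ (b≉0 , _))    = contradiction (≈-trans (≈-sym a≈b) a≈0) b≉0
...   | inj₂ (inj₂ (b≉0 , _))    = contradiction (≈-trans (≈-sym a≈b) a≈0) b≉0

-- The field with p² elements

-- The pair (s , t) stands for s + t√g.
module Fp² {p : ℕ} (pr : Prime p) (h′ : ℕ) (p≡1+2h : p ≡ suc (2 ℕ.* suc h′))
           (g : ℤ) (g≉0 : ¬ g ≈ 0ℤ [mod p ]) (g-ns : ¬ Square p g) where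
  private
    module F = Fp pr
    h = suc h′
    r≡h*2 : F.r ≡ h ℕ.* 2
    r≡h*2 = trans (cong ℕ.pred p≡1+2h) (ℕₚ.*-comm 2 h)
    module S = F.Squares h′ r≡h*2
    instance
      p≢0 = prime⇒nonZero pr
      p*p≢0 = ℕₚ.m*n≢0 p p
  -- The polynomial is X² - g, so X serves as √g.
  open Quadratic 0ℤ (- g) using (_⊗_; _⊕_; quotient)
  E = quotient p
  open CommutativeRing E using () renaming (_≈_ to _≋_; refl to ≋-refl; sym to ≋-sym; trans to ≋-trans)
  open Algebra.Properties.Semiring.Exp (CommutativeRing.semiring E) public
    using () renaming (_^_ to _^²_; ^-congˡ to ^²-congˡ; ^-assocʳ to ^²-assoc)

  ≋-lift : ∀ {x y} → x ≡ y → x ≋ y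
  ≋-lift refl = ≈-refl , ≈-refl

  private
    ι-⊗₁ : ∀ g a b → a * b - - g * (0ℤ * 0ℤ) ≡ a * b
    ι-⊗₁ = solve-∀
    ι-⊗₂ : ∀ a b → a * 0ℤ + 0ℤ * b - 0ℤ * (0ℤ * 0ℤ) ≡ 0ℤ
    ι-⊗₂ = solve-∀
    decompose₁ : ∀ g s t → s + (t * 0ℤ - - g * (0ℤ * 1ℤ)) ≡ s
    decompose₁ = solve-∀
    decompose₂ : ∀ t → 0ℤ + (t * 1ℤ + 0ℤ * 0ℤ - 0ℤ * (0ℤ * 1ℤ)) ≡ t
    decompose₂ = solve-∀

  ι-^ : ∀ a n → (a , 0ℤ) ^² n ≡ (a F.^ n , 0ℤ)
  ι-^ a zero    = refl
  ι-^ a (suc n) = trans (cong ((a , 0ℤ) ⊗_) (ι-^ a n)) (cong₂ _,_ (ι-⊗₁ g a (a F.^ n)) (ι-⊗₂ a (a F.^ n)))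

  ι-fermat : ∀ a → (a , 0ℤ) ^² p ≋ (a , 0ℤ)
  ι-fermat a = ≋-trans (≋-lift (ι-^ a p)) (subst (λ e → a F.^ e ≈ a [mod p ]) F.1+r≡p (F.fermat a) , ≈-refl)

  char : ∀ x → Algebra.Properties.Semiring.Mult._×_ (CommutativeRing.semiring E) p x ≋ (0ℤ , 0ℤ)
  char (u , v) = ≋-trans (≋-lift (split p)) (N·a≈0 p u , N·a≈0 p v)
    where
    split : ∀ n → Algebra.Properties.Semiring.Mult._×_ (CommutativeRing.semiring E) n (u , v) ≡ (Algebra.Properties.Semiring.Mult._×_ (CommutativeRing.semiring (ℤ/ p)) n u , Algebra.Properties.Semiring.Mult._×_ (CommutativeRing.semiring (ℤ/ p)) n v)
    split zero    = refl
    split (suc n) = cong ((u , v) ⊕_) (split n)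

  -- √g ^ p = √g · g ^ ((p - 1) / 2) = - √g.
  ^p≋conj : ∀ s t → (s , t) ^² p ≋ (s , - t)
  ^p≋conj s t = ≋-trans (^²-congˡ p (≋-lift (sym (cong₂ _,_ (decompose₁ g s t) (decompose₂ t)))))
    (≋-trans (Frobenius.^p-quadratic (CommutativeRing.commutativeSemiring E) pr char {s = s , 0ℤ} {t = t , 0ℤ} {ω = 0ℤ , 1ℤ}
                {γ = g , 0ℤ} {ε = - 1ℤ , 0ℤ} h p≡1+2h (≋-lift (cong₂ _,_ (eq₁ g) refl))
                (≋-trans (≋-lift (ι-^ g h)) (S.nonsquare⇒^h≈-1 g≉0 g-ns , ≈-refl)) (ι-fermat s) (ι-fermat t))
             (≋-lift (cong₂ _,_ (eq₂ g s t) (eq₃ t))))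
    where
    eq₁ : ∀ g → 0ℤ * 0ℤ - - g * (1ℤ * 1ℤ) ≡ g
    eq₁ = solve-∀
    eq₂ : ∀ g s t → s + (t * (0ℤ * - 1ℤ - - g * (1ℤ * 0ℤ)) - - g * (0ℤ * (0ℤ * 0ℤ + 1ℤ * - 1ℤ - 0ℤ * (1ℤ * 0ℤ)))) ≡ s
    eq₂ = solve-∀
    eq₃ : ∀ t → 0ℤ + (t * (0ℤ * 0ℤ + 1ℤ * - 1ℤ - 0ℤ * (1ℤ * 0ℤ)) + 0ℤ * (0ℤ * - 1ℤ - - g * (1ℤ * 0ℤ))
                      - 0ℤ * (0ℤ * (0ℤ * 0ℤ + 1ℤ * - 1ℤ - 0ℤ * (1ℤ * 0ℤ)))) ≡ - t
    eq₃ = solve-∀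

  -- If t were nonzero, s² = gt² would make g the square of s/t.
  norm-0 : ∀ s t → s * s - g * (t * t) ≈ 0ℤ [mod p ] → (s , t) ≋ (0ℤ , 0ℤ)
  norm-0 s t N≈0 with t ≈? 0ℤ [mod p ]
  ... | yes t≈0 = Sum.[ (λ s≈0 → s≈0) , (λ s≈0 → s≈0) ] (F.*≈0 s s (≈-lin₂ 1ℤ (g * t) (eq g s t) N≈0 t≈0)) , t≈0
    where
    eq : ∀ g s t → s * s - 0ℤ ≡ 1ℤ * (s * s - g * (t * t) - 0ℤ) + g * t * (t - 0ℤ)
    eq = solve-∀
  ... | no t≉0 = let (u , ut≈1) = S.inverse t≉0 in
    contradiction (u * s , ≈-lin₂ (u * u) (g * (u * t + 1ℤ)) (eq g s t u) N≈0 ut≈1) g-ns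
    where
    eq : ∀ g s t u → u * s * (u * s) - g ≡ u * u * (s * s - g * (t * t) - 0ℤ) + g * (u * t + 1ℤ) * (u * t - 1ℤ)
    eq = solve-∀

  -- Multiplying xy by the conjugate of y gives x N(y) with N(y) in 𝔽ₚ. The coefficients in `eq₁`
  -- and `eq₂` come from that conjugate.
  ⊗≋0 : ∀ x y → x ⊗ y ≋ (0ℤ , 0ℤ) → x ≋ (0ℤ , 0ℤ) ⊎ y ≋ (0ℤ , 0ℤ)
  ⊗≋0 (u , v) (s , t) (p₁ , p₂) with (s * s - g * (t * t)) ≈? 0ℤ [mod p ]
  ... | yes N≈0 = inj₂ (norm-0 s t N≈0)
  ... | no N≉0  = inj₁ (cancelN u (≈-lin₂ s (- (g * t)) (eq₁ g u v s t) p₁ p₂) , cancelN v (≈-lin₂ (- t) s (eq₂ g u v s t) p₁ p₂))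
    where
    cancelN : ∀ w → w * (s * s - g * (t * t)) ≈ 0ℤ [mod p ] → w ≈ 0ℤ [mod p ]
    cancelN w wN≈0 = Sum.[ (λ w≈0 → w≈0) , (λ N≈0 → contradiction N≈0 N≉0) ] (F.*≈0 w (s * s - g * (t * t)) wN≈0)
    eq₁ : ∀ g u v s t → u * (s * s - g * (t * t)) - 0ℤ ≡
          s * (u * s - - g * (v * t) - 0ℤ) + - (g * t) * (u * t + v * s - 0ℤ * (v * t) - 0ℤ)
    eq₁ = solve-∀
    eq₂ : ∀ g u v s t → v * (s * s - g * (t * t)) - 0ℤ ≡
          - t * (u * s - - g * (v * t) - 0ℤ) + s * (u * t + v * s - 0ℤ * (v * t) - 0ℤ)
    eq₂ = solve-∀

  cancel : ∀ x y z → x ⊗ z ≋ y ⊗ z → x ≋ y ⊎ z ≋ (0ℤ , 0ℤ)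
  cancel (x₁ , x₂) (y₁ , y₂) (s , t) (e₁ , e₂) = Sum.map₁ (λ (d₁ , d₂) → F.-≈0⇒≈ d₁ , F.-≈0⇒≈ d₂)
    (⊗≋0 (x₁ - y₁ , x₂ - y₂) (s , t) (≈-lin 1ℤ (eq₁ g x₁ x₂ y₁ y₂ s t) e₁ , ≈-lin 1ℤ (eq₂ x₁ x₂ y₁ y₂ s t) e₂))
    where
    eq₁ : ∀ g x₁ x₂ y₁ y₂ s t → (x₁ - y₁) * s - - g * ((x₂ - y₂) * t) - 0ℤ ≡
          1ℤ * (x₁ * s - - g * (x₂ * t) - (y₁ * s - - g * (y₂ * t)))
    eq₁ = solve-∀
    eq₂ : ∀ x₁ x₂ y₁ y₂ s t → (x₁ - y₁) * t + (x₂ - y₂) * s - 0ℤ * ((x₂ - y₂) * t) - 0ℤ ≡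
          1ℤ * (x₁ * t + x₂ * s - 0ℤ * (x₂ * t) - (y₁ * t + y₂ * s - 0ℤ * (y₂ * t)))
    eq₂ = solve-∀

  r² = ℕ.pred (p ℕ.* p)

  -- Frobenius is conjugation, and conjugation has order two.
  fermat² : ∀ x → x ^² suc r² ≋ x
  fermat² (s , t) = subst (λ e → (s , t) ^² e ≋ (s , t)) (sym (ℕₚ.suc-pred (p ℕ.* p)))
    (≋-trans (≋-sym (^²-assoc (s , t) p p)) (≋-trans (^²-congˡ p (^p≋conj s t))
      (≋-trans (^p≋conj s (- t)) (≋-lift (cong (s ,_) (ℤₚ.neg-involutive t))))))

  Fᵖ² : FiniteSetoid
  Fᵖ² = residues p ×ᶠ residues p

  card² : + length (FiniteSetoid.elems Fᵖ²) ≡ + suc r²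
  card² = trans (sym (∑-1 (FiniteSetoid.elems Fᵖ²))) (trans (∑-cartesianProduct (λ _ → 1ℤ) F.elems F.elems)
    (trans (∑-∑-* (λ _ → 1ℤ) (λ _ → 1ℤ) F.elems F.elems)
    (trans (cong₂ _*_ ∑1≡p ∑1≡p) (trans (sym (ℤₚ.pos-* p p)) (cong +_ (sym (ℕₚ.suc-pred (p ℕ.* p))))))))
    where
    ∑1≡p : ∑ (λ _ → 1ℤ) F.elems ≡ + p
    ∑1≡p = trans (∑-1 F.elems) (cong +_ (trans (length-map +_ (upTo p)) (length-upTo p)))

  open FiniteDomain E (FiniteSetoid._≈?_ Fᵖ²) (FiniteSetoid.elems Fᵖ²) (FiniteSetoid.enum Fᵖ²) cancel (F.1≉0 ∘ proj₁)
    r² card² fermat² public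
    using (x^m+k≈y⇒xᵐ≈1; xᵐ≈1⇒x^m+k≈y) renaming (roots-of-unity-count to roots-of-unity-count²)

  ^²-+p≋conj⇒≋1 : ∀ m s t → ¬ t ≈ 0ℤ [mod p ] → (s , t) ^² (m ℕ.+ p) ≋ (s , - t) → (s , t) ^² m ≋ (1ℤ , 0ℤ)
  ^²-+p≋conj⇒≋1 m s t t≉0 = x^m+k≈y⇒xᵐ≈1 {x = s , t} {y = s , - t} {k = p} m (^p≋conj s t) (λ x̄≈0 → t≉0 (≈-lin (- 1ℤ) (eq t) (proj₂ x̄≈0)))
    where
    eq : ∀ t → t - 0ℤ ≡ - 1ℤ * (- t - 0ℤ)
    eq = solve-∀

  ≋1⇒^²-+p≋conj : ∀ m s t → (s , t) ^² m ≋ (1ℤ , 0ℤ) → (s , t) ^² (m ℕ.+ p) ≋ (s , - t)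
  ≋1⇒^²-+p≋conj m s t = xᵐ≈1⇒x^m+k≈y {x = s , t} {y = s , - t} {k = p} m (^p≋conj s t)

-- Counting modulo an odd prime

-- The coordinates of X ^ n modulo X² + bX + c, by repeated multiplication with X.
xpow : ℤ → ℤ → ℕ → ℤ²
xpow b c zero    = 1ℤ , 0ℤ
xpow b c (suc n) = - (c * proj₂ (xpow b c n)) , proj₁ (xpow b c n) - b * proj₂ (xpow b c n)

discr : ℤ² → ℤ
discr (b , c) = b * b - + 4 * c

-- Modulo X² + bX + c the conjugate of X is - b - X.
Good : ℕ → ℕ → ℤ² → Set
Good n N (b , c) = gcd N ℤ.∣ c * discr (b , c) ∣ ≡ 1 × xpow b c n ≈² (- b , - 1ℤ) [mod N ]

Good? : ∀ n N x → Dec (Good n N x)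
Good? n N (b , c) = (gcd N ℤ.∣ c * discr (b , c) ∣ ℕ.≟ 1) ×-dec
  (proj₁ (xpow b c n) ≈? - b [mod N ] ×-dec proj₂ (xpow b c n) ≈? - 1ℤ [mod N ])

module _ {N : ℕ} where
  ≈-lin₄ : ∀ {a b} k l m n {c d e f g h i j} →
           a - b ≡ k * (c - d) + l * (e - f) + m * (g - h) + n * (i - j) →
           c ≈ d [mod N ] → e ≈ f [mod N ] → g ≈ h [mod N ] → i ≈ j [mod N ] → a ≈ b [mod N ]
  ≈-lin₄ k l m n eq c≈d e≈f g≈h i≈j = modulo (subst (+ N ∣ᶻ_) (sym eq)
    (ℤ∣.∣m∣n⇒∣m+n (ℤ∣.∣m∣n⇒∣m+n (ℤ∣.∣m∣n⇒∣m+n (ℤ∣.∣n⇒∣m*n k (N∣a-b c≈d)) (ℤ∣.∣n⇒∣m*n l (N∣a-b e≈f)))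
      (ℤ∣.∣n⇒∣m*n m (N∣a-b g≈h))) (ℤ∣.∣n⇒∣m*n n (N∣a-b i≈j))))

module _ {p : ℕ} (pr : Prime p) {a : ℤ} where
  coprime⇒≉0 : gcd p ℤ.∣ a ∣ ≡ 1 → ¬ a ≈ 0ℤ [mod p ]
  coprime⇒≉0 gcd≡1 a≈0 = ℕ.nonTrivial⇒≢1 {{prime⇒nonTrivial pr}}
    (ℕ∣.∣1⇒≡1 (subst (p ℕ∣.∣_) gcd≡1 (gcd-greatest ℕ∣.∣-refl (∣⇒∣ᵤ (≈0⇒∣ a≈0)))))

  ≉0⇒coprime : ¬ a ≈ 0ℤ [mod p ] → gcd p ℤ.∣ a ∣ ≡ 1
  ≉0⇒coprime a≉0 with prime⇒irreducible pr (gcd[m,n]∣m p ℤ.∣ a ∣)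
  ... | inj₁ gcd≡1 = gcd≡1
  ... | inj₂ gcd≡p = contradiction (∣⇒≈0 (∣ᵤ⇒∣ (subst (ℕ∣._∣ ℤ.∣ a ∣) gcd≡p (gcd[m,n]∣n p ℤ.∣ a ∣)))) a≉0

-- Modulo p the good quadratics with (Δ / p) = (g / p) are counted by their roots s ± t√g.
module TwoRoots {p : ℕ} (pr : Prime p) (h′ : ℕ) (p≡1+2h : p ≡ suc (2 ℕ.* suc h′)) (n : ℕ)
                (g : ℤ) (g≉0 : ¬ g ≈ 0ℤ [mod p ]) (ε : ℤ)
                (legendre-g* : ∀ {y} → ¬ y ≈ 0ℤ [mod p ] → legendre (g * (y * y)) p ≡ ε)
                (ratio : ∀ {a} → ¬ a ≈ 0ℤ [mod p ] → legendre a p ≡ ε → ∃ λ y → g * (y * y) ≈ a [mod p ]) where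
  private
    module F = Fp pr
    module S = F.Squares h′ (trans (cong ℕ.pred p≡1+2h) (ℕₚ.*-comm 2 (suc h′)))
    instance p≢0 = prime⇒nonZero pr
    E = Quadratic.quotient 0ℤ (- g) p
  open CommutativeRing E using () renaming (_≈_ to _≋_; refl to ≋-refl; sym to ≋-sym; trans to ≋-trans; *-cong to ⊗-cong)
  open Algebra.Properties.Semiring.Exp (CommutativeRing.semiring E) using () renaming (_^_ to _^²_)

  -- α = s + t√g with α ≠ ᾱ, αᾱ ≠ 0 and αⁿ = ᾱ. The norm, rather than α, is required to be nonzero
  -- because the ring has zero divisors when g = 1.
  V : ℤ² → Set
  V (s , t) = ¬ t ≈ 0ℤ [mod p ] × ¬ (s * s - g * (t * t)) ≈ 0ℤ [mod p ] × (s , t) ^² n ≋ (s , - t)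

  V? : ∀ x → Dec (V x)
  V? (s , t) = ¬? (t ≈? 0ℤ [mod p ]) ×-dec ¬? ((s * s - g * (t * t)) ≈? 0ℤ [mod p ]) ×-dec
    (proj₁ ((s , t) ^² n) ≈? s [mod p ] ×-dec proj₂ ((s , t) ^² n) ≈? - t [mod p ])

  W : ℤ² → Set
  W x = Good n p x × legendre (discr x) p ≡ ε

  W? : ∀ x → Dec (W x)
  W? x = Good? n p x ×-dec legendre (discr x) p ℤ.≟ ε

  -- The coefficients of (X - α)(X - ᾱ): minus the trace of α, and its norm.
  minimal : ℤ² → ℤ²
  minimal (s , t) = - (+ 2 * s) , s * s - g * (t * t)

  2≉0 : ¬ + 2 ≈ 0ℤ [mod p ]
  2≉0 2≈0 = contradiction (residue-unique 2<p (ℕₚ.<-trans (ℕₚ.n<1+n 0) F.1<p) 2≈0) λ ()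
    where
    2<p : 2 ℕ.< p
    2<p = subst (2 ℕ.<_) (sym p≡1+2h) (ℕ.s≤s (ℕ.s≤s (subst (0 ℕ.<_) (sym (ℕₚ.+-suc h′ (h′ ℕ.+ 0))) (ℕ.s≤s ℕ.z≤n))))

  *≉0 : ∀ a b → ¬ a ≈ 0ℤ [mod p ] → ¬ b ≈ 0ℤ [mod p ] → ¬ a * b ≈ 0ℤ [mod p ]
  *≉0 a b a≉0 b≉0 ab≈0 = Sum.[ a≉0 , b≉0 ] (F.*≈0 a b ab≈0)

  -- X ↦ s + t√g respects X² + bX + c = 0, hence is a ring homomorphism and sends u + vX to (u + vs)
  -- + vt√g.
  power : ∀ {b c} s t → (b , c) ≈² minimal (s , t) [mod p ] → ∀ m →
          (s , t) ^² m ≋ (proj₁ (xpow b c m) + proj₂ (xpow b c m) * s , proj₂ (xpow b c m) * t)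
  power s t b,c≈ zero = ≋-refl
  power {b} {c} s t (b≈ , c≈) (suc m) = ≋-trans (⊗-cong (≋-refl {s , t}) (power {b} {c} s t (b≈ , c≈) m))
    (≈-lin₂ v (v * s) (eq₁ b c g s t u v) c≈ b≈ , ≈-lin (v * t) (eq₂ b s t u v) b≈)
    where
    u = proj₁ (xpow b c m)
    v = proj₂ (xpow b c m)
    eq₁ : ∀ b c g s t u v → s * (u + v * s) - - g * (t * (v * t)) - (- (c * v) + (u - b * v) * s) ≡
          v * (c - (s * s - g * (t * t))) + v * s * (b - - (+ 2 * s))
    eq₁ = solve-∀
    eq₂ : ∀ b s t u v → s * (v * t) + t * (u + v * s) - 0ℤ * (t * (v * t)) - (u - b * v) * t ≡
          v * t * (b - - (+ 2 * s))
    eq₂ = solve-∀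

  -- Δ = (α - ᾱ)², and α - ᾱ = 2t√g.
  discr-minimal : ∀ {b c} s t → (b , c) ≈² minimal (s , t) [mod p ] → discr (b , c) ≈ g * (+ 2 * t * (+ 2 * t)) [mod p ]
  discr-minimal {b} {c} s t (b≈ , c≈) = ≈-lin₂ (b - + 2 * s) (- + 4) (eq b c g s t) b≈ c≈
    where
    eq : ∀ b c g s t → b * b - + 4 * c - g * (+ 2 * t * (+ 2 * t)) ≡
         (b - + 2 * s) * (b - - (+ 2 * s)) + - + 4 * (c - (s * s - g * (t * t)))
    eq = solve-∀

  *t≈-t⇒≈-1 : ∀ v t → ¬ t ≈ 0ℤ [mod p ] → v * t ≈ - t [mod p ] → v ≈ - 1ℤ [mod p ]
  *t≈-t⇒≈-1 v t t≉0 vt≈-t = F.-≈0⇒≈ (Sum.[ (λ v+1≈0 → v+1≈0) , (λ t≈0 → contradiction t≈0 t≉0) ]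
    (F.*≈0 (v - - 1ℤ) t (≈-lin 1ℤ (eq t v) vt≈-t)))
    where
    eq : ∀ t v → (v - - 1ℤ) * t - 0ℤ ≡ 1ℤ * (v * t - - t)
    eq = solve-∀

  V⇒W : ∀ {x y} → V x → y ≈² minimal x [mod p ] → W y
  V⇒W {s , t} {b , c} (t≉0 , N≉0 , αⁿ≋ᾱ) (b≈ , c≈) =
    (≉0⇒coprime pr {c * discr (b , c)} (*≉0 c (discr (b , c)) (λ c≈0 → N≉0 (≈-trans (≈-sym c≈) c≈0)) (λ Δ≈0 → gτ²≉0 (≈-trans (≈-sym Δ≈) Δ≈0))) ,
      u≈-b , v≈-1) ,
    trans (legendre-cong Δ≈) (legendre-g* τ≉0)
    where
    τ = + 2 * t
    Δ≈ : discr (b , c) ≈ g * (τ * τ) [mod p ]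
    Δ≈ = discr-minimal s t (b≈ , c≈)
    τ≉0 : ¬ τ ≈ 0ℤ [mod p ]
    τ≉0 = *≉0 (+ 2) t 2≉0 t≉0
    gτ²≉0 : ¬ g * (τ * τ) ≈ 0ℤ [mod p ]
    gτ²≉0 = *≉0 g (τ * τ) g≉0 (*≉0 τ τ τ≉0 τ≉0)
    u = proj₁ (xpow b c n)
    v = proj₂ (xpow b c n)
    u+vs,vt≋ᾱ : (u + v * s , v * t) ≋ (s , - t)
    u+vs,vt≋ᾱ = ≋-trans (≋-sym (power {b} {c} s t (b≈ , c≈) n)) αⁿ≋ᾱ
    -- The coordinate at √g yields v = -1; the other one then yields u = 2s = -b.
    v≈-1 : v ≈ - 1ℤ [mod p ]
    v≈-1 = *t≈-t⇒≈-1 v t t≉0 (proj₂ u+vs,vt≋ᾱ)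
    u≈-b : u ≈ - b [mod p ]
    u≈-b = ≈-lin₃ 1ℤ (- s) 1ℤ (eq b s u v) (proj₁ u+vs,vt≋ᾱ) v≈-1 b≈
      where
      eq : ∀ b s u v → u - - b ≡ 1ℤ * (u + v * s - s) + - s * (v - - 1ℤ) + 1ℤ * (b - - (+ 2 * s))
      eq = solve-∀

  -- From g(2t)² = d = gy² follows (2t - y)(2t + y) = 0. Here w stands for ½.
  ±-roots : ∀ y t w d → w * + 2 ≈ 1ℤ [mod p ] → d ≈ g * (+ 2 * t * (+ 2 * t)) [mod p ] → g * (y * y) ≈ d [mod p ] →
            t ≈ w * y [mod p ] ⊎ t ≈ - (w * y) [mod p ]
  ±-roots y t w d w*2≈1 d≈ gy²≈d = Sum.[ (λ g≈0 → contradiction g≈0 g≉0) , (λ e → Sum.map plus minus (F.*≈0 A B e)) ]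
    (F.*≈0 g (A * B) (≈-lin₂ (- 1ℤ) (- 1ℤ) (eq g y t d) d≈ gy²≈d))
    where
    A = + 2 * t - y
    B = + 2 * t - - y
    eq : ∀ g y t d → g * ((+ 2 * t - y) * (+ 2 * t - - y)) - 0ℤ ≡
         - 1ℤ * (d - g * (+ 2 * t * (+ 2 * t))) + - 1ℤ * (g * (y * y) - d)
    eq = solve-∀
    eq₊ : ∀ t y w → t - w * y ≡ w * (+ 2 * t - y - 0ℤ) + - t * (w * + 2 - 1ℤ)
    eq₊ = solve-∀
    eq₋ : ∀ t y w → t - - (w * y) ≡ w * (+ 2 * t - - y - 0ℤ) + - t * (w * + 2 - 1ℤ)
    eq₋ = solve-∀
    plus : A ≈ 0ℤ [mod p ] → t ≈ w * y [mod p ]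
    plus e = ≈-lin₂ w (- t) (eq₊ t y w) e w*2≈1
    minus : B ≈ 0ℤ [mod p ] → t ≈ - (w * y) [mod p ]
    minus e = ≈-lin₂ w (- t) (eq₋ t y w) e w*2≈1

  module Preimages {b c : ℤ} (Wbc : W (b , c)) where
    w = proj₁ (S.inverse 2≉0)
    w*2≈1 = proj₂ (S.inverse 2≉0)
    cΔ≉0 : ¬ c * discr (b , c) ≈ 0ℤ [mod p ]
    cΔ≉0 = coprime⇒≉0 pr {c * discr (b , c)} (proj₁ (proj₁ Wbc))
    c≉0 : ¬ c ≈ 0ℤ [mod p ]
    c≉0 c≈0 = cΔ≉0 (≈-* c≈0 (≈-refl {a = discr (b , c)}))
    Δ≉0 : ¬ discr (b , c) ≈ 0ℤ [mod p ]
    Δ≉0 Δ≈0 = cΔ≉0 (≈-trans (≈-* (≈-refl {a = c}) Δ≈0) (≈-reflexive (ℤₚ.*-zeroʳ c)))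
    y = proj₁ (ratio Δ≉0 (proj₂ Wbc))
    gy²≈Δ = proj₂ (ratio Δ≉0 (proj₂ Wbc))
    -- The quadratic formula, with w = ½ and y = √(Δ/g).
    s = - (w * b)
    t = w * y
    u≈-b = proj₁ (proj₂ (proj₁ Wbc))
    v≈-1 = proj₂ (proj₂ (proj₁ Wbc))
    u = proj₁ (xpow b c n)
    v = proj₂ (xpow b c n)

    t≉0 : ¬ t ≈ 0ℤ [mod p ]
    t≉0 t≈0 = Δ≉0 (≈-lin₃ (- 1ℤ) (g * y * + 2) (- (g * y * y)) (eq g w y (discr (b , c))) gy²≈Δ t≈0 w*2≈1)
      where
      eq : ∀ g w y d → d - 0ℤ ≡ - 1ℤ * (g * (y * y) - d) + g * y * + 2 * (w * y - 0ℤ) + - (g * y * y) * (w * + 2 - 1ℤ)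
      eq = solve-∀

    -‿≉ : ∀ {x} → ¬ (x ≈² (s , t) [mod p ] × x ≈² (s , - t) [mod p ])
    -‿≉ {x₁ , x₂} ((_ , x≈t) , (_ , x≈-t)) = *≉0 (+ 2) t 2≉0 t≉0 (≈-lin₂ (- 1ℤ) 1ℤ (eq x₂ t) x≈t x≈-t)
      where
      eq : ∀ x t → + 2 * t - 0ℤ ≡ - 1ℤ * (x - t) + 1ℤ * (x - - t)
      eq = solve-∀

    -- Assuming only t′² = t² covers the two roots, with t and with - t, at once.
    root : ∀ {s′ t′} → s′ ≈ s [mod p ] → ¬ t′ ≈ 0ℤ [mod p ] → t′ * t′ ≈ t * t [mod p ] →
           V (s′ , t′) × (b , c) ≈² minimal (s′ , t′) [mod p ]
    root {s′} {t′} s′≈s t′≉0 t′²≈t² = (t′≉0 , (λ N≈0 → c≉0 (≈-trans c≈ N≈0)) ,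
        ≋-trans (power {b} {c} s′ t′ (b≈ , c≈) n)
          (≈-lin₃ 1ℤ s′ (- 1ℤ) (eq₃ b s′ u v) u≈-b v≈-1 b≈ , ≈-lin t′ (eq₄ t′ v) v≈-1)) , b≈ , c≈
      where
      eq₁ : ∀ b s′ w → b - - (+ 2 * s′) ≡ + 2 * (s′ - - (w * b)) + - b * (w * + 2 - 1ℤ)
      eq₁ = solve-∀
      b≈ : b ≈ - (+ 2 * s′) [mod p ]
      b≈ = ≈-lin₂ (+ 2) (- b) (eq₁ b s′ w) s′≈s w*2≈1
      eq₂ : ∀ b c g s′ t′ w y → c - (s′ * s′ - g * (t′ * t′)) ≡
            - (s′ - w * b) * (s′ - - (w * b)) + g * (t′ * t′ - w * y * (w * y)) +
            w * w * (g * (y * y) - (b * b - + 4 * c)) + - (c * (w * + 2 + 1ℤ)) * (w * + 2 - 1ℤ)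
      eq₂ = solve-∀
      c≈ : c ≈ s′ * s′ - g * (t′ * t′) [mod p ]
      c≈ = ≈-lin₄ (- (s′ - w * b)) g (w * w) (- (c * (w * + 2 + 1ℤ))) (eq₂ b c g s′ t′ w y) s′≈s t′²≈t² gy²≈Δ w*2≈1
      eq₃ : ∀ b s′ u v → u + v * s′ - s′ ≡ 1ℤ * (u - - b) + s′ * (v - - 1ℤ) + - 1ℤ * (b - - (+ 2 * s′))
      eq₃ = solve-∀
      eq₄ : ∀ t′ v → v * t′ - - t′ ≡ t′ * (v - - 1ℤ)
      eq₄ = solve-∀

    to : ∀ {x} → x ≈² (s , t) [mod p ] ⊎ x ≈² (s , - t) [mod p ] → V x × (b , c) ≈² minimal x [mod p ]
    to {s′ , t′} (inj₁ (s′≈s , t′≈t)) = root s′≈s (t≉0 ∘ ≈-trans (≈-sym t′≈t)) (≈-* t′≈t t′≈t)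
    to {s′ , t′} (inj₂ (s′≈s , t′≈-t)) = root s′≈s
      (λ t′≈0 → t≉0 (≈-lin₂ (- 1ℤ) 1ℤ (eq₁ t t′) t′≈0 t′≈-t)) (≈-trans (≈-* t′≈-t t′≈-t) (≈-reflexive (eq₂ t)))
      where
      eq₁ : ∀ t t′ → t - 0ℤ ≡ - 1ℤ * (t′ - 0ℤ) + 1ℤ * (t′ - - t)
      eq₁ = solve-∀
      eq₂ : ∀ t → - t * - t ≡ t * t
      eq₂ = solve-∀

    from : ∀ {x} → V x × (b , c) ≈² minimal x [mod p ] → x ≈² (s , t) [mod p ] ⊎ x ≈² (s , - t) [mod p ]
    from {s′ , t′} (_ , b≈ , c≈) = Sum.map (s′≈s ,_) (s′≈s ,_) t′≈±t
      where
      eq₁ : ∀ b s′ w → s′ - - (w * b) ≡ w * (b - - (+ 2 * s′)) + - s′ * (w * + 2 - 1ℤ)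
      eq₁ = solve-∀
      s′≈s : s′ ≈ s [mod p ]
      s′≈s = ≈-lin₂ w (- s′) (eq₁ b s′ w) b≈ w*2≈1
      t′≈±t : t′ ≈ t [mod p ] ⊎ t′ ≈ - t [mod p ]
      t′≈±t = ±-roots y t′ w (discr (b , c)) w*2≈1 (discr-minimal s′ t′ (b≈ , c≈)) gy²≈Δ

  V-count : ∑ (λ x → ⟦ V? x ⟧) (FiniteSetoid.elems (residues p ×ᶠ residues p)) ≡
            + 2 * ∑ (λ x → ⟦ W? x ⟧) (FiniteSetoid.elems (residues p ×ᶠ residues p))
  V-count = count-2-to-1 (residues p ×ᶠ residues p) (residues p ×ᶠ residues p) V? W? minimal
    (λ {x} {y} → V⇒W {x} {y})
    preimages
    where
    preimages : ∀ {y} → W y → ∃ λ z → ∃ λ z′ → (∀ {x} → ¬ (x ≈² z [mod p ] × x ≈² z′ [mod p ])) ×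
      (∀ x → (x ≈² z [mod p ] ⊎ x ≈² z′ [mod p ] → V x × y ≈² minimal x [mod p ]) ×
             (V x × y ≈² minimal x [mod p ] → x ≈² z [mod p ] ⊎ x ≈² z′ [mod p ]))
    preimages Wy = (s , t) , (s , - t) , (λ {x} → -‿≉ {x}) , (λ x → to , from)
      where
      open Preimages Wy

gcd-cong : ∀ {a b c d} → (∀ {k} → k ℕ∣.∣ a → k ℕ∣.∣ b → k ℕ∣.∣ c × k ℕ∣.∣ d) →
           (∀ {k} → k ℕ∣.∣ c → k ℕ∣.∣ d → k ℕ∣.∣ a × k ℕ∣.∣ b) → gcd a b ≡ gcd c d
gcd-cong {a} {b} {c} {d} to from = ℕ∣.∣-antisym
  (uncurry gcd-greatest (to (gcd[m,n]∣m a b) (gcd[m,n]∣n a b)))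
  (uncurry gcd-greatest (from (gcd[m,n]∣m c d) (gcd[m,n]∣n c d)))

module _ {p n : ℕ} .{{_ : ℕ.NonZero p}} (p≤n : p ℕ.≤ n) where
  private
    n-1≡ : n ℕ.∸ 1 ≡ (n ℕ.∸ p) ℕ.+ ℕ.pred p
    n-1≡ = trans (cong (ℕ._∸ 1) (sym (ℕₚ.m∸n+n≡m p≤n))) (ℕₚ.+-∸-assoc (n ℕ.∸ p) (ℕ.>-nonZero⁻¹ p))
    n²-1≡ : n ℕ.* n ℕ.∸ 1 ≡ (n ℕ.∸ p) ℕ.* (n ℕ.+ p) ℕ.+ (p ℕ.* p ℕ.∸ 1)
    n²-1≡ = trans (cong (λ m → m ℕ.* m ℕ.∸ 1) (sym (ℕₚ.m∸n+n≡m p≤n)))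
      (trans (cong (ℕ._∸ 1) (eq (n ℕ.∸ p) p))
      (trans (ℕₚ.+-∸-assoc ((n ℕ.∸ p) ℕ.* ((n ℕ.∸ p) ℕ.+ p ℕ.+ p)) (ℕ.>-nonZero⁻¹ (p ℕ.* p) {{ℕₚ.m*n≢0 p p}}))
        (cong (λ m → (n ℕ.∸ p) ℕ.* (m ℕ.+ p) ℕ.+ (p ℕ.* p ℕ.∸ 1)) (ℕₚ.m∸n+n≡m p≤n))))
      where
      eq : ∀ m p → (m ℕ.+ p) ℕ.* (m ℕ.+ p) ≡ m ℕ.* (m ℕ.+ p ℕ.+ p) ℕ.+ p ℕ.* p
      eq = ℕ-solve-∀

  -- n - 1 = (n - p) + (p - 1).
  gcd[n-p,p-1] : gcd (n ℕ.∸ p) (ℕ.pred p) ≡ gcd (n ℕ.∸ 1) (p ℕ.∸ 1)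
  gcd[n-p,p-1] = gcd-cong
    (λ {k} k∣n-p k∣p-1 → subst (k ℕ∣.∣_) (sym n-1≡) (ℕ∣.∣m∣n⇒∣m+n k∣n-p k∣p-1) , k∣p-1)
    (λ {k} k∣n-1 k∣p-1 → ℕ∣.∣m+n∣m⇒∣n (subst (k ℕ∣.∣_) (trans n-1≡ (ℕₚ.+-comm (n ℕ.∸ p) (ℕ.pred p))) k∣n-1) k∣p-1 , k∣p-1)

  -- n² - 1 = (n - p)(n + p) + (p² - 1), so a common divisor of n - p and p² - 1 divides n² - 1.
  gcd[n-p,p²-1] : gcd (n ℕ.∸ p) (p ℕ.* p ℕ.∸ 1) ≡ gcd (p ℕ.* p ℕ.∸ 1) (gcd (n ℕ.* n ℕ.∸ 1) (n ℕ.∸ p))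
  gcd[n-p,p²-1] = gcd-cong
    (λ {k} k∣n-p k∣p²-1 → k∣p²-1 , gcd-greatest (subst (k ℕ∣.∣_) (sym n²-1≡) (ℕ∣.∣m∣n⇒∣m+n (ℕ∣.∣m⇒∣m*n (n ℕ.+ p) k∣n-p) k∣p²-1)) k∣n-p)
    (λ k∣p²-1 k∣gcd → ℕ∣.∣-trans k∣gcd (gcd[m,n]∣n (n ℕ.* n ℕ.∸ 1) (n ℕ.∸ p)) , k∣p²-1)

-- Two moduli appear: N will be a power of p, while the sign ε of the discriminant is always read
-- off modulo p.
LocalGood : (n p N : ℕ) → ℤ → ℤ² → Set
LocalGood n p N ε x = Good n N x × legendre (discr x) p ≡ ε

LocalGood? : ∀ n p N ε x → Dec (LocalGood n p N ε x)
LocalGood? n p N ε x = Good? n N x ×-dec legendre (discr x) p ℤ.≟ ε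

localCount : (n p N : ℕ) .{{_ : ℕ.NonZero N}} → ℤ → ℤ
localCount n p N ε = ∑ (λ x → ⟦ LocalGood? n p N ε x ⟧) (FiniteSetoid.elems (residues N ×ᶠ residues N))

module Counts {p : ℕ} (pr : Prime p) (h′ : ℕ) (p≡1+2h : p ≡ suc (2 ℕ.* suc h′)) (n : ℕ) (p≤n : p ℕ.≤ n) where
  private
    module F = Fp pr
    module S = F.Squares h′ (trans (cong ℕ.pred p≡1+2h) (ℕₚ.*-comm 2 (suc h′)))
    instance
      p≢0 = prime⇒nonZero pr
      r≢0 : ℕ.NonZero F.r
      r≢0 = ℕ.≢-nonZero λ r≡0 → contradiction (trans (sym r≡0) (cong ℕ.pred p≡1+2h)) λ ()
      p*p≢0 = ℕₚ.m*n≢0 p p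
      r²≢0 : ℕ.NonZero (ℕ.pred (p ℕ.* p))
      r²≢0 = ℕ.≢-nonZero λ p²-1≡0 → ℕₚ.<⇒≱ F.1<p
        (subst (p ℕ.≤_) (trans (sym (ℕₚ.suc-pred (p ℕ.* p))) (cong suc p²-1≡0)) (ℕₚ.m≤m*n p p))

  +⇒- : ∀ {a b c} → a + b ≡ c → a ≡ c - b
  +⇒- {a} {b} refl = eq a b
    where
    eq : ∀ a b → a ≡ a + b - b
    eq = solve-∀

  -- As ᾱ = αᵖ, the equation αⁿ = ᾱ for nonzero α reads α^(n-p) = 1. From all solutions in the field
  -- with p² elements (`U`) those lying in 𝔽ₚ (`B`) are subtracted.
  inert-count : + 2 * localCount n p p ℤ.-1ℤ ≡
                + gcd (p ℕ.* p ℕ.∸ 1) (gcd (n ℕ.* n ℕ.∸ 1) (n ℕ.∸ p)) - + gcd (n ℕ.∸ 1) (p ℕ.∸ 1)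
  inert-count = trans (sym T.V-count) (trans (+⇒- (trans (sym (∑-+ _ _ (FiniteSetoid.elems K.Fᵖ²))) (∑-cong split (FiniteSetoid.elems K.Fᵖ²))))
    (cong₂ _-_ (trans (K.roots-of-unity-count² m) (cong +_ (gcd[n-p,p²-1] p≤n)))
               (trans base-count (trans (F.roots-of-unity-count m) (cong +_ (gcd[n-p,p-1] p≤n))))))
    where
    m = n ℕ.∸ p
    g = proj₁ S.∃nonsquare
    g≉0 = proj₁ (proj₂ S.∃nonsquare)
    g-ns = proj₂ (proj₂ S.∃nonsquare)
    module K = Fp² pr h′ p≡1+2h g g≉0 g-ns
    legendre-g* : ∀ {y} → ¬ y ≈ 0ℤ [mod p ] → legendre (g * (y * y)) p ≡ ℤ.-1ℤ
    legendre-g* {y} y≉0 = nonsquare⇒legendre≡-1 λ (z , z²≈gy²) → let (u , uy≈1) = S.inverse y≉0 in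
      g-ns (u * z , ≈-lin₂ (u * u) (g * (u * y + 1ℤ)) (eq g u y z) z²≈gy² uy≈1)
      where
      eq : ∀ g u y z → u * z * (u * z) - g ≡ u * u * (z * z - g * (y * y)) + g * (u * y + 1ℤ) * (u * y - 1ℤ)
      eq = solve-∀
    ratio : ∀ {a} → ¬ a ≈ 0ℤ [mod p ] → legendre a p ≡ ℤ.-1ℤ → ∃ λ y → g * (y * y) ≈ a [mod p ]
    ratio {a} a≉0 l≡-1 = S.nonsquares-ratio a≉0 (proj₂ (legendre≡-1⇒nonsquare {p} {a} l≡-1)) g≉0 g-ns
    module T = TwoRoots pr h′ p≡1+2h n g g≉0 ℤ.-1ℤ legendre-g* ratio
    open CommutativeRing K.E using () renaming (_≈_ to _≋_; trans to ≋-trans)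
    0² : ℤ²
    0² = 0ℤ , 0ℤ
    1² : ℤ²
    1² = 1ℤ , 0ℤ
    _≋?_ : ∀ x y → Dec (x ≋ y)
    _≋?_ = FiniteSetoid._≈?_ K.Fᵖ²
    U B : ℤ² → Set
    U x = ¬ x ≋ 0² × x K.^² m ≋ 1²
    B x = proj₂ x ≈ 0ℤ [mod p ] × U x
    U? : ∀ x → Dec (U x)
    U? x = ¬? (x ≋? 0²) ×-dec (x K.^² m) ≋? 1²
    B? : ∀ x → Dec (B x)
    B? x = (proj₂ x ≈? 0ℤ [mod p ]) ×-dec U? x
    V⇒U : ∀ s t → T.V (s , t) → U (s , t)
    V⇒U s t (t≉0 , N≉0 , xⁿ≋x̄) = (t≉0 ∘ proj₂) , K.^²-+p≋conj⇒≋1 m s t t≉0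
      (subst (λ e → (s , t) K.^² e ≋ (s , - t)) (sym (ℕₚ.m∸n+n≡m p≤n)) xⁿ≋x̄)
    U⇒V : ∀ s t → ¬ t ≈ 0ℤ [mod p ] → U (s , t) → T.V (s , t)
    U⇒V s t t≉0 (x≉0 , xᵐ≋1) = t≉0 , (λ N≈0 → x≉0 (K.norm-0 s t N≈0)) ,
      subst (λ e → (s , t) K.^² e ≋ (s , - t)) (ℕₚ.m∸n+n≡m p≤n) (K.≋1⇒^²-+p≋conj m s t xᵐ≋1)
    split : ∀ x → ⟦ T.V? x ⟧ + ⟦ B? x ⟧ ≡ ⟦ U? x ⟧
    split x = trans (sym (⟦⟧-⊎ (T.V? x) (B? x) λ (Vx , Bx) → proj₁ Vx (proj₁ Bx)))
      (⟦⟧-cong (T.V? x ⊎-dec B? x) (U? x) Sum.[ V⇒U (proj₁ x) (proj₂ x) , proj₂ ] (from (proj₂ x ≈? 0ℤ [mod p ])))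
      where
      from : Dec (proj₂ x ≈ 0ℤ [mod p ]) → U x → T.V x ⊎ B x
      from (yes t≈0) Ux = inj₂ (t≈0 , Ux)
      from (no t≉0)  Ux = inj₁ (U⇒V (proj₁ x) (proj₂ x) t≉0 Ux)
    U₁? : ∀ a → Dec (¬ a ≈ 0ℤ [mod p ] × a F.^ m ≈ 1ℤ [mod p ])
    U₁? a = ¬? (a ≈? 0ℤ [mod p ]) ×-dec (a F.^ m) ≈? 1ℤ [mod p ]
    base-count : ∑ (λ x → ⟦ B? x ⟧) (FiniteSetoid.elems K.Fᵖ²) ≡ F.# U₁?
    base-count = count-1-to-1 K.Fᵖ² (residues p) B? U₁? proj₁ to
      (λ {y} (y≉0 , yᵐ≈1) → (y , 0ℤ) , λ x → from y≉0 yᵐ≈1 , λ ((t≈0 , _) , y≈s) → ≈-sym y≈s , t≈0)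
      where
      to : ∀ {x y} → B x → y ≈ proj₁ x [mod p ] → ¬ y ≈ 0ℤ [mod p ] × y F.^ m ≈ 1ℤ [mod p ]
      to {s , t} {y} (t≈0 , x≉0 , xᵐ≋1) y≈s = (λ y≈0 → x≉0 (≈-trans (≈-sym y≈s) y≈0 , t≈0)) ,
        proj₁ (≋-trans (K.≋-lift (sym (K.ι-^ y m))) (≋-trans (K.^²-congˡ m (y≈s , ≈-sym t≈0)) xᵐ≋1))
      from : ∀ {x y} → ¬ y ≈ 0ℤ [mod p ] → y F.^ m ≈ 1ℤ [mod p ] → x ≋ (y , 0ℤ) →
             B x × y ≈ proj₁ x [mod p ]
      from {s , t} {y} y≉0 yᵐ≈1 (s≈y , t≈0) = (t≈0 , (λ x≋0 → y≉0 (≈-trans (≈-sym s≈y) (proj₁ x≋0))) ,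
        ≋-trans (K.^²-congˡ m (s≈y , t≈0)) (≋-trans (K.≋-lift (K.ι-^ y m)) (yᵐ≈1 , ≈-refl))) , ≈-sym s≈y

  -- For g = 1 the map (s , t) ↦ (s + t , s - t) identifies 𝔽ₚ[√g] with 𝔽ₚ × 𝔽ₚ, and conjugation swaps the factors.
  module Split (g : ℤ) (g≈1 : g ≈ 1ℤ [mod p ]) .{{_ : ℕ.NonZero n}} where
    legendre-g* : ∀ {y} → ¬ y ≈ 0ℤ [mod p ] → legendre (g * (y * y)) p ≡ 1ℤ
    legendre-g* {y} y≉0 = square⇒legendre≡1 {a = g * (y * y)}
      (λ gy²≈0 → Sum.[ y≉0 , y≉0 ] (F.*≈0 y y (≈-lin₂ (- (y * y)) 1ℤ (eq₁ g y) g≈1 gy²≈0)))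
      (y , ≈-lin (- (y * y)) (eq₂ g y) g≈1)
      where
      eq₁ : ∀ g y → y * y - 0ℤ ≡ - (y * y) * (g - 1ℤ) + 1ℤ * (g * (y * y) - 0ℤ)
      eq₁ = solve-∀
      eq₂ : ∀ g y → y * y - g * (y * y) ≡ - (y * y) * (g - 1ℤ)
      eq₂ = solve-∀
    ratio : ∀ {a} → ¬ a ≈ 0ℤ [mod p ] → legendre a p ≡ 1ℤ → ∃ λ y → g * (y * y) ≈ a [mod p ]
    ratio {a} _ l≡1 = let (y , y²≈a) = proj₂ (legendre≡1⇒square {p} {a} l≡1) in y , ≈-lin₂ (y * y) 1ℤ (eq g y a) g≈1 y²≈a
      where
      eq : ∀ g y a → g * (y * y) - a ≡ y * y * (g - 1ℤ) + 1ℤ * (y * y - a)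
      eq = solve-∀
    g≉0 : ¬ g ≈ 0ℤ [mod p ]
    g≉0 g≈0 = F.1≉0 (≈-trans (≈-sym g≈1) g≈0)
    module T = TwoRoots pr h′ p≡1+2h n g g≉0 1ℤ legendre-g* ratio
    open Algebra.Properties.Semiring.Exp (CommutativeRing.semiring (Quadratic.quotient 0ℤ (- g) p)) using () renaming (_^_ to _^²_)

    -- As g = 1, √g ↦ 1 is a ring homomorphism to 𝔽ₚ; `power-minus` is the same for √g ↦ -1.
    power-plus : ∀ m s t → proj₁ ((s , t) ^² m) + proj₂ ((s , t) ^² m) ≈ (s + t) F.^ m [mod p ]
    power-plus zero    s t = ≈-refl
    power-plus (suc m) s t = ≈-lin₂ (s + t) (t * v) (eq g s t u v ((s + t) F.^ m)) (power-plus m s t) g≈1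
      where
      u = proj₁ ((s , t) ^² m)
      v = proj₂ ((s , t) ^² m)
      eq : ∀ g s t u v q → s * u - - g * (t * v) + (s * v + t * u - 0ℤ * (t * v)) - (s + t) * q ≡
           (s + t) * (u + v - q) + t * v * (g - 1ℤ)
      eq = solve-∀

    power-minus : ∀ m s t → proj₁ ((s , t) ^² m) - proj₂ ((s , t) ^² m) ≈ (s - t) F.^ m [mod p ]
    power-minus zero    s t = ≈-refl
    power-minus (suc m) s t = ≈-lin₂ (s - t) (t * v) (eq g s t u v ((s - t) F.^ m)) (power-minus m s t) g≈1
      where
      u = proj₁ ((s , t) ^² m)
      v = proj₂ ((s , t) ^² m)
      eq : ∀ g s t u v q → s * u - - g * (t * v) - (s * v + t * u - 0ℤ * (t * v)) - (s - t) * q ≡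
           (s - t) * (u - v - q) + t * v * (g - 1ℤ)
      eq = solve-∀

    w = proj₁ (S.inverse T.2≉0)
    w*2≈1 = proj₂ (S.inverse T.2≉0)

    -- In 𝔽ₚ × 𝔽ₚ the equation (a , a′)ⁿ = (a′ , a) forces a′ = aⁿ and then a^(n²) = a, so a alone
    -- determines the pair. The inequality is a′ ≠ a, that is, t ≠ 0.
    P : ℤ → Set
    P a = ¬ a F.^ n ≈ a [mod p ] × a F.^ (n ℕ.* n) ≈ a [mod p ]
    P? : ∀ a → Dec (P a)
    P? a = ¬? ((a F.^ n) ≈? a [mod p ]) ×-dec (a F.^ (n ℕ.* n)) ≈? a [mod p ]

    u+v≈s-t : ∀ {s t u v} → u ≈ s [mod p ] → v ≈ - t [mod p ] → u + v ≈ s - t [mod p ]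
    u+v≈s-t u≈s v≈-t = ≈-+ u≈s v≈-t

    u-v≈s+t : ∀ {s t u v} → u ≈ s [mod p ] → v ≈ - t [mod p ] → u - v ≈ s + t [mod p ]
    u-v≈s+t {s} {t} {u} {v} = ≈-lin₂ 1ℤ (- 1ℤ) (eq s t u v)
      where
      eq : ∀ s t u v → u - v - (s + t) ≡ 1ℤ * (u - s) + - 1ℤ * (v - - t)
      eq = solve-∀

    V⇒swap : ∀ s t → T.V (s , t) → (s + t) F.^ n ≈ s - t [mod p ] × (s - t) F.^ n ≈ s + t [mod p ]
    V⇒swap s t (_ , _ , u≈s , v≈-t) = ≈-trans (≈-sym (power-plus n s t)) (u+v≈s-t u≈s v≈-t) ,
                                      ≈-trans (≈-sym (power-minus n s t)) (u-v≈s+t u≈s v≈-t)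

    s-t≉s+t : ∀ s t → ¬ t ≈ 0ℤ [mod p ] → ¬ s - t ≈ s + t [mod p ]
    s-t≉s+t s t t≉0 e = T.*≉0 (+ 2) t T.2≉0 t≉0 (≈-lin (- 1ℤ) (eq s t) e)
      where
      eq : ∀ s t → + 2 * t - 0ℤ ≡ - 1ℤ * (s - t - (s + t))
      eq = solve-∀

    V⇒P : ∀ s t a → T.V (s , t) → a ≈ s + t [mod p ] → P a
    V⇒P s t a Vst a≈s+t =
      (λ aⁿ≈a → s-t≉s+t s t (proj₁ Vst) (≈-trans (≈-sym aⁿ≈s-t) (≈-trans aⁿ≈a a≈s+t))) ,
      ≈-trans (≈-sym (F.^-assocʳ a n n)) (≈-trans (F.^-congˡ n aⁿ≈s-t) (≈-trans (proj₂ (V⇒swap s t Vst)) (≈-sym a≈s+t)))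
      where
      aⁿ≈s-t : a F.^ n ≈ s - t [mod p ]
      aⁿ≈s-t = ≈-trans (F.^-congˡ n a≈s+t) (proj₁ (V⇒swap s t Vst))

    halves : ∀ {s t a a′} → a ≈ s + t [mod p ] → a′ ≈ s - t [mod p ] →
             s ≈ w * (a + a′) [mod p ] × t ≈ w * (a - a′) [mod p ]
    halves {s} {t} {a} {a′} a≈ a′≈ =
      ≈-lin₃ (- w) (- w) (- s) (eq₁ s t a a′ w) a≈ a′≈ w*2≈1 , ≈-lin₃ (- w) w (- t) (eq₂ s t a a′ w) a≈ a′≈ w*2≈1
      where
      eq₁ : ∀ s t a a′ w → s - w * (a + a′) ≡ - w * (a - (s + t)) + - w * (a′ - (s - t)) + - s * (w * + 2 - 1ℤ)
      eq₁ = solve-∀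
      eq₂ : ∀ s t a a′ w → t - w * (a - a′) ≡ - w * (a - (s + t)) + w * (a′ - (s - t)) + - t * (w * + 2 - 1ℤ)
      eq₂ = solve-∀

    unhalves : ∀ {s t a a′} → s ≈ w * (a + a′) [mod p ] → t ≈ w * (a - a′) [mod p ] →
               a ≈ s + t [mod p ] × a′ ≈ s - t [mod p ]
    unhalves {s} {t} {a} {a′} s≈ t≈ =
      ≈-lin₃ (- 1ℤ) (- 1ℤ) (- a) (eq₁ s t a a′ w) s≈ t≈ w*2≈1 , ≈-lin₃ (- 1ℤ) 1ℤ (- a′) (eq₂ s t a a′ w) s≈ t≈ w*2≈1
      where
      eq₁ : ∀ s t a a′ w → a - (s + t) ≡ - 1ℤ * (s - w * (a + a′)) + - 1ℤ * (t - w * (a - a′)) + - a * (w * + 2 - 1ℤ)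
      eq₁ = solve-∀
      eq₂ : ∀ s t a a′ w → a′ - (s - t) ≡ - 1ℤ * (s - w * (a + a′)) + 1ℤ * (t - w * (a - a′)) + - a′ * (w * + 2 - 1ℤ)
      eq₂ = solve-∀

    conjugate : ∀ {s t u v} → u + v ≈ s - t [mod p ] → u - v ≈ s + t [mod p ] → u ≈ s [mod p ] × v ≈ - t [mod p ]
    conjugate {s} {t} {u} {v} e₁ e₂ =
      ≈-lin₃ w w (- (u - s)) (eq₁ s t u v w) e₁ e₂ w*2≈1 , ≈-lin₃ w (- w) (- (v + t)) (eq₂ s t u v w) e₁ e₂ w*2≈1
      where
      eq₁ : ∀ s t u v w → u - s ≡ w * (u + v - (s - t)) + w * (u - v - (s + t)) + - (u - s) * (w * + 2 - 1ℤ)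
      eq₁ = solve-∀
      eq₂ : ∀ s t u v w → v - - t ≡ w * (u + v - (s - t)) + - w * (u - v - (s + t)) + - (v + t) * (w * + 2 - 1ℤ)
      eq₂ = solve-∀

    -- The norm s² - t² is the product aa′, and 2t = a - a′.
    swap⇒V : ∀ s t a a′ → a ≈ s + t [mod p ] → a′ ≈ s - t [mod p ] → a F.^ n ≈ a′ [mod p ] → a′ F.^ n ≈ a [mod p ] →
             ¬ a′ ≈ a [mod p ] → ¬ a ≈ 0ℤ [mod p ] → ¬ a′ ≈ 0ℤ [mod p ] → T.V (s , t)
    swap⇒V s t a a′ a≈ a′≈ aⁿ≈a′ a′ⁿ≈a a′≉a a≉0 a′≉0 =
      (λ t≈0 → a′≉a (≈-lin₃ 1ℤ (- 1ℤ) (- + 2) (eq₁ s t a a′) a′≈ a≈ t≈0)) ,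
      (λ N≈0 → T.*≉0 a a′ a≉0 a′≉0 (≈-lin₄ a′ (s + t) 1ℤ (t * t) (eq₂ g s t a a′) a≈ a′≈ N≈0 g≈1)) ,
      conjugate (≈-trans (power-plus n s t) (≈-trans (F.^-congˡ n (≈-sym a≈)) (≈-trans aⁿ≈a′ a′≈)))
                (≈-trans (power-minus n s t) (≈-trans (F.^-congˡ n (≈-sym a′≈)) (≈-trans a′ⁿ≈a a≈)))
      where
      eq₁ : ∀ s t a a′ → a′ - a ≡ 1ℤ * (a′ - (s - t)) + - 1ℤ * (a - (s + t)) + - + 2 * (t - 0ℤ)
      eq₁ = solve-∀
      eq₂ : ∀ g s t a a′ → a * a′ - 0ℤ ≡ a′ * (a - (s + t)) + (s + t) * (a′ - (s - t)) + 1ℤ * (s * s - g * (t * t) - 0ℤ) + t * t * (g - 1ℤ)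
      eq₂ = solve-∀

    0^n≈0 : ∀ m .{{_ : ℕ.NonZero m}} {a} → a ≈ 0ℤ [mod p ] → a F.^ m ≈ 0ℤ [mod p ]
    0^n≈0 (suc m) {a} a≈0 = ≈-* a≈0 (≈-refl {a = a F.^ m})

    P⇒V : ∀ a → P a → ∀ s t → s ≈ w * (a + a F.^ n) [mod p ] → t ≈ w * (a - a F.^ n) [mod p ] → T.V (s , t)
    P⇒V a (aⁿ≉a , aⁿⁿ≈a) s t s≈ t≈ = swap⇒V s t a (a F.^ n) (proj₁ (unhalves {a = a} {a F.^ n} s≈ t≈)) (proj₂ (unhalves {a = a} {a F.^ n} s≈ t≈)) ≈-refl
      a′ⁿ≈a aⁿ≉a a≉0 (λ a′≈0 → a≉0 (≈-trans (≈-sym a′ⁿ≈a) (0^n≈0 n a′≈0)))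
      where
      a′ⁿ≈a : (a F.^ n) F.^ n ≈ a [mod p ]
      a′ⁿ≈a = ≈-trans (F.^-assocʳ a n n) aⁿⁿ≈a
      a≉0 : ¬ a ≈ 0ℤ [mod p ]
      a≉0 a≈0 = aⁿ≉a (≈-trans (0^n≈0 n a≈0) (≈-sym a≈0))

    V⇒halves : ∀ s t a → T.V (s , t) → a ≈ s + t [mod p ] → s ≈ w * (a + a F.^ n) [mod p ] × t ≈ w * (a - a F.^ n) [mod p ]
    V⇒halves s t a Vst a≈ = halves a≈ (≈-trans (F.^-congˡ n a≈) (proj₁ (V⇒swap s t Vst)))

    split-count : + 2 * localCount n p p 1ℤ ≡ + gcd (n ℕ.* n ℕ.∸ 1) (p ℕ.∸ 1) - + gcd (n ℕ.∸ 1) (p ℕ.∸ 1)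
    split-count = trans (sym T.V-count) (trans
      (count-1-to-1 (residues p ×ᶠ residues p) (residues p) T.V? P? (λ x → proj₁ x + proj₂ x)
        (λ {x} {a} → V⇒P (proj₁ x) (proj₂ x) a)
        (λ {a} Pa → (w * (a + a F.^ n) , w * (a - a F.^ n)) , λ x →
          (λ e → P⇒V a Pa (proj₁ x) (proj₂ x) (proj₁ e) (proj₂ e) , proj₁ (unhalves {a = a} {a F.^ n} (proj₁ e) (proj₂ e))) ,
          (λ e → V⇒halves (proj₁ x) (proj₂ x) a (proj₁ e) (proj₂ e))))
      (F.period-2-count n))

-- Lifting to prime powers

-- Coprimality together with an inverse: in this form it can be cancelled from congruences and
-- passes to products of moduli by a formula.
Unit : ℕ → ℤ → Set
Unit N a = ∃ λ u → u * a ≈ 1ℤ [mod N ]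

module _ {N : ℕ} where
  Unit-cong : ∀ {a b} → a ≈ b [mod N ] → Unit N a → Unit N b
  Unit-cong {a} {b} a≈b (u , ua≈1) = u , ≈-lin₂ (- u) 1ℤ (eq a b u) a≈b ua≈1
    where
    eq : ∀ a b u → u * b - 1ℤ ≡ - u * (a - b) + 1ℤ * (u * a - 1ℤ)
    eq = solve-∀

  Unit-neg : ∀ {a} → Unit N (- a) → Unit N a
  Unit-neg {a} (u , e) = - u , ≈-trans (≈-reflexive (eq a u)) e
    where
    eq : ∀ a u → - u * a ≡ u * - a
    eq = solve-∀

  Unit-*ʳ : ∀ a b → Unit N (a * b) → Unit N b
  Unit-*ʳ a b (u , e) = u * a , ≈-trans (≈-reflexive (ℤₚ.*-assoc u a b)) e

  Unit-cancel : ∀ {a} x → Unit N a → a * x ≈ 0ℤ [mod N ] → x ≈ 0ℤ [mod N ]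
  Unit-cancel {a} x (u , ua≈1) ax≈0 = ≈-lin₂ u (- x) (eq a x u) ax≈0 ua≈1
    where
    eq : ∀ a x u → x - 0ℤ ≡ u * (a * x - 0ℤ) + - x * (u * a - 1ℤ)
    eq = solve-∀

  coprime⇒Unit : ∀ a → gcd N ℤ.∣ a ∣ ≡ 1 → Unit N a
  coprime⇒Unit a gcd≡1 = go (coprime-Bézout (gcd≡1⇒coprime gcd≡1))
    where
    abs-unit : ∀ a → Unit N (+ ℤ.∣ a ∣) → Unit N a
    abs-unit (+ _)        e = e
    abs-unit (ℤ.-[1+ k ]) e = Unit-neg {a = ℤ.-[1+ k ]} e
    cast : ∀ x y z w → 1 ℕ.+ x ℕ.* y ≡ z ℕ.* w → 1ℤ + + x * + y ≡ + z * + w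
    cast x y z w e = trans (cong (_+_ 1ℤ) (sym (ℤₚ.pos-* x y))) (trans (cong +_ e) (ℤₚ.pos-* z w))
    move₁ : ∀ a b c d → 1ℤ + a * b ≡ c * d → - a * b - 1ℤ ≡ - c * d
    move₁ a b c d e = trans (eq₁ (a * b) a b) (trans (cong -_ e) (ℤₚ.neg-distribˡ-* c d))
      where
      eq₁ : ∀ ab a b → - a * b - 1ℤ ≡ - (1ℤ + a * b)
      eq₁ = solve-∀
    move₂ : ∀ a b c d → 1ℤ + a * b ≡ c * d → c * d - 1ℤ ≡ a * b
    move₂ a b c d e = trans (cong (_- 1ℤ) (sym e)) (eq₂ (a * b))
      where
      eq₂ : ∀ x → 1ℤ + x - 1ℤ ≡ x
      eq₂ = solve-∀
    go : Bézout.Identity 1 N ℤ.∣ a ∣ → Unit N a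
    go (Bézout.+- x y e) = abs-unit a (- + y , modulo (divides (- + x) (move₁ (+ y) (+ ℤ.∣ a ∣) (+ x) (+ N) (cast y ℤ.∣ a ∣ x N e))))
    go (Bézout.-+ x y e) = abs-unit a (+ y , modulo (divides (+ x) (move₂ (+ x) (+ N) (+ y) (+ ℤ.∣ a ∣) (cast x N y ℤ.∣ a ∣ e))))

  Unit⇒coprime : ∀ a → Unit N a → gcd N ℤ.∣ a ∣ ≡ 1
  Unit⇒coprime a (u , ua≈1) = ℕ∣.∣1⇒≡1 (∣⇒∣ᵤ {+ d} {1ℤ} (subst (+ d ∣ᶻ_) (eq (u * a))
    (ℤ∣.∣m∣n⇒∣m-n (ℤ∣.∣n⇒∣m*n u (∣ᵤ⇒∣ {+ d} {a} (gcd[m,n]∣n N ℤ.∣ a ∣)))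
                  (ℤ∣.∣-trans (∣ᵤ⇒∣ (gcd[m,n]∣m N ℤ.∣ a ∣)) (N∣a-b ua≈1)))))
    where
    d = gcd N ℤ.∣ a ∣
    eq : ∀ x → x - (x - 1ℤ) ≡ 1ℤ
    eq = solve-∀

∣-*-mono : ∀ {M N a b} → + M ∣ᶻ a → + N ∣ᶻ b → + (M ℕ.* N) ∣ᶻ a * b
∣-*-mono {M} {N} (divides q refl) (divides r refl) = divides (q * r) (trans (eq q r (+ M) (+ N)) (cong (q * r *_) (sym (ℤₚ.pos-* M N))))
  where
  eq : ∀ q r m n → q * m * (r * n) ≡ q * r * (m * n)
  eq = solve-∀

-- The product of the errors ua - 1 and va - 1 is a multiple of MN, and its negative has the form
-- (...)a - 1. M and N may share factors, as the passage from p to its powers demands.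
Unit-* : ∀ {M N a} → Unit M a → Unit N a → Unit (M ℕ.* N) a
Unit-* {M} {N} {a} (u , ua≈1) (v , va≈1) = u + v - u * v * a , modulo (subst (+ (M ℕ.* N) ∣ᶻ_) (eq u v a)
  (ℤ∣.∣m⇒∣-m (∣-*-mono {M} {N} (N∣a-b ua≈1) (N∣a-b va≈1))))
  where
  eq : ∀ u v a → - ((u * a - 1ℤ) * (v * a - 1ℤ)) ≡ (u + v - u * v * a) * a - 1ℤ
  eq = solve-∀

Unit-coarsen : ∀ {M N a} → M ℕ∣.∣ N → Unit N a → Unit M a
Unit-coarsen M∣N (u , e) = u , ≈-coarsen M∣N e

Unit-^ : ∀ {p a} k → Unit p a → Unit (p ℕ.^ k) a
Unit-^         zero    _ = 0ℤ , modulo (divides (- 1ℤ) refl)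
Unit-^ {p} {a} (suc k) e = Unit-* {p} {p ℕ.^ k} {a} e (Unit-^ {p} {a} k e)

module _ {N : ℕ} where
  xpow-cong : ∀ {b c b′ c′} m → (b , c) ≈² (b′ , c′) [mod N ] → xpow b c m ≈² xpow b′ c′ m [mod N ]
  xpow-cong zero    _         = ≈-refl , ≈-refl
  xpow-cong (suc m) (b≈ , c≈) = let (u≈ , v≈) = xpow-cong m (b≈ , c≈) in
    ≈-neg (≈-* c≈ v≈) , ≈-- u≈ (≈-* b≈ v≈)

  discr-cong : ∀ {x y} → x ≈² y [mod N ] → discr x ≈ discr y [mod N ]
  discr-cong (b≈ , c≈) = ≈-- (≈-* b≈ b≈) (≈-* (≈-refl {a = + 4}) c≈)

  Good⇒Unit : ∀ {n} x → Good n N x → Unit N (proj₂ x * discr x)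
  Good⇒Unit x g = coprime⇒Unit (proj₂ x * discr x) (proj₁ g)

  mkGood : ∀ {n} x → Unit N (proj₂ x * discr x) → xpow (proj₁ x) (proj₂ x) n ≈² (- proj₁ x , - 1ℤ) [mod N ] → Good n N x
  mkGood x e p = Unit⇒coprime (proj₂ x * discr x) e , p

  Good-cong : ∀ {n} x y → x ≈² y [mod N ] → Good n N x → Good n N y
  Good-cong {n} x@(b , c) y@(b′ , c′) x≈y g@(_ , u≈ , v≈) =
    mkGood {n} y (Unit-cong {a = c * discr x} {c′ * discr y} (≈-* (proj₂ x≈y) (discr-cong {x} {y} x≈y)) (Good⇒Unit {n} x g))
      (≈-trans (≈-sym (proj₁ xpow≈)) (≈-trans u≈ (≈-neg (proj₁ x≈y))) , ≈-trans (≈-sym (proj₂ xpow≈)) v≈)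
    where
    xpow≈ : xpow b c n ≈² xpow b′ c′ n [mod N ]
    xpow≈ = xpow-cong n x≈y

Good-coarsen : ∀ {M N n} x → M ℕ∣.∣ N → Good n N x → Good n M x
Good-coarsen {n = n} x M∣N g@(_ , u≈ , v≈) =
  mkGood {n = n} x (Unit-coarsen {a = proj₂ x * discr x} M∣N (Good⇒Unit {n = n} x g)) (≈-coarsen M∣N u≈ , ≈-coarsen M∣N v≈)

-- Trace and norm of Xᵐ = u + vX, computed from Tr X = -b and N X = c.
xtrace xnorm : ℤ → ℤ → ℕ → ℤ
xtrace b c m = + 2 * proj₁ (xpow b c m) - b * proj₂ (xpow b c m)
xnorm b c m = let (u , v) = xpow b c m in u * u - b * (u * v) + c * (v * v)

xnorm≡^ : ∀ b c m → xnorm b c m ≡ c ℤ.^ m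
xnorm≡^ b c zero    = eq b c
  where
  eq : ∀ b c → 1ℤ * 1ℤ - b * (1ℤ * 0ℤ) + c * (0ℤ * 0ℤ) ≡ 1ℤ
  eq = solve-∀
xnorm≡^ b c (suc m) = trans (eq b c (proj₁ (xpow b c m)) (proj₂ (xpow b c m))) (cong (c *_) (xnorm≡^ b c m))
  where
  eq : ∀ b c u v → - (c * v) * - (c * v) - b * (- (c * v) * (u - b * v)) + c * ((u - b * v) * (u - b * v)) ≡
       c * (u * u - b * (u * v) + c * (v * v))
  eq = solve-∀

-- With v m the X-coordinate of X ^ m, the trace of X ^ m has differential - m (v m db + v (m - 1) dc).
-- Its factor m makes traces contract p-adically when p ∣ m.
module Perturbation {K : ℕ} (b c β γ : ℤ) (β² : β * β ≈ 0ℤ [mod K ]) (βγ : β * γ ≈ 0ℤ [mod K ]) (γ² : γ * γ ≈ 0ℤ [mod K ]) where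
  private
    v : ℕ → ℤ
    v m = proj₂ (xpow b c m)
    τ τ′ D : ℕ → ℤ
    τ m = xtrace b c m
    τ′ m = xtrace (b + β) (c + γ) m
    D m = + suc m * (β * v (suc m) + γ * v m)

  trace-rec : ∀ b c m → xtrace b c (suc (suc m)) ≡ - b * xtrace b c (suc m) - c * xtrace b c m
  trace-rec b c m = eq b c (proj₁ (xpow b c m)) (proj₂ (xpow b c m))
    where
    eq : ∀ b c u v → + 2 * - (c * (u - b * v)) - b * (- (c * v) - b * (u - b * v)) ≡
         - b * (+ 2 * - (c * v) - b * (u - b * v)) - c * (+ 2 * u - b * v)
    eq = solve-∀

  -- Two consecutive exponents are carried along because traces satisfy a second-order recurrence.
  -- They start at 1, since the differential of the trace of Xᵐ involves the coordinate of Xᵐ⁻¹.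
  trace-perturbation : ∀ m → τ′ (suc m) ≈ τ (suc m) - D m [mod K ] × τ′ (suc (suc m)) ≈ τ (suc (suc m)) - D (suc m) [mod K ]
  trace-perturbation zero = ≈-reflexive (eq₁ b c β γ) , ≈-lin 1ℤ (eq₂ b c β γ) β²
    where
    eq₁ : ∀ b c β γ → + 2 * - ((c + γ) * 0ℤ) - (b + β) * (1ℤ - (b + β) * 0ℤ) ≡
          + 2 * - (c * 0ℤ) - b * (1ℤ - b * 0ℤ) - 1ℤ * (β * (1ℤ - b * 0ℤ) + γ * 0ℤ)
    eq₁ = solve-∀
    eq₂ : ∀ b c β γ → + 2 * - ((c + γ) * (1ℤ - (b + β) * 0ℤ)) - (b + β) * (- ((c + γ) * 0ℤ) - (b + β) * (1ℤ - (b + β) * 0ℤ)) -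
          (+ 2 * - (c * (1ℤ - b * 0ℤ)) - b * (- (c * 0ℤ) - b * (1ℤ - b * 0ℤ)) -
           + 2 * (β * (- (c * 0ℤ) - b * (1ℤ - b * 0ℤ)) + γ * (1ℤ - b * 0ℤ))) ≡ 1ℤ * (β * β - 0ℤ)
    eq₂ = solve-∀
  trace-perturbation (suc m) = let (ih₁ , ih₂) = trace-perturbation m in
    ih₂ , step (τ′ (suc m)) (τ′ (suc (suc m))) (τ′ (suc (suc (suc m)))) (proj₁ (xpow b c m)) (v m) (+ suc m)
            (trace-rec (b + β) (c + γ) (suc m)) ih₁ ih₂
    where
    -- v₁, v₂ and v₃ are the X-coordinates of the next three powers of X, and n is the factor of the
    -- differential of the first trace.
    step : ∀ t₁ t₂ t₃ u v n → t₃ ≡ - (b + β) * t₂ - (c + γ) * t₁ →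
           let v₁ = u - b * v; v₂ = - (c * v) - b * v₁; v₃ = - (c * v₁) - b * v₂ in
           t₁ ≈ + 2 * - (c * v) - b * v₁ - n * (β * v₁ + γ * v) [mod K ] →
           t₂ ≈ + 2 * - (c * v₁) - b * v₂ - (1ℤ + n) * (β * v₂ + γ * v₁) [mod K ] →
           t₃ ≈ + 2 * - (c * v₂) - b * v₃ - (1ℤ + (1ℤ + n)) * (β * v₃ + γ * v₂) [mod K ]
    step t₁ t₂ t₃ u v n refl ih₁ ih₂ = ≈-trans (≈-- (≈-* (≈-refl {a = - (b + β)}) ih₂) (≈-* (≈-refl {a = c + γ}) ih₁))
      (≈-lin₃ ((1ℤ + n) * v₂) ((1ℤ + n) * v₁ + n * v₁) (n * v) (eq b c β γ u v n) β² βγ γ²)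
      where
      v₁ = u - b * v
      v₂ = - (c * v) - b * v₁
      eq : ∀ b c β γ u v n →
        - (b + β) * (+ 2 * - (c * (u - b * v)) - b * (- (c * v) - b * (u - b * v)) - (1ℤ + n) * (β * (- (c * v) - b * (u - b * v)) + γ * (u - b * v))) -
        (c + γ) * (+ 2 * - (c * v) - b * (u - b * v) - n * (β * (u - b * v) + γ * v)) -
        (+ 2 * - (c * (- (c * v) - b * (u - b * v))) - b * (- (c * (u - b * v)) - b * (- (c * v) - b * (u - b * v))) -
         (1ℤ + (1ℤ + n)) * (β * (- (c * (u - b * v)) - b * (- (c * v) - b * (u - b * v))) + γ * (- (c * v) - b * (u - b * v)))) ≡
        (1ℤ + n) * (- (c * v) - b * (u - b * v)) * (β * β - 0ℤ) + ((1ℤ + n) * (u - b * v) + n * (u - b * v)) * (β * γ - 0ℤ) + n * v * (γ * γ - 0ℤ)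
      eq = solve-∀

  power-perturbation : ∀ m → (c + γ) ℤ.^ suc m ≈ c ℤ.^ suc m + + suc m * (γ * c ℤ.^ m) [mod K ]
  power-perturbation zero    = ≈-reflexive (eq c γ)
    where
    eq : ∀ c γ → (c + γ) * 1ℤ ≡ c * 1ℤ + 1ℤ * (γ * 1ℤ)
    eq = solve-∀
  power-perturbation (suc m) = step ((c + γ) ℤ.^ suc m) (c ℤ.^ m) (+ suc m) (power-perturbation m)
    where
    step : ∀ q d n → q ≈ c * d + n * (γ * d) [mod K ] → (c + γ) * q ≈ c * (c * d) + (1ℤ + n) * (γ * (c * d)) [mod K ]
    step q d n = λ e → ≈-lin₂ (c + γ) (n * d) (eq c γ q d n) e γ²
      where
      eq : ∀ c γ q d n → (c + γ) * q - (c * (c * d) + (1ℤ + n) * (γ * (c * d))) ≡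
           (c + γ) * (q - (c * d + n * (γ * d))) + n * d * (γ * γ - 0ℤ)
      eq = solve-∀

module _ {K : ℕ} (b c u v : ℤ) where
  private
    η = u * u - b * (u * (v - 1ℤ)) + c * ((v - 1ℤ) * (v - 1ℤ))

  -- With Y = u + vX, η is the norm of Y - X, and (Y - X)(Y - X̄) = Y² + bY + c vanishes when Y has trace - b and norm c.
  η≈-Δ : u ≈ - b [mod K ] → v ≈ - 1ℤ [mod K ] → η ≈ - discr (b , c) [mod K ]
  η≈-Δ = ≈-lin₂ (u + b) (- (b * u) + c * (v - + 3)) (eq b c u v)
    where
    eq : ∀ b c u v → u * u - b * (u * (v - 1ℤ)) + c * ((v - 1ℤ) * (v - 1ℤ)) - - (b * b - + 4 * c) ≡
         (u + b) * (u - - b) + (- (b * u) + c * (v - + 3)) * (v - - 1ℤ)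
    eq = solve-∀

  -- If Y has trace T and norm N, then Y² + bY + c = (T + b)Y - (N - c). Multiplying (Y - X)(Y - X̄)
  -- by the conjugate of Y - X gives η(Y - X̄), whose coordinates are treated in `eq₃` and `eq₄`.
  conjugate-lift : Unit K η → + 2 * u - b * v ≈ - b [mod K ] → u * u - b * (u * v) + c * (v * v) ≈ c [mod K ] →
                   u ≈ - b [mod K ] × v ≈ - 1ℤ [mod K ]
  conjugate-lift unit trace≈ norm≈ =
    ≈-lin 1ℤ (eq₁ u b) (Unit-cancel {a = η} (u + b) unit
      (≈-lin₂ ((u - b * (v - 1ℤ)) * u + c * ((v - 1ℤ) * v)) (- (u - b * (v - 1ℤ))) (eq₃ b c u v) trace≈ norm≈)) ,
    ≈-lin 1ℤ (eq₂ v) (Unit-cancel {a = η} (v + 1ℤ) unit (≈-lin₂ u (v - 1ℤ) (eq₄ b c u v) trace≈ norm≈))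
    where
    eq₁ : ∀ u b → u - - b ≡ 1ℤ * (u + b - 0ℤ)
    eq₁ = solve-∀
    eq₂ : ∀ v → v - - 1ℤ ≡ 1ℤ * (v + 1ℤ - 0ℤ)
    eq₂ = solve-∀
    eq₃ : ∀ b c u v → (u * u - b * (u * (v - 1ℤ)) + c * ((v - 1ℤ) * (v - 1ℤ))) * (u + b) - 0ℤ ≡
          ((u - b * (v - 1ℤ)) * u + c * ((v - 1ℤ) * v)) * (+ 2 * u - b * v - - b) +
          - (u - b * (v - 1ℤ)) * (u * u - b * (u * v) + c * (v * v) - c)
    eq₃ = solve-∀
    eq₄ : ∀ b c u v → (u * u - b * (u * (v - 1ℤ)) + c * ((v - 1ℤ) * (v - 1ℤ))) * (v + 1ℤ) - 0ℤ ≡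
          u * (+ 2 * u - b * v - - b) + (v - 1ℤ) * (u * u - b * (u * v) + c * (v * v) - c)
    eq₄ = solve-∀

module _ {K : ℕ} (b c u v : ℤ) where
  conjugate-trace : u ≈ - b [mod K ] → v ≈ - 1ℤ [mod K ] → + 2 * u - b * v ≈ - b [mod K ]
  conjugate-trace = ≈-lin₂ (+ 2) (- b) (eq b u v)
    where
    eq : ∀ b u v → + 2 * u - b * v - - b ≡ + 2 * (u - - b) + - b * (v - - 1ℤ)
    eq = solve-∀

  conjugate-norm : u ≈ - b [mod K ] → v ≈ - 1ℤ [mod K ] → u * u - b * (u * v) + c * (v * v) ≈ c [mod K ]
  conjugate-norm = ≈-lin₂ (u - b * v - b) (b * b + c * (v - 1ℤ)) (eq b c u v)
    where
    eq : ∀ b c u v → u * u - b * (u * v) + c * (v * v) - c ≡ (u - b * v - b) * (u - - b) + (b * b + c * (v - 1ℤ)) * (v - - 1ℤ)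
    eq = solve-∀

Good⇒trace : ∀ {n K} x → Good n K x → xtrace (proj₁ x) (proj₂ x) n ≈ - proj₁ x [mod K ]
Good⇒trace {n} (b , c) (_ , u≈ , v≈) = conjugate-trace b c (proj₁ (xpow b c n)) (proj₂ (xpow b c n)) u≈ v≈

Good⇒norm : ∀ {n K} x → Good n K x → proj₂ x ℤ.^ n ≈ proj₂ x [mod K ]
Good⇒norm {n} (b , c) (_ , u≈ , v≈) = ≈-trans (≈-reflexive (sym (xnorm≡^ b c n)))
  (conjugate-norm b c (proj₁ (xpow b c n)) (proj₂ (xpow b c n)) u≈ v≈)

-- Trace and norm alone would also allow Xⁿ = X. Goodness modulo p makes the norm η of Xⁿ - X
-- congruent to -Δ modulo p, hence a unit modulo p and all its powers.
fixed⇒Good : ∀ {n p} k x → Good n p x → xtrace (proj₁ x) (proj₂ x) n ≈ - proj₁ x [mod p ℕ.^ k ] →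
             proj₂ x ℤ.^ n ≈ proj₂ x [mod p ℕ.^ k ] → Good n (p ℕ.^ k) x
fixed⇒Good {n} {p} k x@(b , c) good-p@(_ , u≈ , v≈) trace≈ norm≈ =
  mkGood {n = n} x (Unit-^ {a = c * discr x} k cΔ-unit)
    (conjugate-lift b c u v (Unit-^ {a = η} k (Unit-cong {a = - discr x} {η} (≈-sym (η≈-Δ b c u v u≈ v≈)) -Δ-unit))
      trace≈ (≈-trans (≈-reflexive (xnorm≡^ b c n)) norm≈))
  where
  u = proj₁ (xpow b c n)
  v = proj₂ (xpow b c n)
  η = u * u - b * (u * (v - 1ℤ)) + c * ((v - 1ℤ) * (v - 1ℤ))
  cΔ-unit : Unit p (c * discr x)
  cΔ-unit = Good⇒Unit {n = n} x good-p
  -Δ-unit : Unit p (- discr x)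
  -Δ-unit = Unit-neg {a = - discr x} (Unit-cong {a = discr x} {b = - - discr x} (≈-reflexive (sym (ℤₚ.neg-involutive (discr x))))
              (Unit-*ʳ c (discr x) cΔ-unit))

module Lifting {p n : ℕ} (pr : Prime p) .{{_ : ℕ.NonZero n}} (p∣n : p ℕ∣.∣ n) (k : ℕ) where
  private
    M = p ℕ.^ suc k
    instance
      p≢0 = prime⇒nonZero pr
      M≢0 : ℕ.NonZero M
      M≢0 = ℕₚ.m^n≢0 p (suc k)
      pM≢0 : ℕ.NonZero (p ℕ.* M)
      pM≢0 = ℕₚ.m^n≢0 p (suc (suc k))
    p∣M : p ℕ∣.∣ M
    p∣M = ℕ∣.m∣m*n (p ℕ.^ k)
    M∣pM : M ℕ∣.∣ p ℕ.* M
    M∣pM = ℕ∣.n∣m*n p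

  -- Second-order terms are multiples of M², and p divides M.
  *-≈0 : ∀ {a b} → + M ∣ᶻ a → + M ∣ᶻ b → a * b ≈ 0ℤ [mod p ℕ.* M ]
  *-≈0 {a} {b} M∣a M∣b = ∣⇒≈0 (∣-*-mono {p} {M} (ℤ∣.∣-trans (∣ᵤ⇒∣ {+ p} {+ M} p∣M) M∣a) M∣b)

  module _ (b c β γ : ℤ) (M∣β : + M ∣ᶻ β) (M∣γ : + M ∣ᶻ γ) where
    open Perturbation {p ℕ.* M} b c β γ (*-≈0 M∣β M∣β) (*-≈0 M∣β M∣γ) (*-≈0 M∣γ M∣γ)

    n*≈0 : ∀ m → p ℕ∣.∣ m → ∀ {a} → + M ∣ᶻ a → + m * a ≈ 0ℤ [mod p ℕ.* M ]
    n*≈0 m p∣m M∣a = ∣⇒≈0 (∣-*-mono {p} {M} (∣ᵤ⇒∣ {+ p} {+ m} p∣m) M∣a)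

    drop-- : ∀ {x y d} → x ≈ y - d [mod p ℕ.* M ] → d ≈ 0ℤ [mod p ℕ.* M ] → x ≈ y [mod p ℕ.* M ]
    drop-- {x} {y} {d} = ≈-lin₂ 1ℤ (- 1ℤ) (eq x y d)
      where
      eq : ∀ x y d → x - y ≡ 1ℤ * (x - (y - d)) + - 1ℤ * (d - 0ℤ)
      eq = solve-∀

    drop-+ : ∀ {x y d} → x ≈ y + d [mod p ℕ.* M ] → d ≈ 0ℤ [mod p ℕ.* M ] → x ≈ y [mod p ℕ.* M ]
    drop-+ {x} {y} {d} = ≈-lin₂ 1ℤ 1ℤ (eq x y d)
      where
      eq : ∀ x y d → x - y ≡ 1ℤ * (x - (y + d)) + 1ℤ * (d - 0ℤ)
      eq = solve-∀

    trace-contraction′ : ∀ m .{{_ : ℕ.NonZero m}} → p ℕ∣.∣ m → xtrace (b + β) (c + γ) m ≈ xtrace b c m [mod p ℕ.* M ]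
    trace-contraction′ (suc m) p∣m = drop-- (proj₁ (trace-perturbation m)) (n*≈0 (suc m) p∣m
      (ℤ∣.∣m∣n⇒∣m+n (ℤ∣.∣m⇒∣m*n (proj₂ (xpow b c (suc m))) M∣β) (ℤ∣.∣m⇒∣m*n (proj₂ (xpow b c m)) M∣γ)))

    power-contraction′ : ∀ m .{{_ : ℕ.NonZero m}} → p ℕ∣.∣ m → (c + γ) ℤ.^ m ≈ c ℤ.^ m [mod p ℕ.* M ]
    power-contraction′ (suc m) p∣m = drop-+ (power-perturbation m) (n*≈0 (suc m) p∣m (ℤ∣.∣m⇒∣m*n (c ℤ.^ m) M∣γ))

  +-- : ∀ a b → b + (a - b) ≡ a
  +-- = solve-∀

  trace-contraction : ∀ x y → x ≈² y [mod M ] → xtrace (proj₁ x) (proj₂ x) n ≈ xtrace (proj₁ y) (proj₂ y) n [mod p ℕ.* M ]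
  trace-contraction (b′ , c′) (b , c) (b≈ , c≈) = ≈-trans
    (≈-reflexive (cong₂ (λ b c → xtrace b c n) (sym (+-- b′ b)) (sym (+-- c′ c))))
    (trace-contraction′ b c (b′ - b) (c′ - c) (N∣a-b b≈) (N∣a-b c≈) n p∣n)

  power-contraction : ∀ x y → x ≈² y [mod M ] → proj₂ x ℤ.^ n ≈ proj₂ y ℤ.^ n [mod p ℕ.* M ]
  power-contraction (b′ , c′) (b , c) (b≈ , c≈) = ≈-trans
    (≈-reflexive (cong (ℤ._^ n) (sym (+-- c′ c))))
    (power-contraction′ b c (b′ - b) (c′ - c) (N∣a-b b≈) (N∣a-b c≈) n p∣n)

  -- By the two contractions its value modulo pM depends only on the argument modulo M, so it
  -- carries residues modulo M to residues modulo pM.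
  lift : ℤ² → ℤ²
  lift (b , c) = - xtrace b c n , c ℤ.^ n

  ≈-neg-swap : ∀ {K} a b → a ≈ - b [mod K ] → b ≈ - a [mod K ]
  ≈-neg-swap a b = ≈-lin 1ℤ (eq a b)
    where
    eq : ∀ a b → b - - a ≡ 1ℤ * (a - - b)
    eq = solve-∀

  -- Taking trace and norm of Xⁿ = X̄ shows that a good x is its own lift, and `lift x` agrees with
  -- `lift y` modulo pM.
  lift-unique : ∀ x y → Good n (p ℕ.* M) x → y ≈² x [mod M ] → x ≈² lift y [mod p ℕ.* M ]
  lift-unique x y gx y≈x =
    ≈-neg-swap (xtrace (proj₁ y) (proj₂ y) n) (proj₁ x) (≈-trans (trace-contraction y x y≈x) (Good⇒trace {n} x gx)) ,
    ≈-trans (≈-sym (Good⇒norm {n} x gx)) (≈-sym (power-contraction y x y≈x))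

  lift-≈ : ∀ x y → Good n M y → x ≈² lift y [mod p ℕ.* M ] → x ≈² y [mod M ]
  lift-≈ x y gy (p₁ , p₂) =
    ≈-trans (≈-coarsen M∣pM p₁) (≈-sym (≈-neg-swap (xtrace (proj₁ y) (proj₂ y) n) (proj₁ y) (Good⇒trace {n} y gy))) ,
    ≈-trans (≈-coarsen M∣pM p₂) (Good⇒norm {n} y gy)

  -- x agrees with y modulo M, hence `lift x`, `lift y` and x agree modulo pM: x is a fixed point,
  -- and it inherits goodness modulo p from y.
  lift-Good : ∀ x y → Good n M y → x ≈² lift y [mod p ℕ.* M ] → Good n (p ℕ.* M) x
  lift-Good x@(b , c) y gy x≈ = fixed⇒Good {n} {p} (suc (suc k)) x
    (Good-cong {n = n} y x (≈²-coarsen {x = y} {x} p∣M y≈x) (Good-coarsen {n = n} y p∣M gy))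
    (≈-trans (trace-contraction x y x≈y) (≈-neg-swap b (xtrace (proj₁ y) (proj₂ y) n) (proj₁ x≈)))
    (≈-trans (power-contraction x y x≈y) (≈-sym (proj₂ x≈)))
    where
    x≈y : x ≈² y [mod M ]
    x≈y = lift-≈ x y gy x≈
    y≈x : y ≈² x [mod M ]
    y≈x = ≈-sym (proj₁ x≈y) , ≈-sym (proj₂ x≈y)

  legendre-≈ : ∀ x y → y ≈² x [mod M ] → legendre (discr x) p ≡ legendre (discr y) p
  legendre-≈ x y y≈x = sym (legendre-cong {p} {discr y} {discr x} (discr-cong {p} {y} {x} (≈²-coarsen {x = y} {x} p∣M y≈x)))

  module _ (ε : ℤ) where
    private
      ≈²-sym : ∀ x y {K} → x ≈² y [mod K ] → y ≈² x [mod K ]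
      ≈²-sym x y (e₁ , e₂) = ≈-sym e₁ , ≈-sym e₂

      reduce : ∀ x y → LocalGood n p (p ℕ.* M) ε x → y ≈² x [mod M ] → LocalGood n p M ε y
      reduce x y (gx , l) y≈x = Good-cong {n = n} x y (≈²-sym y x y≈x) (Good-coarsen {n = n} x M∣pM gx) ,
                                trans (sym (legendre-≈ x y y≈x)) l

      to : ∀ x y → LocalGood n p M ε y → x ≈² lift y [mod p ℕ.* M ] → LocalGood n p (p ℕ.* M) ε x × y ≈² x [mod M ]
      to x y (gy , l) x≈ = (lift-Good x y gy x≈ , trans (legendre-≈ x y y≈x) l) , y≈x
        where
        y≈x : y ≈² x [mod M ]
        y≈x = ≈²-sym x y (lift-≈ x y gy x≈)

      from : ∀ x y → LocalGood n p (p ℕ.* M) ε x × y ≈² x [mod M ] → x ≈² lift y [mod p ℕ.* M ]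
      from x y ((gx , _) , y≈x) = lift-unique x y gx y≈x

    localCount-lift : localCount n p (p ℕ.* M) ε ≡ localCount n p M ε
    localCount-lift = count-1-to-1 (residues (p ℕ.* M) ×ᶠ residues (p ℕ.* M)) (residues M ×ᶠ residues M)
      {V = LocalGood n p (p ℕ.* M) ε} {W = LocalGood n p M ε}
      (LocalGood? n p (p ℕ.* M) ε) (LocalGood? n p M ε) (λ x → x) (λ {x} {y} → reduce x y)
      (λ {y} gy → lift y , λ x → to x y gy , from x y)

-- Chinese remainder theorem

≈²-sym : ∀ {N} x y → x ≈² y [mod N ] → y ≈² x [mod N ]
≈²-sym x y (p , q) = ≈-sym p , ≈-sym q

module CRT {M K : ℕ} .{{_ : ℕ.NonZero M}} .{{_ : ℕ.NonZero K}} (M-unit : Unit K (+ M)) where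
  instance MK≢0 = ℕₚ.m*n≢0 M K
  private
    u = proj₁ M-unit
    q = ℤ∣.quotient (N∣a-b (proj₂ M-unit))
    uM-1≡qK : u * + M - 1ℤ ≡ q * + K
    uM-1≡qK = ℤ∣._∣_.equality (N∣a-b (proj₂ M-unit))

  -- Since uM = 1 + qK, the numbers -qK and uM are the two idempotents: -qK is 1 modulo M and 0
  -- modulo K, and uM the reverse.
  crt : ℤ → ℤ → ℤ
  crt y z = y * - (q * + K) + z * (u * + M)

  crt-≈ˡ : ∀ y z → crt y z ≈ y [mod M ]
  crt-≈ˡ y z = modulo (divides ((z - y) * u) (trans (cong (λ e → y * - e + z * (u * + M) - y) (sym uM-1≡qK)) (eq y z u (+ M))))
    where
    eq : ∀ y z u m → y * - (u * m - 1ℤ) + z * (u * m) - y ≡ (z - y) * u * m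
    eq = solve-∀

  crt-≈ʳ : ∀ y z → crt y z ≈ z [mod K ]
  crt-≈ʳ y z = modulo (divides ((z - y) * q) (trans (eq₁ y z q (+ K) (u * + M)) (trans (cong (λ e → y * - (q * + K) + z * e) uM-1≡qK) (eq₂ y z q (+ K)))))
    where
    eq₁ : ∀ y z q k e → y * - (q * k) + z * e - z ≡ y * - (q * k) + z * (e - 1ℤ)
    eq₁ = solve-∀
    eq₂ : ∀ y z q k → y * - (q * k) + z * (q * k) ≡ (z - y) * q * k
    eq₂ = solve-∀

  -- With d = a - b one has d = d · uM - d · qK; K ∣ d settles the first term and M ∣ d the second.
  ≈-MK : ∀ {a b} → a ≈ b [mod M ] → a ≈ b [mod K ] → a ≈ b [mod M ℕ.* K ]
  ≈-MK {a} {b} a≈b a≈b′ = modulo (subst (+ (M ℕ.* K) ∣ᶻ_) (trans (cong (λ e → d * (u * + M) - d * e) (sym uM-1≡qK)) (eq d (u * + M)))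
    (ℤ∣.∣m∣n⇒∣m-n (subst (+ (M ℕ.* K) ∣ᶻ_) (ℤₚ.*-comm (u * + M) d) (∣-*-mono {M} {K} (ℤ∣.∣n⇒∣m*n u ℤ∣.∣-refl) (N∣a-b a≈b′)))
                  (∣-*-mono {M} {K} (N∣a-b a≈b) (ℤ∣.∣n⇒∣m*n q ℤ∣.∣-refl))))
    where
    d = a - b
    eq : ∀ d e → d * e - d * (e - 1ℤ) ≡ d
    eq = solve-∀

  Good-MK : ∀ {n} x → Good n M x → Good n K x → Good n (M ℕ.* K) x
  Good-MK {n} x gM gK = mkGood {n = n} x (Unit-* {M} {K} {proj₂ x * discr x} (Good⇒Unit {n = n} x gM) (Good⇒Unit {n = n} x gK))
    (≈-MK (proj₁ (proj₂ gM)) (proj₁ (proj₂ gK)) , ≈-MK (proj₂ (proj₂ gM)) (proj₂ (proj₂ gK)))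

  ⟦Good⟧-MK : ∀ n x → ⟦ Good? n (M ℕ.* K) x ⟧ ≡ ⟦ Good? n M x ⟧ * ⟦ Good? n K x ⟧
  ⟦Good⟧-MK n x = trans (⟦⟧-cong (Good? n (M ℕ.* K) x) (Good? n M x ×-dec Good? n K x)
      (λ g → Good-coarsen {n = n} x (ℕ∣.m∣m*n K) g , Good-coarsen {n = n} x (ℕ∣.n∣m*n M) g) (λ (gM , gK) → Good-MK {n} x gM gK))
    (⟦⟧-× (Good? n M x) (Good? n K x))

  private
    F = residues M ×ᶠ residues M
    G = residues K ×ᶠ residues K
    H = residues (M ℕ.* K) ×ᶠ residues (M ℕ.* K)

    crt² : ℤ² → ℤ² → ℤ²
    crt² (a , b) (c , d) = crt a c , crt b d

    to : ∀ x y z → y ≈² x [mod M ] × z ≈² x [mod K ] → x ≈² crt² y z [mod M ℕ.* K ]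
    to x (a , b) (c , d) ((a≈ , b≈) , (c≈ , d≈)) =
      ≈-MK (≈-trans (≈-sym a≈) (≈-sym (crt-≈ˡ a c))) (≈-trans (≈-sym c≈) (≈-sym (crt-≈ʳ a c))) ,
      ≈-MK (≈-trans (≈-sym b≈) (≈-sym (crt-≈ˡ b d))) (≈-trans (≈-sym d≈) (≈-sym (crt-≈ʳ b d)))

    from : ∀ x y z → x ≈² crt² y z [mod M ℕ.* K ] → y ≈² x [mod M ] × z ≈² x [mod K ]
    from x (a , b) (c , d) (e₁ , e₂) =
      (≈-sym (≈-trans (≈-coarsen (ℕ∣.m∣m*n K) e₁) (crt-≈ˡ a c)) , ≈-sym (≈-trans (≈-coarsen (ℕ∣.m∣m*n K) e₂) (crt-≈ˡ b d))) ,
      (≈-sym (≈-trans (≈-coarsen (ℕ∣.n∣m*n M) e₁) (crt-≈ʳ a c)) , ≈-sym (≈-trans (≈-coarsen (ℕ∣.n∣m*n M) e₂) (crt-≈ʳ b d)))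

  -- The sum is regrouped along the diagonal x ↦ (x , x), which represents the isomorphism onto
  -- pairs of classes modulo M and K; each fibre is one class given by `crt`.
  ∑-MK : (f g : ℤ² → ℤ) → (∀ x y → x ≈² y [mod M ] → f x ≡ f y) → (∀ x y → x ≈² y [mod K ] → g x ≡ g y) →
         ∑ (λ x → f x * g x) (FiniteSetoid.elems H) ≡ ∑ f (FiniteSetoid.elems F) * ∑ g (FiniteSetoid.elems G)
  ∑-MK f g f-cong g-cong = trans
    (∑-fibres (F ×ᶠ G) (λ x → x , x) (λ x → f x * g x) (λ yz → f (proj₁ yz) * g (proj₂ yz)) (FiniteSetoid.elems H) fibre)
    (trans (∑-cartesianProduct (λ yz → f (proj₁ yz) * g (proj₂ yz)) (FiniteSetoid.elems F) (FiniteSetoid.elems G))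
           (∑-∑-* f g (FiniteSetoid.elems F) (FiniteSetoid.elems G)))
    where
    fibre : ∀ yz → ∑ (λ x → f x * g x * ⟦ FiniteSetoid._≈?_ (F ×ᶠ G) yz (x , x) ⟧) (FiniteSetoid.elems H) ≡ f (proj₁ yz) * g (proj₂ yz)
    fibre yz@(y , z) = trans (∑-cong pointwise (FiniteSetoid.elems H))
      (trans (∑-*ˡ (f y * g z) (λ x → ⟦ FiniteSetoid._≈?_ H x (crt² y z) ⟧) (FiniteSetoid.elems H))
      (trans (cong (f y * g z *_) (FiniteSetoid.enum H (crt² y z))) (ℤₚ.*-identityʳ (f y * g z))))
      where
      pointwise : ∀ x → f x * g x * ⟦ FiniteSetoid._≈?_ (F ×ᶠ G) yz (x , x) ⟧ ≡ f y * g z * ⟦ FiniteSetoid._≈?_ H x (crt² y z) ⟧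
      pointwise x with FiniteSetoid._≈?_ (F ×ᶠ G) yz (x , x) | FiniteSetoid._≈?_ H x (crt² y z)
      ... | yes (y≈x , z≈x) | yes _ = cong (_* 1ℤ) (sym (cong₂ _*_ (f-cong y x y≈x) (g-cong z x z≈x)))
      ... | yes e  | no ¬e = contradiction (to x y z e) ¬e
      ... | no ¬e  | yes e = contradiction (from x y z e) ¬e
      ... | no _   | no _  = trans (ℤₚ.*-zeroʳ (f x * g x)) (sym (ℤₚ.*-zeroʳ (f y * g z)))

-- Local sums weighed by the Legendre symbol

Good-Δ≉0 : ∀ {n N p} (pr : Prime p) x → p ℕ∣.∣ N → Good n N x → ¬ discr x ≈ 0ℤ [mod p ]
Good-Δ≉0 {n} {N} {p} pr x p∣N g = coprime⇒≉0 pr {discr x} (Unit⇒coprime (discr x)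
  (Unit-*ʳ (proj₂ x) (discr x) (Unit-coarsen {a = proj₂ x * discr x} p∣N (Good⇒Unit {n = n} x g))))

module LocalSums {n p N : ℕ} (pr : Prime p) (p∣N : p ℕ∣.∣ N) .{{_ : ℕ.NonZero N}} where
  private
    elems = FiniteSetoid.elems (residues N ×ᶠ residues N)
    instance p≢0 = prime⇒nonZero pr

    weigh : (w : ℤ → ℤ) → ∀ x → ⟦ Good? n N x ⟧ * w (legendre (discr x) p) ≡
            w 1ℤ * ⟦ LocalGood? n p N 1ℤ x ⟧ + w ℤ.-1ℤ * ⟦ LocalGood? n p N ℤ.-1ℤ x ⟧
    weigh w x = trans (go (Good? n N x)) (sym (cong₂ (λ a b → w 1ℤ * a + w ℤ.-1ℤ * b)
        (⟦⟧-× (Good? n N x) (l ℤ.≟ 1ℤ)) (⟦⟧-× (Good? n N x) (l ℤ.≟ ℤ.-1ℤ))))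
      where
      l = legendre (discr x) p
      eq₁ : ∀ a b → 1ℤ * a ≡ a * (1ℤ * 1ℤ) + b * (1ℤ * 0ℤ)
      eq₁ = solve-∀
      eq₂ : ∀ a b → 1ℤ * b ≡ a * (1ℤ * 0ℤ) + b * (1ℤ * 1ℤ)
      eq₂ = solve-∀
      eq₃ : ∀ a b c d e → 0ℤ * e ≡ a * (0ℤ * c) + b * (0ℤ * d)
      eq₃ = solve-∀
      sign : ∀ {l} → l ≡ 1ℤ ⊎ l ≡ ℤ.-1ℤ → 1ℤ * w l ≡ w 1ℤ * (1ℤ * ⟦ l ℤ.≟ 1ℤ ⟧) + w ℤ.-1ℤ * (1ℤ * ⟦ l ℤ.≟ ℤ.-1ℤ ⟧)
      sign (inj₁ refl) = eq₁ (w 1ℤ) (w ℤ.-1ℤ)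
      sign (inj₂ refl) = eq₂ (w 1ℤ) (w ℤ.-1ℤ)
      go : (d : Dec (Good n N x)) → ⟦ d ⟧ * w l ≡ w 1ℤ * (⟦ d ⟧ * ⟦ l ℤ.≟ 1ℤ ⟧) + w ℤ.-1ℤ * (⟦ d ⟧ * ⟦ l ℤ.≟ ℤ.-1ℤ ⟧)
      go (yes g) = sign (legendre≡±1 {p} {discr x} (Good-Δ≉0 {n} pr x p∣N g))
      go (no _)  = eq₃ (w 1ℤ) (w ℤ.-1ℤ) ⟦ l ℤ.≟ 1ℤ ⟧ ⟦ l ℤ.≟ ℤ.-1ℤ ⟧ (w l)

  -- Goodness makes Δ nonzero modulo p, so only the values w(1) and w(-1) enter. Keeping w general
  -- serves both the plain and the signed count.
  ∑-weighed : (w : ℤ → ℤ) → ∑ (λ x → ⟦ Good? n N x ⟧ * w (legendre (discr x) p)) elems ≡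
              w 1ℤ * localCount n p N 1ℤ + w ℤ.-1ℤ * localCount n p N ℤ.-1ℤ
  ∑-weighed w = trans (∑-cong (weigh w) elems) (trans (∑-+ _ _ elems) (cong₂ _+_ (∑-*ˡ (w 1ℤ) _ elems) (∑-*ˡ (w ℤ.-1ℤ) _ elems)))

-- p = 2h + 1 with h = h′ + 1: the positivity of h is built into the form of the witness.
odd-prime : ∀ {p} → Prime p → ¬ 2 ℕ∣.∣ p → ∃ λ h′ → p ≡ suc (2 ℕ.* suc h′)
odd-prime {p} pr 2∤p with p ℕ/.% 2 in p%2 | p ℕ/./ 2 in p/2 | ℕ/.m%n<n p 2 | ℕ/.m≡m%n+[m/n]*n p 2
... | 0 | _      | _ | _  = contradiction (ℕ∣.m%n≡0⇒n∣m p 2 p%2) 2∤p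
... | 1 | zero   | _ | eq = contradiction eq (ℕ.nonTrivial⇒≢1 {{prime⇒nonTrivial pr}})
... | 1 | suc h′ | _ | eq = h′ , trans eq (cong suc (ℕₚ.*-comm (suc h′) 2))
... | suc (suc _) | _ | ℕ.s≤s (ℕ.s≤s ()) | _

module PrimePower {n p : ℕ} .{{_ : ℕ.NonZero n}} (pr : Prime p) (2∤n : ¬ 2 ℕ∣.∣ n) (p∣n : p ℕ∣.∣ n) where
  private
    instance p≢0 = prime⇒nonZero pr
    h = odd-prime pr (λ 2∣p → 2∤n (ℕ∣.∣-trans 2∣p p∣n))
    module P = Counts pr (proj₁ h) (proj₂ h) n (ℕ∣.∣⇒≤ p∣n)

    localCount-≡ : ∀ {M N} .{{_ : ℕ.NonZero M}} .{{_ : ℕ.NonZero N}} → M ≡ N → ∀ ε → localCount n p M ε ≡ localCount n p N ε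
    localCount-≡ refl ε = refl

  localCount-^ : ∀ k .{{_ : ℕ.NonZero (p ℕ.^ suc k)}} ε → localCount n p (p ℕ.^ suc k) ε ≡ localCount n p p ε
  localCount-^ zero    ε = localCount-≡ (ℕₚ.*-identityʳ p) ε
  localCount-^ (suc k) ε = trans (Lifting.localCount-lift pr p∣n k ε) (localCount-^ k {{ℕₚ.m^n≢0 p (suc k)}} ε)

  split-count : ∀ k .{{_ : ℕ.NonZero (p ℕ.^ suc k)}} →
                + 2 * localCount n p (p ℕ.^ suc k) 1ℤ ≡ + gcd (n ℕ.* n ℕ.∸ 1) (p ℕ.∸ 1) - + gcd (n ℕ.∸ 1) (p ℕ.∸ 1)
  split-count k = trans (cong (+ 2 *_) (localCount-^ k 1ℤ)) (P.Split.split-count 1ℤ ≈-refl)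

  inert-count : ∀ k .{{_ : ℕ.NonZero (p ℕ.^ suc k)}} → + 2 * localCount n p (p ℕ.^ suc k) ℤ.-1ℤ ≡
                + gcd (p ℕ.* p ℕ.∸ 1) (gcd (n ℕ.* n ℕ.∸ 1) (n ℕ.∸ p)) - + gcd (n ℕ.∸ 1) (p ℕ.∸ 1)
  inert-count k = trans (cong (+ 2 *_) (localCount-^ k ℤ.-1ℤ)) P.inert-count

-- From integers to rationals

ι : ℤ → ℚ
ι i = i ℚ./ 1

ι-+ : ∀ i j → ι (i + j) ≡ ι i ℚ.+ ι j
ι-+ i j = ℚₚ.toℚᵘ-injective (ℚᵘₚ.≃-trans (ℚₚ.toℚᵘ-fromℚᵘ (i+j)) (ℚᵘₚ.≃-trans (ℚᵘ.*≡* (eq i j))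
  (ℚᵘₚ.≃-sym (ℚᵘₚ.≃-trans (ℚₚ.toℚᵘ-homo-+ (ι i) (ι j)) (ℚᵘₚ.+-cong (ℚₚ.toℚᵘ-fromℚᵘ (ℚᵘ.mkℚᵘ i 0)) (ℚₚ.toℚᵘ-fromℚᵘ (ℚᵘ.mkℚᵘ j 0)))))))
  where
  i+j = ℚᵘ.mkℚᵘ (i + j) 0
  eq : ∀ i j → (i + j) * 1ℤ ≡ (i * 1ℤ + j * 1ℤ) * 1ℤ
  eq = solve-∀

ι-* : ∀ i j → ι (i * j) ≡ ι i ℚ.* ι j
ι-* i j = ℚₚ.toℚᵘ-injective (ℚᵘₚ.≃-trans (ℚₚ.toℚᵘ-fromℚᵘ (ℚᵘ.mkℚᵘ (i * j) 0)) (ℚᵘₚ.≃-trans (ℚᵘ.*≡* refl)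
  (ℚᵘₚ.≃-sym (ℚᵘₚ.≃-trans (ℚₚ.toℚᵘ-homo-* (ι i) (ι j)) (ℚᵘₚ.*-cong (ℚₚ.toℚᵘ-fromℚᵘ (ℚᵘ.mkℚᵘ i 0)) (ℚₚ.toℚᵘ-fromℚᵘ (ℚᵘ.mkℚᵘ j 0)))))))

ι-neg : ∀ i → ι (- i) ≡ ℚ.- ι i
ι-neg i = ℚₚ.toℚᵘ-injective (ℚᵘₚ.≃-trans (ℚₚ.toℚᵘ-fromℚᵘ (ℚᵘ.mkℚᵘ (- i) 0)) (ℚᵘₚ.≃-sym
  (ℚᵘₚ.≃-trans (ℚₚ.toℚᵘ-homo‿- (ι i)) (ℚᵘₚ.-‿cong (ℚₚ.toℚᵘ-fromℚᵘ (ℚᵘ.mkℚᵘ i 0))))))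

-- The local counts are known through their doubles; the division by 2 takes place only in ℚ.
ι-halve : ∀ x i j → + 2 * x ≡ i - j → ι x ≡ ½ ℚ.* (ι i ℚ.- ι j)
ι-halve x i j 2x≡i-j = begin
  ι x                     ≡⟨ ℚₚ.*-identityˡ (ι x) ⟨
  ℚ.1ℚ ℚ.* ι x            ≡⟨⟩
  (½ ℚ.* ι (+ 2)) ℚ.* ι x ≡⟨ ℚₚ.*-assoc ½ (ι (+ 2)) (ι x) ⟩
  ½ ℚ.* (ι (+ 2) ℚ.* ι x) ≡⟨ cong (½ ℚ.*_) (ι-* (+ 2) x) ⟨
  ½ ℚ.* ι (+ 2 * x)       ≡⟨ cong (λ e → ½ ℚ.* ι e) 2x≡i-j ⟩
  ½ ℚ.* ι (i - j)         ≡⟨ cong (½ ℚ.*_) (trans (ι-+ i (- j)) (cong (ι i ℚ.+_) (ι-neg j))) ⟩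
  ½ ℚ.* (ι i ℚ.- ι j) ∎
  where open ≡-Reasoning

-- Multiplicativity over the prime factorisation

value : Factorisation → ℕ
value = foldr (λ pr acc → (proj₁ pr ℕ.^ proj₂ pr) ℕ.* acc) 1

-- A common form for the constant 1 (`one-weight`) and the Jacobi symbol (`power-weight`), so that
-- one induction evaluates both sums.
weight : (ℕ × ℕ → ℤ → ℤ) → Factorisation → ℤ → ℤ
weight w fs a = foldr (λ pr acc → w pr (legendre a (proj₁ pr)) * acc) 1ℤ fs

Unit-value : ∀ {a} fs → All (λ pr → Unit (proj₁ pr) a) fs → Unit (value fs) a
Unit-value     []             []        = 0ℤ , modulo (divides (- 1ℤ) refl)
Unit-value {a} ((p , r) ∷ fs) (e ∷ es) = Unit-* {p ℕ.^ r} {value fs} {a} (Unit-^ {p} {a} r e) (Unit-value fs es)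

Unit-pow : ∀ {N} m r → Unit N (+ m) → Unit N (+ (m ℕ.^ r))
Unit-pow {N} m zero    _ = 1ℤ , ≈-refl
Unit-pow {N} m (suc r) e@(u , um≈1) = let (v , vmʳ≈1) = Unit-pow {N} m r e in
  u * v , ≈-trans (≈-reflexive (trans (cong (u * v *_) (ℤₚ.pos-* m (m ℕ.^ r))) (eq u v (+ m) (+ (m ℕ.^ r))))) (≈-* um≈1 vmʳ≈1)
  where
  eq : ∀ u v a b → u * v * (a * b) ≡ (u * a) * (v * b)
  eq = solve-∀

distinct-primes-Unit : ∀ {p q} → Prime p → Prime q → ¬ p ≡ q → Unit q (+ p)
distinct-primes-Unit {p} {q} pr-p pr-q p≢q = coprime⇒Unit {q} (+ p) (≉0⇒coprime pr-q {+ p} λ p≈0 →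
  Sum.[ (λ q≡1 → ℕ.nonTrivial⇒≢1 {{prime⇒nonTrivial pr-q}} q≡1) , (λ q≡p → p≢q (sym q≡p)) ] (prime⇒irreducible pr-p (∣⇒∣ᵤ {+ q} {+ p} (≈0⇒∣ p≈0))))

PrimeFactor : ℕ → ℕ × ℕ → Set
PrimeFactor n (p , r) = Prime p × 1 ℕ.≤ r × p ℕ∣.∣ n

others-Unit : ∀ {n p} → Prime p → ∀ fs → All (PrimeFactor n) fs → All (λ q → ¬ p ≡ q) (map proj₁ fs) →
              All (λ pr → Unit (proj₁ pr) (+ p)) fs
others-Unit pr []       []       []         = []
others-Unit pr (_ ∷ fs) (f ∷ ok) (p≢q ∷ ps) = distinct-primes-Unit pr (proj₁ f) p≢q ∷ others-Unit pr fs ok ps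

value≢0 : ∀ {n} fs → All (PrimeFactor n) fs → ℕ.NonZero (value fs)
value≢0 []             []       = _
value≢0 ((p , r) ∷ fs) (f ∷ ok) = ℕₚ.m*n≢0 (p ℕ.^ r) (value fs) {{ℕₚ.m^n≢0 p r {{prime⇒nonZero (proj₁ f)}}}} {{value≢0 fs ok}}

weight-cong : ∀ {n} w {N} fs → All (PrimeFactor n) fs → value fs ℕ∣.∣ N → ∀ {a b} → a ≈ b [mod N ] → weight w fs a ≡ weight w fs b
weight-cong w []                   []       _ _ = refl
weight-cong w ((p , suc r) ∷ fs) (f ∷ ok) v∣N a≈b = cong₂ _*_
  (cong (w (p , suc r)) (legendre-cong {{prime⇒nonZero (proj₁ f)}} (≈-coarsen (ℕ∣.∣-trans (ℕ∣.∣-trans (ℕ∣.m∣m*n (p ℕ.^ r)) (ℕ∣.m∣m*n (value fs))) v∣N) a≈b)))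
  (weight-cong w fs ok (ℕ∣.∣-trans (ℕ∣.n∣m*n (p ℕ.^ suc r)) v∣N) a≈b)
weight-cong w ((p , zero) ∷ fs) ((_ , () , _) ∷ ok) _ _

-- The exponent n stays fixed while the modulus `value fs` shrinks with the list, so that the sum
-- factors in an induction over `fs`.
weightedSum : ∀ n (w : ℕ × ℕ → ℤ → ℤ) fs .{{_ : ℕ.NonZero (value fs)}} → ℤ
weightedSum n w fs = ∑ (λ x → ⟦ Good? n (value fs) x ⟧ * weight w fs (discr x))
  (FiniteSetoid.elems (residues (value fs) ×ᶠ residues (value fs)))

localFactor : ℕ → (ℕ × ℕ → ℤ → ℤ) → ℕ × ℕ → ℚ
localFactor n w pr = ι (w pr 1ℤ) ℚ.* Cᵢ n (proj₁ pr) ℚ.+ ι (w pr ℤ.-1ℤ) ℚ.* Dᵢ n (proj₁ pr)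

≈-mod-1 : ∀ a b → a ≈ b [mod 1 ]
≈-mod-1 a b = modulo (divides (a - b) (sym (ℤₚ.*-identityʳ (a - b))))

ι-weightedSum : ∀ n .{{_ : ℕ.NonZero n}} w → ¬ 2 ℕ∣.∣ n → ∀ fs .{{_ : ℕ.NonZero (value fs)}} → All (PrimeFactor n) fs → Unique (map proj₁ fs) →
                ι (weightedSum n w fs) ≡ foldr (λ pr acc → localFactor n w pr ℚ.* acc) ℚ.1ℚ fs
-- Modulo 1 there is a single class and it is good, which gives the empty product 1.
ι-weightedSum n w 2∤n [] [] [] = cong (λ e → ι (e * 1ℤ + 0ℤ)) (⟦⟧-yes (Good? n 1 (0ℤ , 0ℤ))
  (mkGood {1} {n} (0ℤ , 0ℤ) (0ℤ , ≈-mod-1 (0ℤ * (0ℤ * discr (0ℤ , 0ℤ))) 1ℤ)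
    (≈-mod-1 (proj₁ (xpow 0ℤ 0ℤ n)) (- 0ℤ) , ≈-mod-1 (proj₂ (xpow 0ℤ 0ℤ n)) (- 1ℤ))))
ι-weightedSum n w 2∤n ((p , suc r) ∷ fs) (f@(pr , _ , p∣n) ∷ ok) (p∉fs ∷ unique) = begin
  ι (weightedSum n w ((p , suc r) ∷ fs))              ≡⟨ cong ι (trans (∑-cong factor elems) (∑-MK local rest local-cong rest-cong)) ⟩
  ι (∑ local elemsM * weightedSum n w fs)             ≡⟨ ι-* (∑ local elemsM) (weightedSum n w fs) ⟩
  ι (∑ local elemsM) ℚ.* ι (weightedSum n w fs)       ≡⟨ cong₂ ℚ._*_ ι-local (ι-weightedSum n w 2∤n fs ok unique) ⟩
  localFactor n w (p , suc r) ℚ.* foldr (λ pr acc → localFactor n w pr ℚ.* acc) ℚ.1ℚ fs ∎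
  where
  open ≡-Reasoning
  M = p ℕ.^ suc r
  K = value fs
  instance
    p≢0 = prime⇒nonZero pr
    M≢0 : ℕ.NonZero M
    M≢0 = ℕₚ.m^n≢0 p (suc r)
    K≢0 : ℕ.NonZero K
    K≢0 = value≢0 fs ok
  open CRT {M} {K} (Unit-pow p (suc r) (Unit-value fs (others-Unit pr fs ok p∉fs))) using (∑-MK; ⟦Good⟧-MK)
  elems = FiniteSetoid.elems (residues (M ℕ.* K) ×ᶠ residues (M ℕ.* K))
  elemsM = FiniteSetoid.elems (residues M ×ᶠ residues M)
  local rest : ℤ² → ℤ
  local x = ⟦ Good? n M x ⟧ * w (p , suc r) (legendre (discr x) p)
  rest x = ⟦ Good? n K x ⟧ * weight w fs (discr x)
  ⟦Good⟧-cong : ∀ {N} x y → x ≈² y [mod N ] → ⟦ Good? n N x ⟧ ≡ ⟦ Good? n N y ⟧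
  ⟦Good⟧-cong {N} x y x≈y = ⟦⟧-cong (Good? n N x) (Good? n N y) (Good-cong {N} {n} x y x≈y) (Good-cong {N} {n} y x (≈²-sym x y x≈y))
  factor : ∀ x → ⟦ Good? n (M ℕ.* K) x ⟧ * (w (p , suc r) (legendre (discr x) p) * weight w fs (discr x)) ≡ local x * rest x
  factor x = trans (cong (_* (w (p , suc r) (legendre (discr x) p) * weight w fs (discr x))) (⟦Good⟧-MK n x))
    (eq ⟦ Good? n M x ⟧ ⟦ Good? n K x ⟧ (w (p , suc r) (legendre (discr x) p)) (weight w fs (discr x)))
    where
    eq : ∀ a b c d → a * b * (c * d) ≡ (a * c) * (b * d)
    eq = solve-∀
  local-cong : ∀ x y → x ≈² y [mod M ] → local x ≡ local y
  local-cong x y x≈y = cong₂ _*_ (⟦Good⟧-cong x y x≈y)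
    (cong (w (p , suc r)) (legendre-cong {p} {discr x} {discr y} (≈-coarsen (ℕ∣.m∣m*n (p ℕ.^ r)) (discr-cong {M} {x} {y} x≈y))))
  rest-cong : ∀ x y → x ≈² y [mod K ] → rest x ≡ rest y
  rest-cong x y x≈y = cong₂ _*_ (⟦Good⟧-cong x y x≈y) (weight-cong w fs ok ℕ∣.∣-refl (discr-cong {K} {x} {y} x≈y))
  ι-local : ι (∑ local elemsM) ≡ localFactor n w (p , suc r)
  ι-local = begin
    ι (∑ local elemsM)
      ≡⟨ cong ι (LocalSums.∑-weighed {n} {p} {M} pr (ℕ∣.m∣m*n (p ℕ.^ r)) (w (p , suc r))) ⟩
    ι (w (p , suc r) 1ℤ * localCount n p M 1ℤ + w (p , suc r) ℤ.-1ℤ * localCount n p M ℤ.-1ℤ)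
      ≡⟨ ι-+ (w (p , suc r) 1ℤ * localCount n p M 1ℤ) (w (p , suc r) ℤ.-1ℤ * localCount n p M ℤ.-1ℤ) ⟩
    ι (w (p , suc r) 1ℤ * localCount n p M 1ℤ) ℚ.+ ι (w (p , suc r) ℤ.-1ℤ * localCount n p M ℤ.-1ℤ)
      ≡⟨ cong₂ ℚ._+_ (ι-* (w (p , suc r) 1ℤ) (localCount n p M 1ℤ)) (ι-* (w (p , suc r) ℤ.-1ℤ) (localCount n p M ℤ.-1ℤ)) ⟩
    ι (w (p , suc r) 1ℤ) ℚ.* ι (localCount n p M 1ℤ) ℚ.+ ι (w (p , suc r) ℤ.-1ℤ) ℚ.* ι (localCount n p M ℤ.-1ℤ)
      ≡⟨ cong₂ (λ c d → ι (w (p , suc r) 1ℤ) ℚ.* c ℚ.+ ι (w (p , suc r) ℤ.-1ℤ) ℚ.* d)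
           (ι-halve (localCount n p M 1ℤ) (+ gcd (n ℕ.* n ℕ.∸ 1) (p ℕ.∸ 1)) (+ gcd (n ℕ.∸ 1) (p ℕ.∸ 1)) (PrimePower.split-count pr 2∤n p∣n r))
           (ι-halve (localCount n p M ℤ.-1ℤ) (+ gcd (p ℕ.* p ℕ.∸ 1) (gcd (n ℕ.* n ℕ.∸ 1) (n ℕ.∸ p))) (+ gcd (n ℕ.∸ 1) (p ℕ.∸ 1)) (PrimePower.inert-count pr 2∤n p∣n r)) ⟩
    localFactor n w (p , suc r) ∎
ι-weightedSum n w 2∤n ((p , zero) ∷ fs) ((_ , () , _) ∷ ok) _

-- Frobenius liars

coeff-+ : ∀ p q k → coeff (p +ₚ q) k ≡ coeff p k + coeff q k
coeff-+ []      q       k       = sym (ℤₚ.+-identityˡ (coeff q k))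
coeff-+ (a ∷ p) []      k       = sym (ℤₚ.+-identityʳ (coeff (a ∷ p) k))
coeff-+ (a ∷ p) (b ∷ q) zero    = refl
coeff-+ (a ∷ p) (b ∷ q) (suc k) = coeff-+ p q k

coeff-scale : ∀ a q k → coeff (map (a *_) q) k ≡ a * coeff q k
coeff-scale a []      k       = sym (ℤₚ.*-zeroʳ a)
coeff-scale a (b ∷ q) zero    = refl
coeff-scale a (b ∷ q) (suc k) = coeff-scale a q k

coeff-neg : ∀ q k → coeff (negₚ q) k ≡ - coeff q k
coeff-neg []      k       = refl
coeff-neg (b ∷ q) zero    = refl
coeff-neg (b ∷ q) (suc k) = coeff-neg q k

coeff-∷* : ∀ a p q k → coeff ((a ∷ p) *ₚ q) k ≡ a * coeff q k + coeff (0ℤ ∷ (p *ₚ q)) k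
coeff-∷* a p q k = trans (coeff-+ (map (a *_) q) (0ℤ ∷ (p *ₚ q)) k) (cong (_+ coeff (0ℤ ∷ (p *ₚ q)) k) (coeff-scale a q k))

coeff-1* : ∀ q k → coeff (oneₚ *ₚ q) k ≡ coeff q k
coeff-1* q k = trans (coeff-∷* 1ℤ [] q k) (trans (cong (_+_ (1ℤ * coeff q k)) (zeros k)) (trans (ℤₚ.+-identityʳ _) (ℤₚ.*-identityˡ (coeff q k))))
  where
  zeros : ∀ k → coeff (0ℤ ∷ []) k ≡ 0ℤ
  zeros zero    = refl
  zeros (suc k) = refl

coeff-*1 : ∀ q k → coeff (q *ₚ oneₚ) k ≡ coeff q k
coeff-*1 []      k       = refl
coeff-*1 (a ∷ q) zero    = trans (coeff-∷* a q oneₚ 0) (trans (ℤₚ.+-identityʳ (a * 1ℤ)) (ℤₚ.*-identityʳ a))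
coeff-*1 (a ∷ q) (suc k) = trans (coeff-∷* a q oneₚ (suc k)) (trans (cong (_+ coeff (q *ₚ oneₚ) k) (ℤₚ.*-zeroʳ a))
  (trans (ℤₚ.+-identityˡ _) (coeff-*1 q k)))

module _ {n : ℕ} where
  infix 4 _≈ₚ_
  _≈ₚ_ : Poly → Poly → Set
  p ≈ₚ q = ∀ k → coeff p k ≈ coeff q k [mod n ]

  PolyEq⇒≈ₚ : ∀ {p q} → PolyEq n p q → p ≈ₚ q
  PolyEq⇒≈ₚ {p} {q} e k = modulo (∣ᵤ⇒∣ {+ n} {coeff p k - coeff q k} (e k))

  ≈ₚ⇒PolyEq : ∀ {p q} → p ≈ₚ q → PolyEq n p q
  ≈ₚ⇒PolyEq {p} {q} e k = ∣⇒∣ᵤ {+ n} {coeff p k - coeff q k} (N∣a-b (e k))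

  record Degree (h : Poly) (d : ℕ) : Set where
    constructor degree
    field
      leading : coeff h d ≈ 1ℤ [mod n ]
      above   : ∀ k → d ℕ.< k → coeff h k ≈ 0ℤ [mod n ]
  open Degree public

  MonicDeg⇒Degree : ∀ {h d} → MonicDeg n h d → Degree h d
  MonicDeg⇒Degree {h} {d} (l , a) = degree (modulo (∣ᵤ⇒∣ {+ n} {coeff h d - 1ℤ} l)) (λ k d<k → ∣⇒≈0 (∣ᵤ⇒∣ {+ n} {coeff h k} (a k d<k)))

  Degree⇒MonicDeg : ∀ {h d} → Degree h d → MonicDeg n h d
  Degree⇒MonicDeg {h} {d} (degree l a) = ∣⇒∣ᵤ {+ n} {coeff h d - 1ℤ} (N∣a-b l) , λ k d<k → ∣⇒∣ᵤ {+ n} {coeff h k} (≈0⇒∣ (a k d<k))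

  Degree-cong : ∀ {g h d} → g ≈ₚ h → Degree g d → Degree h d
  Degree-cong g≈h (degree l a) = degree (≈-trans (≈-sym (g≈h _)) l) (λ k d<k → ≈-trans (≈-sym (g≈h k)) (a k d<k))

  coeff-0* : ∀ h q → (∀ k → coeff h k ≈ 0ℤ [mod n ]) → ∀ k → coeff (h *ₚ q) k ≈ 0ℤ [mod n ]
  coeff-0* []      q h≈0 k = ≈-refl
  coeff-0* (a ∷ h) q h≈0 k = ≈-trans (≈-reflexive (coeff-∷* a h q k)) (≈-+ (≈-* (h≈0 0) (≈-refl {a = coeff q k})) (shifted k))
    where
    shifted : ∀ k → coeff (0ℤ ∷ (h *ₚ q)) k ≈ 0ℤ [mod n ]
    shifted zero    = ≈-refl
    shifted (suc k) = coeff-0* h q (h≈0 ∘ suc) k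

  -- Degrees add in spite of zero divisors modulo n, because both leading coefficients are 1.
  Degree-* : ∀ {h q d e} → Degree h d → Degree q e → Degree (h *ₚ q) (d ℕ.+ e)
  -- The zero polynomial is monic only if 0 = 1 modulo n; `l` is that congruence and serves again
  -- for the product.
  Degree-* {[]} {q} {d} {e} (degree l a) (degree l′ a′) = degree l (λ k _ → ≈-refl)
  Degree-* {a ∷ h} {q} {zero} {e} (degree l a≈0) (degree l′ a′) = degree
    (≈-trans (≈-reflexive (coeff-∷* a h q e)) (≈-+ (≈-* l l′) (shifted e)))
    (λ k e<k → ≈-trans (≈-reflexive (coeff-∷* a h q k)) (≈-+ (≈-* l (a′ k e<k)) (shifted k)))
    where
    shifted : ∀ k → coeff (0ℤ ∷ (h *ₚ q)) k ≈ 0ℤ [mod n ]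
    shifted zero    = ≈-refl
    shifted (suc k) = coeff-0* h q (λ j → a≈0 (suc j) (ℕ.s≤s ℕ.z≤n)) k
  Degree-* {a ∷ h} {q} {suc d} {e} (degree l a≈0) dq@(degree l′ a′) = degree
    (≈-trans (≈-reflexive (coeff-∷* a h q (suc (d ℕ.+ e)))) (≈-+ (a*≈0 (suc (d ℕ.+ e)) (ℕ.s≤s (ℕₚ.m≤n+m e d))) (leading ih)))
    top
    where
    ih : Degree (h *ₚ q) (d ℕ.+ e)
    ih = Degree-* {h} {q} {d} {e} (degree l (λ k d<k → a≈0 (suc k) (ℕ.s≤s d<k))) dq
    a*≈0 : ∀ k → e ℕ.< k → a * coeff q k ≈ 0ℤ [mod n ]
    a*≈0 k e<k = ≈-trans (≈-* (≈-refl {a = a}) (a′ k e<k)) (≈-reflexive (ℤₚ.*-zeroʳ a))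
    top : ∀ k → suc d ℕ.+ e ℕ.< k → coeff ((a ∷ h) *ₚ q) k ≈ 0ℤ [mod n ]
    top (suc k) (ℕ.s≤s d+e<k) = ≈-trans (≈-reflexive (coeff-∷* a h q (suc k)))
      (≈-+ (a*≈0 (suc k) (ℕ.s≤s (ℕₚ.≤-trans (ℕₚ.m≤n+m e (suc d)) d+e<k))) (above ih k d+e<k))

module Division (b c : ℕ) where
  open Quadratic (+ b) (+ c) using (_⊗_; _⊕_)

  remainder : Poly → ℤ²
  remainder []      = 0ℤ , 0ℤ
  remainder (a ∷ p) = (a , 0ℤ) ⊕ (0ℤ , 1ℤ) ⊗ remainder p

  -- If p = Qf + u + vX, then a + Xp = (XQ + v)f + (a - cv) + (u - bv)X, so v is the new lowest
  -- coefficient of the quotient.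
  quotientₚ : Poly → Poly
  quotientₚ []      = []
  quotientₚ (a ∷ p) = proj₂ (remainder p) ∷ quotientₚ p

  linear : ℤ² → Poly
  linear (u , v) = u ∷ v ∷ []

  division : ∀ p k → coeff (quotientₚ p *ₚ quad b c) k + coeff (linear (remainder p)) k ≡ coeff p k
  division []      zero          = refl
  division []      (suc zero)    = refl
  division []      (suc (suc k)) = refl
  division (a ∷ p) k = trans (cong (_+ coeff (linear (remainder (a ∷ p))) k) (coeff-∷* v (quotientₚ p) (quad b c) k)) (go k)
    where
    u = proj₁ (remainder p)
    v = proj₂ (remainder p)
    Q = quotientₚ p *ₚ quad b c
    eq₀ : ∀ a c u v → v * c + 0ℤ + (a + (0ℤ * u - c * (1ℤ * v))) ≡ a
    eq₀ = solve-∀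
    eq₁ : ∀ b u v q → v * b + q + (0ℤ + (0ℤ * v + 1ℤ * u - b * (1ℤ * v))) ≡ q + u
    eq₁ = solve-∀
    eq₂ : ∀ v q → v * 1ℤ + q + 0ℤ ≡ q + v
    eq₂ = solve-∀
    eq₃ : ∀ v q → v * 0ℤ + q + 0ℤ ≡ q + 0ℤ
    eq₃ = solve-∀
    go : ∀ k → v * coeff (quad b c) k + coeff (0ℤ ∷ Q) k + coeff (linear (remainder (a ∷ p))) k ≡ coeff (a ∷ p) k
    go zero                = eq₀ a (+ c) u v
    go (suc zero)          = trans (eq₁ (+ b) u v (coeff Q 0)) (division p 0)
    go (suc (suc zero))    = trans (eq₂ v (coeff Q 1)) (division p 1)
    go (suc (suc (suc k))) = trans (eq₃ v (coeff Q (suc (suc k)))) (division p (suc (suc k)))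

module LiarBridge (n : ℕ) (1<n : 1 ℕ.< n) (fs : Factorisation) (b c : ℕ) where
  private
    β = + b
    γ = + c
  open Quadratic β γ using (_⊗_; _⊕_; ⊖_; conj)
  R = Quadratic.quotient β γ n
  open CommutativeRing R using () renaming (_≈_ to _≋_; refl to ≋-refl; sym to ≋-sym; trans to ≋-trans; +-cong to ⊕-cong; *-cong to ⊗-cong; -‿cong to ⊖-cong)
  open Algebra.Properties.Semiring.Exp (CommutativeRing.semiring R) using () renaming (_^_ to _^ᴿ_; ^-congˡ to ^ᴿ-cong; ^-assocʳ to ^ᴿ-assoc)
  open Division b c

  X X̄ : ℤ²
  X = 0ℤ , 1ℤ
  X̄ = - β , - 1ℤ

  f : Poly
  f = quad b c

  ≋-reflexive : ∀ {x y} → x ≡ y → x ≋ y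
  ≋-reflexive refl = ≈-refl , ≈-refl

  private
    const-* : ∀ a a′ → (a * a′ , 0ℤ) ≡ (a , 0ℤ) ⊗ (a′ , 0ℤ)
    const-* a a′ = cong₂ _,_ (eq₁ γ a a′) (eq₂ β a a′)
      where
      eq₁ : ∀ c a a′ → a * a′ ≡ a * a′ - c * (0ℤ * 0ℤ)
      eq₁ = solve-∀
      eq₂ : ∀ b a a′ → 0ℤ ≡ a * 0ℤ + 0ℤ * a′ - b * (0ℤ * 0ℤ)
      eq₂ = solve-∀

  open Evaluation (λ a b → a ≈ b [mod n ]) ≈-sym ≈-reflexive R (λ a → a , 0ℤ) (λ a≈b → a≈b , ≈-refl)
    (≈-refl , ≈-refl) (≈-refl , ≈-refl) (λ a a′ → ≈-refl , ≈-refl) (λ a a′ → ≋-reflexive (const-* a a′))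

  X^≡xpow : ∀ m → X ^ᴿ m ≡ xpow β γ m
  X^≡xpow zero    = refl
  X^≡xpow (suc m) = trans (cong (X ⊗_) (X^≡xpow m)) (cong₂ _,_ (eq₁ γ (proj₁ (xpow β γ m)) (proj₂ (xpow β γ m))) (eq₂ β (proj₁ (xpow β γ m)) (proj₂ (xpow β γ m))))
    where
    eq₁ : ∀ c u v → 0ℤ * u - c * (1ℤ * v) ≡ - (c * v)
    eq₁ = solve-∀
    eq₂ : ∀ b u v → 0ℤ * v + 1ℤ * u - b * (1ℤ * v) ≡ u - b * v
    eq₂ = solve-∀

  conj-⊗ : ∀ x y → conj (x ⊗ y) ≡ conj x ⊗ conj y
  conj-⊗ (u , v) (s , t) = cong₂ _,_ (eq₁ β γ u v s t) (eq₂ β u v s t)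
    where
    eq₁ : ∀ b c u v s t → u * s - c * (v * t) - b * (u * t + v * s - b * (v * t)) ≡ (u - b * v) * (s - b * t) - c * (- v * - t)
    eq₁ = solve-∀
    eq₂ : ∀ b u v s t → - (u * t + v * s - b * (v * t)) ≡ (u - b * v) * - t + - v * (s - b * t) - b * (- v * - t)
    eq₂ = solve-∀

  conj-^ : ∀ x m → conj (x ^ᴿ m) ≡ conj x ^ᴿ m
  conj-^ x zero    = cong (_, 0ℤ) (eq β)
    where
    eq : ∀ b → 1ℤ - b * 0ℤ ≡ 1ℤ
    eq = solve-∀
  conj-^ x (suc m) = trans (conj-⊗ x (x ^ᴿ m)) (cong (conj x ⊗_) (conj-^ x m))

  conj-cong : ∀ x y → x ≋ y → conj x ≋ conj y
  conj-cong x y (p , q) = ≈-- p (≈-* (≈-refl {a = β}) q) , ≈-neg q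

  conj-X : conj X ≡ X̄
  conj-X = cong (_, - 1ℤ) (eq β)
    where
    eq : ∀ b → 0ℤ - b * 1ℤ ≡ - b
    eq = solve-∀

  conj-X̄ : conj X̄ ≡ X
  conj-X̄ = cong (_, 1ℤ) (eq β)
    where
    eq : ∀ b → - b - b * - 1ℤ ≡ 0ℤ
    eq = solve-∀

  eval-f-X : eval X f ≋ (0ℤ , 0ℤ)
  eval-f-X = ≋-trans (eval-quadratic X β γ) (≋-reflexive (cong₂ _,_ (eq₁ β γ) (eq₂ β)))
    where
    eq₁ : ∀ b c → 0ℤ * 0ℤ - c * (1ℤ * 1ℤ) + (b * 0ℤ - c * (0ℤ * 1ℤ)) + c ≡ 0ℤ
    eq₁ = solve-∀
    eq₂ : ∀ b → 0ℤ * 1ℤ + 1ℤ * 0ℤ - b * (1ℤ * 1ℤ) + (b * 1ℤ + 0ℤ * 0ℤ - b * (0ℤ * 1ℤ)) + 0ℤ ≡ 0ℤ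
    eq₂ = solve-∀

  eval-f-X̄ : eval X̄ f ≋ (0ℤ , 0ℤ)
  eval-f-X̄ = ≋-trans (eval-quadratic X̄ β γ) (≋-reflexive (cong₂ _,_ (eq₁ β γ) (eq₂ β)))
    where
    eq₁ : ∀ b c → - b * - b - c * (- 1ℤ * - 1ℤ) + (b * - b - c * (0ℤ * - 1ℤ)) + c ≡ 0ℤ
    eq₁ = solve-∀
    eq₂ : ∀ b → - b * - 1ℤ + - 1ℤ * - b - b * (- 1ℤ * - 1ℤ) + (b * - 1ℤ + 0ℤ * - b - b * (0ℤ * - 1ℤ)) + 0ℤ ≡ 0ℤ
    eq₂ = solve-∀

  eval-remainder : ∀ p → eval X p ≋ remainder p
  eval-remainder []      = ≋-refl
  eval-remainder (a ∷ p) = ⊕-cong {a , 0ℤ} {a , 0ℤ} {X ⊗ eval X p} {X ⊗ remainder p} (≋-refl {a , 0ℤ})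
    (⊗-cong {X} {X} {eval X p} {remainder p} (≋-refl {X}) (eval-remainder p))

  -- The value of p at X is its remainder modulo f, so its vanishing leaves p = Qf.
  f∣ : ∀ p → eval X p ≋ (0ℤ , 0ℤ) → ∀ k → coeff (quotientₚ p *ₚ f) k ≈ coeff p k [mod n ]
  f∣ p e k = ≈-trans (≈-reflexive (sym (ℤₚ.+-identityʳ _))) (≈-trans (≈-+ (≈-refl {a = coeff (quotientₚ p *ₚ f) k}) (≈-sym (lin≈0 k)))
      (≈-reflexive (division p k)))
    where
    rem≈0 : remainder p ≋ (0ℤ , 0ℤ)
    rem≈0 = ≋-trans (≋-sym (eval-remainder p)) e
    lin≈0 : ∀ k → coeff (linear (remainder p)) k ≈ 0ℤ [mod n ]
    lin≈0 zero          = proj₁ rem≈0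
    lin≈0 (suc zero)    = proj₂ rem≈0
    lin≈0 (suc (suc k)) = ≈-refl

  degree-f : Degree {n} f 2
  degree-f = degree ≈-refl above-2
    where
    above-2 : ∀ k → 2 ℕ.< k → coeff f k ≈ 0ℤ [mod n ]
    above-2 (suc (suc (suc k))) _ = ≈-refl
    above-2 (suc (suc zero)) (ℕ.s≤s (ℕ.s≤s ()))
    above-2 (suc zero) (ℕ.s≤s ())

  degree-1 : Degree {n} oneₚ 0
  degree-1 = degree ≈-refl above-0
    where
    above-0 : ∀ k → 0 ℕ.< k → coeff oneₚ k ≈ 0ℤ [mod n ]
    above-0 (suc k) _ = ≈-refl

  1≉0 : ¬ 1ℤ ≈ 0ℤ [mod n ]
  1≉0 1≈0 = contradiction (residue-unique 1<n (ℕₚ.<-trans (ℕₚ.n<1+n 0) 1<n) 1≈0) λ ()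

  degree≤2 : ∀ {g d} → _≈ₚ_ {n} g f → Degree {n} g d → d ℕ.≤ 2
  degree≤2 {g} {d} g≈f dg with d ℕ.≤? 2
  ... | yes d≤2 = d≤2
  ... | no d≰2  = contradiction (≈-trans (≈-sym (leading dg)) (≈-trans (g≈f d) (above degree-f d (ℕₚ.≰⇒> d≰2)))) 1≉0

  -- For d = 0 and d = 1 the rounded half is 0 and the sign +1, so both cases vanish by computation.
  sign⇒2≤ : ∀ d → ℤ.-1ℤ ℤ.^ (d ℕ./ 2) ≡ ℤ.-1ℤ → 2 ℕ.≤ d
  sign⇒2≤ (suc (suc d)) _ = ℕ.s≤s (ℕ.s≤s ℕ.z≤n)

  LiarMinus⇒Good : LiarMinus n fs b c → Good n n (β , γ) × jacobi fs (disc b c) ≡ ℤ.-1ℤ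
  LiarMinus⇒Good ((gcd≡1 , F₁ , f₁ , F₂ , f₂ , ((e , dF₁) , gcmd₁) , F₁f₁ , _ , F₂f₂ , f₂≡1 , (q , qF₂) , d , dF₂ , sign) , jac) =
    (gcd≡1 , u≈ , v≈) , jac
    where
    degF₂ : Degree {n} F₂ d
    degF₂ = MonicDeg⇒Degree {h = F₂} dF₂
    degF₁ : Degree {n} F₁ e
    degF₁ = MonicDeg⇒Degree {h = F₁} dF₁
    f₂≈1 : _≈ₚ_ {n} f₂ oneₚ
    f₂≈1 = PolyEq⇒≈ₚ {p = f₂} {oneₚ} f₂≡1
    F₂f₂≈f₁ : _≈ₚ_ {n} (F₂ *ₚ f₂) f₁
    F₂f₂≈f₁ = PolyEq⇒≈ₚ {p = F₂ *ₚ f₂} {f₁} F₂f₂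
    F₁f₁≈f : _≈ₚ_ {n} (F₁ *ₚ f₁) f
    F₁f₁≈f = PolyEq⇒≈ₚ {p = F₁ *ₚ f₁} {f} F₁f₁
    degf₁ : Degree {n} f₁ d
    degf₁ = Degree-cong {g = F₂ *ₚ f₂} F₂f₂≈f₁ (subst (Degree (F₂ *ₚ f₂)) (ℕₚ.+-identityʳ d)
      (Degree-* {h = F₂} {f₂} degF₂ (Degree-cong {g = oneₚ} (λ k → ≈-sym (f₂≈1 k)) degree-1)))
    -- deg F₁ + deg f₁ is at most deg f = 2, and deg f₁ = deg F₂ is at least 2 by the sign
    -- condition.
    e≡0 : e ≡ 0
    e≡0 = ℕₚ.n≤0⇒n≡0 (ℕₚ.+-cancelʳ-≤ 2 e 0 (ℕₚ.≤-trans (ℕₚ.+-monoʳ-≤ e (sign⇒2≤ d (trans sign jac)))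
      (degree≤2 {F₁ *ₚ f₁} F₁f₁≈f (Degree-* {h = F₁} {f₁} degF₁ degf₁))))
    F₁≈1 : _≈ₚ_ {n} F₁ oneₚ
    F₁≈1 = go (subst (Degree F₁) e≡0 degF₁)
      where
      go : Degree {n} F₁ 0 → _≈ₚ_ {n} F₁ oneₚ
      go (degree l a) zero    = l
      go (degree l a) (suc k) = a (suc k) (ℕ.s≤s ℕ.z≤n)
    -- 1 lies in the ideal of F₁ = 1, hence in the ideal of Xⁿ - X and f.
    bezout = proj₂ (gcmd₁ oneₚ) (oneₚ , ≈ₚ⇒PolyEq {p = oneₚ *ₚ F₁} {oneₚ} (λ k → ≈-trans (≈-reflexive (coeff-1* F₁ k)) (F₁≈1 k)))
    A = proj₁ bezout
    A′ = proj₁ (proj₂ bezout)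
    y = X ^ᴿ n
    root : eval y f ≋ (0ℤ , 0ℤ)
    root = power-root {n} {X} {f} {F₁} {f₁} {F₂} {f₂} {q} {A} {A′} eval-f-X F₁≈1 F₁f₁≈f F₂f₂≈f₁ f₂≈1
      (PolyEq⇒≈ₚ {p = q *ₚ F₂} {compose F₂ (Xpow n)} qF₂)
    unit : eval X A ⊗ (y ⊕ ⊖ X) ≋ (1ℤ , 0ℤ)
    unit = power-unit {n} {X} {f} {F₁} {f₁} {F₂} {f₂} {q} {A} {A′} eval-f-X F₁≈1 F₁f₁≈f F₂f₂≈f₁ f₂≈1
      (PolyEq⇒≈ₚ {p = A *ₚ (Xpow n -ₚ Xpow 1) +ₚ A′ *ₚ f} {oneₚ} (proj₂ (proj₂ bezout)))
    sum≋0 : (y ⊕ X) ⊕ (β , 0ℤ) ≋ (0ℤ , 0ℤ)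
    sum≋0 = other-root {X} {y} {β , 0ℤ} {γ , 0ℤ} {eval X A} (≋-trans (≋-sym (eval-quadratic X β γ)) eval-f-X)
      (≋-trans (≋-sym (eval-quadratic y β γ)) root) unit
    u = proj₁ (xpow β γ n)
    v = proj₂ (xpow β γ n)
    xpow-sum≋0 : (xpow β γ n ⊕ X) ⊕ (β , 0ℤ) ≋ (0ℤ , 0ℤ)
    xpow-sum≋0 = subst (λ y → (y ⊕ X) ⊕ (β , 0ℤ) ≋ (0ℤ , 0ℤ)) (X^≡xpow n) sum≋0
    solve-u : ∀ b u → u + 0ℤ + b ≈ 0ℤ [mod n ] → u ≈ - b [mod n ]
    solve-u b u = ≈-lin 1ℤ (eq b u)
      where
      eq : ∀ b u → u - - b ≡ 1ℤ * (u + 0ℤ + b - 0ℤ)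
      eq = solve-∀
    solve-v : ∀ v → v + 1ℤ + 0ℤ ≈ 0ℤ [mod n ] → v ≈ - 1ℤ [mod n ]
    solve-v v = ≈-lin 1ℤ (eq v)
      where
      eq : ∀ v → v - - 1ℤ ≡ 1ℤ * (v + 1ℤ + 0ℤ - 0ℤ)
      eq = solve-∀
    u≈ : u ≈ - β [mod n ]
    u≈ = solve-u β u (proj₁ xpow-sum≋0)
    v≈ : v ≈ - 1ℤ [mod n ]
    v≈ = solve-v v (proj₂ xpow-sum≋0)

  module _ (good : Good n n (β , γ)) where
    private
      X^n≋X̄ : X ^ᴿ n ≋ X̄
      X^n≋X̄ = ≋-trans (≋-reflexive (X^≡xpow n)) (proj₂ good)

      X^n²≋X : X ^ᴿ (n ℕ.* n) ≋ X
      X^n²≋X = ≋-trans (≋-sym (^ᴿ-assoc X n n)) (≋-trans (^ᴿ-cong n X^n≋X̄)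
        (≋-trans (≋-reflexive (trans (cong (_^ᴿ n) (sym conj-X)) (sym (conj-^ X n))))
        (≋-trans (conj-cong (X ^ᴿ n) X̄ X^n≋X̄) (≋-reflexive conj-X̄))))

      Δ-unit : Unit n (discr (β , γ))
      Δ-unit = Unit-*ʳ γ (discr (β , γ)) (Good⇒Unit {n} {n} (β , γ) good)
      t = proj₁ Δ-unit
      -- δ = X̄ - X has square Δ, so tδ inverts it when t inverts Δ.
      δ w : ℤ²
      δ = - β , - + 2
      w = (t , 0ℤ) ⊗ δ

      w⊗δ : w ⊗ δ ≋ (1ℤ , 0ℤ)
      w⊗δ = ≋-trans (≋-reflexive (cong₂ _,_ (eq₁ β γ t) (eq₂ β γ t))) (proj₂ Δ-unit , ≈-refl)
        where
        eq₁ : ∀ b c t → (t * - b - c * (0ℤ * - + 2)) * - b - c * ((t * - + 2 + 0ℤ * - b - b * (0ℤ * - + 2)) * - + 2) ≡ t * (b * b - + 4 * c)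
        eq₁ = solve-∀
        eq₂ : ∀ b c t → (t * - b - c * (0ℤ * - + 2)) * - + 2 + (t * - + 2 + 0ℤ * - b - b * (0ℤ * - + 2)) * - b -
              b * ((t * - + 2 + 0ℤ * - b - b * (0ℤ * - + 2)) * - + 2) ≡ 0ℤ
        eq₂ = solve-∀

      g₁ g₂ : Poly
      g₁ = Xpow n -ₚ Xpow 1
      g₂ = Xpow (n ℕ.* n) -ₚ Xpow 1

      eval-X : eval X (Xpow 1) ≋ X
      eval-X = ≋-trans (eval-Xpow X 1) (CommutativeRing.*-identityʳ R X)

      eval-g₁ : eval X g₁ ≋ δ
      eval-g₁ = ≋-trans (eval-- X (Xpow n) (Xpow 1)) (≋-trans (⊕-cong {eval X (Xpow n)} {X̄} {⊖ eval X (Xpow 1)} {⊖ X}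
          (≋-trans (eval-Xpow X n) X^n≋X̄) (⊖-cong {eval X (Xpow 1)} {X} eval-X))
        (≋-reflexive (cong (_, - + 2) (ℤₚ.+-identityʳ (- β)))))

      eval-g₂ : eval X g₂ ≋ (0ℤ , 0ℤ)
      eval-g₂ = ≋-trans (eval-- X (Xpow (n ℕ.* n)) (Xpow 1)) (≋-trans (⊕-cong {eval X (Xpow (n ℕ.* n))} {X} {⊖ eval X (Xpow 1)} {⊖ X}
          (≋-trans (eval-Xpow X (n ℕ.* n)) X^n²≋X) (⊖-cong {eval X (Xpow 1)} {X} eval-X))
        (CommutativeRing.-‿inverseʳ R X))

      eval-linear′ : ∀ x → eval X (linear x) ≋ x
      eval-linear′ (s , t) = ≋-trans (eval-linear X s t) (≋-reflexive (cong₂ _,_ (eq₁ γ s t) (eq₂ β t)))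
        where
        eq₁ : ∀ c s t → s + (0ℤ * t - c * (1ℤ * 0ℤ)) ≡ s
        eq₁ = solve-∀
        eq₂ : ∀ b t → 0ℤ + (0ℤ * 0ℤ + 1ℤ * t - b * (1ℤ * 0ℤ)) ≡ t
        eq₂ = solve-∀

      -- g₁ takes the unit value δ at X. Taking for A the remainder of q times w = δ⁻¹ makes q - A
      -- g₁ vanish at X, hence divisible by f.
      InIdeal₂-all : ∀ q → InIdeal₂ n g₁ f q
      InIdeal₂-all q = A , quotientₚ r , ≈ₚ⇒PolyEq {p = A *ₚ g₁ +ₚ quotientₚ r *ₚ f} {q} λ k →
          ≈-trans (≈-reflexive (coeff-+ (A *ₚ g₁) (quotientₚ r *ₚ f) k))
          (≈-trans (≈-+ (≈-refl {a = coeff (A *ₚ g₁) k}) (f∣ r r≋0 k))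
          (≈-reflexive (trans (cong (_+_ (coeff (A *ₚ g₁) k)) (trans (coeff-+ q (negₚ (A *ₚ g₁)) k) (cong (_+_ (coeff q k)) (coeff-neg (A *ₚ g₁) k))))
            (eq (coeff (A *ₚ g₁) k) (coeff q k)))))
        where
        A r : Poly
        A = linear (remainder q ⊗ w)
        r = q -ₚ A *ₚ g₁
        eq : ∀ a q → a + (q + - a) ≡ q
        eq = solve-∀
        eval-Ag₁ : eval X (A *ₚ g₁) ≋ (eval X q ⊗ w) ⊗ δ
        eval-Ag₁ = ≋-trans (eval-* X A g₁) (⊗-cong {eval X A} {eval X q ⊗ w} {eval X g₁} {δ}
          (≋-trans (eval-linear′ (remainder q ⊗ w)) (⊗-cong {remainder q} {eval X q} {w} {w} (≋-sym (eval-remainder q)) (≋-refl {w}))) eval-g₁)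
        r≋0 : eval X r ≋ (0ℤ , 0ℤ)
        r≋0 = ≋-trans (eval-- X q (A *ₚ g₁)) (≋-trans
          (⊕-cong {eval X q} {eval X q} {⊖ eval X (A *ₚ g₁)} {⊖ ((eval X q ⊗ w) ⊗ δ)} (≋-refl {eval X q}) (⊖-cong {eval X (A *ₚ g₁)} {(eval X q ⊗ w) ⊗ δ} eval-Ag₁))
          (cofactor {w} {δ} (eval X q) w⊗δ))

      gcmd₁ : IsGcmd n g₁ f oneₚ
      gcmd₁ = (0 , Degree⇒MonicDeg {h = oneₚ} degree-1) , λ q →
        (λ _ → q , ≈ₚ⇒PolyEq {p = q *ₚ oneₚ} {q} (λ k → ≈-reflexive (coeff-*1 q k))) , (λ _ → InIdeal₂-all q)

      eval-InIdeal₂ : ∀ q a a′ → PolyEq n (a *ₚ g₂ +ₚ a′ *ₚ f) q → eval X q ≋ (0ℤ , 0ℤ)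
      eval-InIdeal₂ q a a′ e = ≋-trans (≋-sym (eval-cong X (a *ₚ g₂ +ₚ a′ *ₚ f) q (PolyEq⇒≈ₚ {p = a *ₚ g₂ +ₚ a′ *ₚ f} {q} e)))
        (combination X a g₂ a′ f eval-g₂ eval-f-X)

      -- X^(n²) = X modulo f, so g₂ vanishes at X and adds nothing to the ideal of f.
      gcmd₂ : IsGcmd n g₂ f f
      gcmd₂ = (2 , Degree⇒MonicDeg {h = f} degree-f) , λ q →
        (λ (a , a′ , e) → quotientₚ q , ≈ₚ⇒PolyEq {p = quotientₚ q *ₚ f} {q} (f∣ q (eval-InIdeal₂ q a a′ e))) , (λ (a , e) → [] , a , e)

      f∣f[X^n] : eval X (compose f (Xpow n)) ≋ (0ℤ , 0ℤ)
      f∣f[X^n] = ≋-trans (eval-compose X f (Xpow n)) (≋-trans (eval-θ-cong f (≋-trans (eval-Xpow X n) X^n≋X̄)) eval-f-X̄)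

    Good⇒LiarMinus : jacobi fs (disc b c) ≡ ℤ.-1ℤ → LiarMinus n fs b c
    Good⇒LiarMinus jac = (proj₁ good , oneₚ , f , f , oneₚ , gcmd₁ ,
      ≈ₚ⇒PolyEq {p = oneₚ *ₚ f} {f} (λ k → ≈-reflexive (coeff-1* f k)) , gcmd₂ ,
      ≈ₚ⇒PolyEq {p = f *ₚ oneₚ} {f} (λ k → ≈-reflexive (coeff-*1 f k)) ,
      ≈ₚ⇒PolyEq {p = oneₚ} {oneₚ} (λ k → ≈-refl) ,
      (quotientₚ (compose f (Xpow n)) , ≈ₚ⇒PolyEq {p = quotientₚ (compose f (Xpow n)) *ₚ f} {compose f (Xpow n)} (f∣ (compose f (Xpow n)) f∣f[X^n])) ,
      (2 , Degree⇒MonicDeg {h = f} degree-f , sym jac)) , jac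

-- Signs, the enumeration of liars and the final formula

prime-factors : ∀ {n} fs → All (λ pr → Prime (proj₁ pr)) fs → All (λ pr → 1 ℕ.≤ proj₂ pr) fs → value fs ℕ∣.∣ n → All (PrimeFactor n) fs
prime-factors []                 []         []         _   = []
prime-factors ((p , suc r) ∷ fs) (pr ∷ prs) (1≤r ∷ rs) v∣n =
  (pr , 1≤r , ℕ∣.∣-trans (ℕ∣.∣-trans (ℕ∣.m∣m*n (p ℕ.^ r)) (ℕ∣.m∣m*n (value fs))) v∣n) ∷
  prime-factors fs prs rs (ℕ∣.∣-trans (ℕ∣.n∣m*n (p ℕ.^ suc r)) v∣n)

PlusMinusOne : ℤ → Set
PlusMinusOne a = a ≡ 1ℤ ⊎ a ≡ ℤ.-1ℤ

±1-* : ∀ {a b} → PlusMinusOne a → PlusMinusOne b → PlusMinusOne (a * b)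
±1-* (inj₁ refl) (inj₁ refl) = inj₁ refl
±1-* (inj₁ refl) (inj₂ refl) = inj₂ refl
±1-* (inj₂ refl) (inj₁ refl) = inj₂ refl
±1-* (inj₂ refl) (inj₂ refl) = inj₁ refl

±1-^ : ∀ {a} r → PlusMinusOne a → PlusMinusOne (a ℤ.^ r)
±1-^ zero    _ = inj₁ refl
±1-^ (suc r) e = ±1-* e (±1-^ r e)

jacobi≡±1 : ∀ {n N} fs → All (PrimeFactor N) fs → ∀ x → Good n N x → PlusMinusOne (jacobi fs (discr x))
jacobi≡±1         []             []                    x g = inj₁ refl
jacobi≡±1 {n} {N} ((p , r) ∷ fs) ((pr , _ , p∣N) ∷ ok) x g =
  ±1-* (±1-^ r (legendre≡±1 {p} {{prime⇒nonZero pr}} {discr x} (Good-Δ≉0 {n} {N} pr x p∣N g))) (jacobi≡±1 {n} {N} fs ok x g)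

one-weight power-weight : ℕ × ℕ → ℤ → ℤ
one-weight _ _ = 1ℤ
power-weight (_ , r) l = l ℤ.^ r

weight-one : ∀ fs a → weight one-weight fs a ≡ 1ℤ
weight-one []       a = refl
weight-one (_ ∷ fs) a = trans (ℤₚ.*-identityˡ _) (weight-one fs a)

-1^even : ∀ r → 2 ℕ∣.∣ r → ℤ.-1ℤ ℤ.^ r ≡ 1ℤ
-1^even _ (ℕ∣.divides zero    refl) = refl
-1^even _ (ℕ∣.divides (suc q) refl) = cong (λ e → ℤ.-1ℤ * (ℤ.-1ℤ * e)) (-1^even (q ℕ.* 2) (ℕ∣.divides q refl))

-1^odd : ∀ r → ¬ 2 ℕ∣.∣ r → ℤ.-1ℤ ℤ.^ r ≡ ℤ.-1ℤ
-1^odd zero          2∤r = contradiction (ℕ∣.divides 0 refl) 2∤r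
-1^odd (suc zero)    2∤r = refl
-1^odd (suc (suc r)) 2∤r = cong (λ e → ℤ.-1ℤ * (ℤ.-1ℤ * e)) (-1^odd r (λ 2∣r → 2∤r (ℕ∣.∣m∣n⇒∣m+n (ℕ∣.∣-refl {2}) 2∣r)))

1^ : ∀ r → 1ℤ ℤ.^ r ≡ 1ℤ
1^ zero    = refl
1^ (suc r) = trans (ℤₚ.*-identityˡ _) (1^ r)

product-one : ∀ n fs → foldr (λ pr acc → localFactor n one-weight pr ℚ.* acc) ℚ.1ℚ fs ≡ prodCD n fs
product-one n []       = refl
product-one n (f ∷ fs) = cong₂ ℚ._*_ (cong₂ ℚ._+_ (ℚₚ.*-identityˡ (Cᵢ n (proj₁ f))) (ℚₚ.*-identityˡ (Dᵢ n (proj₁ f)))) (product-one n fs)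

product-signed : ∀ n fs → foldr (λ pr acc → localFactor n power-weight pr ℚ.* acc) ℚ.1ℚ fs ≡ prodSigned n fs
product-signed n []             = refl
product-signed n ((p , r) ∷ fs) = cong₂ ℚ._*_ (factor (2 ℕ∣.∣? r)) (product-signed n fs)
  where
  c = Cᵢ n p
  d = Dᵢ n p
  factor : (2∣?r : Dec (2 ℕ∣.∣ r)) → localFactor n power-weight (p , r) ≡ (if does 2∣?r then c ℚ.+ d else c ℚ.- d)
  factor (yes 2∣r) = cong₂ ℚ._+_ (trans (cong (λ e → ι e ℚ.* c) (1^ r)) (ℚₚ.*-identityˡ c))
                                 (trans (cong (λ e → ι e ℚ.* d) (-1^even r 2∣r)) (ℚₚ.*-identityˡ d))
  factor (no 2∤r)  = cong₂ ℚ._+_ (trans (cong (λ e → ι e ℚ.* c) (1^ r)) (ℚₚ.*-identityˡ c))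
                                 (trans (cong (λ e → ι e ℚ.* d) (-1^odd r 2∤r)) (trans (sym (ℚₚ.neg-distribˡ-* ℚ.1ℚ d)) (cong ℚ.-_ (ℚₚ.*-identityˡ d))))

module _ (n : ℕ) (fs : Factorisation) where
  GoodMinus : ℤ² → Set
  GoodMinus x = Good n n x × jacobi fs (discr x) ≡ ℤ.-1ℤ

  GoodMinus? : ∀ x → Dec (GoodMinus x)
  GoodMinus? x = Good? n n x ×-dec jacobi fs (discr x) ℤ.≟ ℤ.-1ℤ

  ι² : ℕ × ℕ → ℤ²
  ι² (b , c) = + b , + c

  -- `Liar` quantifies over polynomials and gives no direct test. The equivalent condition
  -- `GoodMinus` is decidable, so the liars are listed by filtering with it.
  goodPairs : List (ℕ × ℕ)
  goodPairs = filter (GoodMinus? ∘ ι²) (cartesianProduct (upTo n) (upTo n))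

  length-goodPairs : .{{_ : ℕ.NonZero n}} → + length goodPairs ≡ ∑ (λ x → ⟦ GoodMinus? x ⟧) (FiniteSetoid.elems (residues n ×ᶠ residues n))
  length-goodPairs = begin
    + length goodPairs
      ≡⟨ ∑-filter (GoodMinus? ∘ ι²) (cartesianProduct (upTo n) (upTo n)) ⟨
    ∑ (λ x → ⟦ GoodMinus? (ι² x) ⟧) (cartesianProduct (upTo n) (upTo n))
      ≡⟨ ∑-cartesianProduct (λ x → ⟦ GoodMinus? (ι² x) ⟧) (upTo n) (upTo n) ⟩
    ∑ (λ b → ∑ (λ c → ⟦ GoodMinus? (+ b , + c) ⟧) (upTo n)) (upTo n)
      ≡⟨ ∑-cong (λ b → ∑-map (λ c → ⟦ GoodMinus? (+ b , c) ⟧) +_ (upTo n)) (upTo n) ⟨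
    ∑ (λ b → ∑ (λ c → ⟦ GoodMinus? (+ b , c) ⟧) (map +_ (upTo n))) (upTo n)
      ≡⟨ ∑-map (λ b → ∑ (λ c → ⟦ GoodMinus? (b , c) ⟧) (map +_ (upTo n))) +_ (upTo n) ⟨
    ∑ (λ b → ∑ (λ c → ⟦ GoodMinus? (b , c) ⟧) (map +_ (upTo n))) (map +_ (upTo n))
      ≡⟨ ∑-cartesianProduct (λ x → ⟦ GoodMinus? x ⟧) (map +_ (upTo n)) (map +_ (upTo n)) ⟨
    ∑ (λ x → ⟦ GoodMinus? x ⟧) (FiniteSetoid.elems (residues n ×ᶠ residues n)) ∎
    where open ≡-Reasoning

  goodPairs-count : 1 ℕ.< n → IsCount n (LiarMinus n fs) (length goodPairs)
  goodPairs-count 1<n = goodPairs , Unique-filter (GoodMinus? ∘ ι²) (Unique-cartesianProduct (Unique-upTo n) (Unique-upTo n)) ,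
    (λ b c → to b c , from b c) , refl
    where
    to : ∀ b c → (b , c) ∈ goodPairs → b ℕ.< n × c ℕ.< n × LiarMinus n fs b c
    to b c bc∈ = let (bc∈² , good , jac) = ∈-filter⁻ (GoodMinus? ∘ ι²) {xs = cartesianProduct (upTo n) (upTo n)} bc∈
                     (b∈ , c∈) = ∈-cartesianProduct⁻ (upTo n) (upTo n) bc∈²
                 in ∈-upTo⁻ b∈ , ∈-upTo⁻ c∈ , LiarBridge.Good⇒LiarMinus n 1<n fs b c good jac
    from : ∀ b c → b ℕ.< n × c ℕ.< n × LiarMinus n fs b c → (b , c) ∈ goodPairs
    from b c (b<n , c<n , liar) = ∈-filter⁺ (GoodMinus? ∘ ι²) (∈-cartesianProduct⁺ (∈-upTo⁺ b<n) (∈-upTo⁺ c<n))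
      (LiarBridge.LiarMinus⇒Good n 1<n fs b c liar)

-- Among j = ±1 the value - 1 is singled out by 1 - j.
∑-GoodMinus : ∀ fs .{{_ : ℕ.NonZero (value fs)}} → All (PrimeFactor (value fs)) fs → let n = value fs in
              + 2 * ∑ (λ x → ⟦ GoodMinus? n fs x ⟧) (FiniteSetoid.elems (residues n ×ᶠ residues n)) ≡
              weightedSum n one-weight fs - weightedSum n power-weight fs
∑-GoodMinus fs ok = trans (sym (∑-*ˡ (+ 2) (λ x → ⟦ GoodMinus? n fs x ⟧) elems)) (trans (∑-cong pointwise elems) (∑-- _ _ elems))
  where
  n = value fs
  elems = FiniteSetoid.elems (residues n ×ᶠ residues n)
  pointwise : ∀ x → + 2 * ⟦ GoodMinus? n fs x ⟧ ≡ ⟦ Good? n n x ⟧ * weight one-weight fs (discr x) - ⟦ Good? n n x ⟧ * weight power-weight fs (discr x)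
  pointwise x = trans (cong (+ 2 *_) (⟦⟧-× (Good? n n x) (j ℤ.≟ ℤ.-1ℤ)))
    (trans (go (Good? n n x)) (cong (λ e → ⟦ Good? n n x ⟧ * e - ⟦ Good? n n x ⟧ * j) (sym (weight-one fs (discr x)))))
    where
    j = jacobi fs (discr x)
    sign : ∀ {j} → PlusMinusOne j → + 2 * (1ℤ * ⟦ j ℤ.≟ ℤ.-1ℤ ⟧) ≡ 1ℤ * 1ℤ - 1ℤ * j
    sign (inj₁ refl) = refl
    sign (inj₂ refl) = refl
    go : (d : Dec (Good n n x)) → + 2 * (⟦ d ⟧ * ⟦ j ℤ.≟ ℤ.-1ℤ ⟧) ≡ ⟦ d ⟧ * 1ℤ - ⟦ d ⟧ * j
    go (yes g) = sign (jacobi≡±1 {n} {n} fs ok x g)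
    go (no _)  = refl

count-formula : ∀ fs .{{_ : ℕ.NonZero (value fs)}} → ¬ 2 ℕ∣.∣ value fs → All (PrimeFactor (value fs)) fs → Unique (map proj₁ fs) →
                toℚ (length (goodPairs (value fs) fs)) ≡ formula (value fs) fs
count-formula fs 2∤n ok unique = begin
  ι (+ length (goodPairs n fs))      ≡⟨ cong ι (length-goodPairs n fs) ⟩
  ι S                                ≡⟨ ι-halve S A B (∑-GoodMinus fs ok) ⟩
  ½ ℚ.* (ι A ℚ.- ι B)                ≡⟨ cong₂ (λ a b → ½ ℚ.* (a ℚ.- b)) (trans (ι-weightedSum n one-weight 2∤n fs ok unique) (product-one n fs))
                                                                        (trans (ι-weightedSum n power-weight 2∤n fs ok unique) (product-signed n fs)) ⟩
  ½ ℚ.* (prodCD n fs ℚ.- prodSigned n fs) ≡⟨ ℚₚ.*-distribˡ-+ ½ (prodCD n fs) (ℚ.- prodSigned n fs) ⟩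
  ½ ℚ.* prodCD n fs ℚ.+ ½ ℚ.* (ℚ.- prodSigned n fs) ≡⟨ cong (½ ℚ.* prodCD n fs ℚ.+_) (ℚₚ.neg-distribʳ-* ½ (prodSigned n fs)) ⟨
  formula n fs ∎
  where
  open ≡-Reasoning
  n = value fs
  S = ∑ (λ x → ⟦ GoodMinus? n fs x ⟧) (FiniteSetoid.elems (residues n ×ᶠ residues n))
  A = weightedSum n one-weight fs
  B = weightedSum n power-weight fs

theorem3p8 : (n : ℕ) → Composite n → ¬ (2 ∣ n) →
    (fs : Factorisation) → IsPrimeFactorisation n fs →
    Σ ℕ (λ L → IsCount n (LiarMinus n fs) L × toℚ L ≡ formula n fs)
theorem3p8 n composite 2∤n fs (primes , exponents , unique , refl) =
  length (goodPairs n fs) , goodPairs-count n fs (ℕ.nonTrivial⇒n>1 n {{composite⇒nonTrivial composite}}) ,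
  count-formula fs {{ℕ.nonTrivial⇒nonZero n {{composite⇒nonTrivial composite}}}} 2∤n (prime-factors fs primes exponents ℕ∣.∣-refl) unique
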